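{- There is a randomized algorithm such that, on input an Additive Transversal instance $(m,k,A,B)$ over $\mathbb{Z}_m$ with support size $s=|\operatorname{supp}(A)|$, the algorithm either reports failure or outputs a correct solution. If a solution exists, then the algorithm outputs a solution with probability at least $2/3$ in time $$(k+1)^{s-1}\,\operatorname{poly}(k,s,\log m).$$ The failure probability can be reduced by independent repetition. In particular, the problem is randomized polynomial-time solvable for every fixed support size $s$.
   Context: Fix integers $m\ge 1$ and $1\le k\le m$; $m$ is arbitrary (not necessarily prime). An Additive Transversal instance consists of a sequence $A=(a_1,\dots,a_k)\in(\mathbb{Z}_m)^k$ (repetitions allowed) and a set $B\subseteq\mathbb{Z}_m$ of cardinality $k$. A solution is an ordering $b_1,\dots,b_k$ of the elements of $B$ such that the sums $a_1+b_1,\dots,a_k+b_k$ are pairwise distinct in $\mathbb{Z}_m$. The support $\operatorname{supp}(A)$ is the set of distinct values appearing in $A$. The notation $\operatorname{poly}(\cdot)$ denotes a fixed polynomial in its arguments, independent of the instance. Running time is measured in bit complexity, with elements of $\mathbb{Z}_m$ represented by $O(\log m)$ bits. -}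

module Defs where

open import Data.Bool using (Bool; true; false; if_then_else_)
open import Data.Fin using (Fin; toℕ; _≟_)
open import Data.Fin.Subset using (Subset; ∣_∣)
open import Data.Fin.Subset.Properties using (_∈?_)
import Data.Integer as ℤ
open import Data.List using (List; []; _∷_; length; filter; allFin; deduplicate; map)
open import Data.List.Membership.Propositional using (_∈_)
open import Data.List.Relation.Binary.Permutation.Propositional using (_↭_)
open import Data.List.Relation.Unary.All using (All; []; _∷_; lookup)
open import Data.List.Relation.Unary.Any using (here; there)
open import Data.Nat using (ℕ; zero; suc; _+_; _*_; _^_; _∸_; _≤_; _≡ᵇ_; NonZero; _/_; _%_)
open import Data.Nat.DivMod using (_mod_)
open import Data.Nat.Logarithm using (⌊log₂_⌋)
open import Data.Nat.Properties using (m^n≢0)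
open import Data.Product using (Σ-syntax; ∃-syntax; _×_; _,_; proj₁; proj₂)
open import Data.Rational.Unnormalised as ℚᵘ using (ℚᵘ)
open import Data.Sum using (_⊎_; inj₁; inj₂)
open import Data.Unit using (⊤; tt)
open import Data.Vec as Vec using (Vec; []; _∷_; toList; zipWith)
open import Data.Vec.Relation.Unary.Unique.Propositional using (Unique)
open import Function using (_∘_)
open import Relation.Binary.PropositionalEquality using (_≡_; refl)

------------------------------------------------------------------------
-- Additive Transversal

-- ℤ_m is Fin m with addition modulo m.
_+ₘ_ : ∀ {m} .{{_ : NonZero m}} → Fin m → Fin m → Fin m
_+ₘ_ {m} a b = (toℕ a + toℕ b) mod m

-- The constraint k ≤ m is implied by ∣ B ∣ ≡ k.
record Instance : Set where
  field
    m k       : ℕ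
    {{m≢0}}   : NonZero m
    {{k≢0}}   : NonZero k
    A         : Vec (Fin m) k
    B         : Subset m
    ∣B∣≡k     : ∣ B ∣ ≡ k

elements : ∀ {m} → Subset m → List (Fin m)
elements {m} B = filter (_∈? B) (allFin m)

module _ (I : Instance) where
  open Instance I

  supp : List (Fin m)
  supp = deduplicate _≟_ (toList A)

  supportSize : ℕ
  supportSize = length supp

  record IsSolution (b : Vec (Fin m) k) : Set where
    field
      ordersB      : toList b ↭ elements B
      distinctSums : Unique (zipWith _+ₘ_ A b)

  Solvable : Set
  Solvable = ∃[ b ] IsSolution b

------------------------------------------------------------------------
-- Randomized programs and their bit cost
--
-- Algorithms are finite programs of a first-order language with
-- unbounded loops and fair coin tosses, over data built from bits by
-- sums, products and lists.  There is no built-in arithmetic.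

data Ty : Set where
  𝟙 bit   : Ty
  _⊕_ _⊗_ : Ty → Ty → Ty
  list    : Ty → Ty

infixr 5 _⊕_
infixr 6 _⊗_

⟦_⟧ : Ty → Set
⟦ 𝟙 ⟧      = ⊤
⟦ bit ⟧    = Bool
⟦ σ ⊕ τ ⟧  = ⟦ σ ⟧ ⊎ ⟦ τ ⟧
⟦ σ ⊗ τ ⟧  = ⟦ σ ⟧ × ⟦ τ ⟧
⟦ list τ ⟧ = List ⟦ τ ⟧

-- The length, up to a constant factor, of a value written out in full
-- as a bit string.
size : ∀ τ → ⟦ τ ⟧ → ℕ
size 𝟙        _        = 1
size bit      _        = 1
size (σ ⊕ τ)  (inj₁ v) = suc (size σ v)
size (σ ⊕ τ)  (inj₂ v) = suc (size τ v)
size (σ ⊗ τ)  (v , w)  = suc (size σ v + size τ w)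
size (list τ) []       = 1
size (list τ) (v ∷ vs) = suc (size τ v + size (list τ) vs)

data Expr (Γ : List Ty) : Ty → Set where
  var     : ∀ {τ} → τ ∈ Γ → Expr Γ τ
  letin   : ∀ {σ τ} → Expr Γ σ → Expr (σ ∷ Γ) τ → Expr Γ τ
  call    : ∀ {σ τ} → Expr (σ ∷ []) τ → Expr Γ σ → Expr Γ τ
  unit    : Expr Γ 𝟙
  const   : Bool → Expr Γ bit
  cond    : ∀ {τ} → Expr Γ bit → Expr Γ τ → Expr Γ τ → Expr Γ τ
  pair    : ∀ {σ τ} → Expr Γ σ → Expr Γ τ → Expr Γ (σ ⊗ τ)
  fst     : ∀ {σ τ} → Expr Γ (σ ⊗ τ) → Expr Γ σ
  snd     : ∀ {σ τ} → Expr Γ (σ ⊗ τ) → Expr Γ τ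
  inl     : ∀ {σ τ} → Expr Γ σ → Expr Γ (σ ⊕ τ)
  inr     : ∀ {σ τ} → Expr Γ τ → Expr Γ (σ ⊕ τ)
  case    : ∀ {σ τ υ} → Expr Γ (σ ⊕ τ) → Expr (σ ∷ Γ) υ → Expr (τ ∷ Γ) υ → Expr Γ υ
  nil     : ∀ {τ} → Expr Γ (list τ)
  cons    : ∀ {τ} → Expr Γ τ → Expr Γ (list τ) → Expr Γ (list τ)
  uncons  : ∀ {τ} → Expr Γ (list τ) → Expr Γ (𝟙 ⊕ τ ⊗ list τ)
  -- Run the body on the current state; inj₁ is the next state, inj₂
  -- the final result.
  loop    : ∀ {σ τ} → Expr (σ ∷ Γ) (σ ⊕ τ) → Expr Γ σ → Expr Γ τ
  toss    : Expr Γ bit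

Program : Ty → Ty → Set
Program σ τ = Expr (σ ∷ []) τ

Env : List Ty → Set
Env = All ⟦_⟧

unconsValue : ∀ {A : Set} → List A → ⊤ ⊎ (A × List A)
unconsValue []       = inj₁ tt
unconsValue (x ∷ xs) = inj₂ (x , xs)

-- ρ ⊢ e ∣ ω ⇓ v ∣ ω′ ∣ t :  in environment ρ and with coin outcomes ω
-- still to come, e terminates with value v at cost t, leaving ω′.
--
-- Reading a variable copies its value and is charged the full size of
-- that value; every other construct costs one.  Hence the cost bounds
-- the size of the result (so each intermediate value has been paid for
-- bit by bit), and a fixed program runs on a probabilistic multitape
-- Turing machine in time linear in its cost.
infix 3 _⊢_∣_⇓_∣_∣_ _⊢loop_,_∣_⇓_∣_∣_

mutual
  data _⊢_∣_⇓_∣_∣_ {Γ} (ρ : Env Γ) : ∀ {τ} → Expr Γ τ → List Bool → ⟦ τ ⟧ → List Bool → ℕ → Set where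
    ⇓var    : ∀ {τ} {x : τ ∈ Γ} {ω} →
              ρ ⊢ var x ∣ ω ⇓ lookup ρ x ∣ ω ∣ size τ (lookup ρ x)
    ⇓letin  : ∀ {σ τ} {d : Expr Γ σ} {e : Expr (σ ∷ Γ) τ} {v w ω ω′ ω″ s t} →
              ρ ⊢ d ∣ ω ⇓ v ∣ ω′ ∣ s →
              v ∷ ρ ⊢ e ∣ ω′ ⇓ w ∣ ω″ ∣ t →
              ρ ⊢ letin d e ∣ ω ⇓ w ∣ ω″ ∣ suc (s + t)
    ⇓call   : ∀ {σ τ} {p : Expr (σ ∷ []) τ} {d : Expr Γ σ} {v w ω ω′ ω″ s t} →
              ρ ⊢ d ∣ ω ⇓ v ∣ ω′ ∣ s →
              v ∷ [] ⊢ p ∣ ω′ ⇓ w ∣ ω″ ∣ t →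
              ρ ⊢ call p d ∣ ω ⇓ w ∣ ω″ ∣ suc (s + t)
    ⇓unit   : ∀ {ω} → ρ ⊢ unit ∣ ω ⇓ tt ∣ ω ∣ 1
    ⇓const  : ∀ {b ω} → ρ ⊢ const b ∣ ω ⇓ b ∣ ω ∣ 1
    ⇓true   : ∀ {τ} {c} {d e : Expr Γ τ} {v ω ω′ ω″ s t} →
              ρ ⊢ c ∣ ω ⇓ true ∣ ω′ ∣ s →
              ρ ⊢ d ∣ ω′ ⇓ v ∣ ω″ ∣ t →
              ρ ⊢ cond c d e ∣ ω ⇓ v ∣ ω″ ∣ suc (s + t)
    ⇓false  : ∀ {τ} {c} {d e : Expr Γ τ} {v ω ω′ ω″ s t} →
              ρ ⊢ c ∣ ω ⇓ false ∣ ω′ ∣ s →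
              ρ ⊢ e ∣ ω′ ⇓ v ∣ ω″ ∣ t →
              ρ ⊢ cond c d e ∣ ω ⇓ v ∣ ω″ ∣ suc (s + t)
    ⇓pair   : ∀ {σ τ} {d : Expr Γ σ} {e : Expr Γ τ} {v w ω ω′ ω″ s t} →
              ρ ⊢ d ∣ ω ⇓ v ∣ ω′ ∣ s →
              ρ ⊢ e ∣ ω′ ⇓ w ∣ ω″ ∣ t →
              ρ ⊢ pair d e ∣ ω ⇓ (v , w) ∣ ω″ ∣ suc (s + t)
    ⇓fst    : ∀ {σ τ} {e : Expr Γ (σ ⊗ τ)} {v ω ω′ t} →
              ρ ⊢ e ∣ ω ⇓ v ∣ ω′ ∣ t →
              ρ ⊢ fst e ∣ ω ⇓ proj₁ v ∣ ω′ ∣ suc t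
    ⇓snd    : ∀ {σ τ} {e : Expr Γ (σ ⊗ τ)} {v ω ω′ t} →
              ρ ⊢ e ∣ ω ⇓ v ∣ ω′ ∣ t →
              ρ ⊢ snd e ∣ ω ⇓ proj₂ v ∣ ω′ ∣ suc t
    ⇓inl    : ∀ {σ τ} {e : Expr Γ σ} {v ω ω′ t} →
              ρ ⊢ e ∣ ω ⇓ v ∣ ω′ ∣ t →
              ρ ⊢ inl {τ = τ} e ∣ ω ⇓ inj₁ v ∣ ω′ ∣ suc t
    ⇓inr    : ∀ {σ τ} {e : Expr Γ τ} {v ω ω′ t} →
              ρ ⊢ e ∣ ω ⇓ v ∣ ω′ ∣ t →
              ρ ⊢ inr {σ = σ} e ∣ ω ⇓ inj₂ v ∣ ω′ ∣ suc t
    ⇓case₁  : ∀ {σ τ υ} {c : Expr Γ (σ ⊕ τ)} {d : Expr (σ ∷ Γ) υ} {e : Expr (τ ∷ Γ) υ}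
              {v w ω ω′ ω″ s t} →
              ρ ⊢ c ∣ ω ⇓ inj₁ v ∣ ω′ ∣ s →
              v ∷ ρ ⊢ d ∣ ω′ ⇓ w ∣ ω″ ∣ t →
              ρ ⊢ case c d e ∣ ω ⇓ w ∣ ω″ ∣ suc (s + t)
    ⇓case₂  : ∀ {σ τ υ} {c : Expr Γ (σ ⊕ τ)} {d : Expr (σ ∷ Γ) υ} {e : Expr (τ ∷ Γ) υ}
              {v w ω ω′ ω″ s t} →
              ρ ⊢ c ∣ ω ⇓ inj₂ v ∣ ω′ ∣ s →
              v ∷ ρ ⊢ e ∣ ω′ ⇓ w ∣ ω″ ∣ t →
              ρ ⊢ case c d e ∣ ω ⇓ w ∣ ω″ ∣ suc (s + t)
    ⇓nil    : ∀ {τ ω} → ρ ⊢ nil {τ = τ} ∣ ω ⇓ [] ∣ ω ∣ 1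
    ⇓cons   : ∀ {τ} {d : Expr Γ τ} {e : Expr Γ (list τ)} {v vs ω ω′ ω″ s t} →
              ρ ⊢ d ∣ ω ⇓ v ∣ ω′ ∣ s →
              ρ ⊢ e ∣ ω′ ⇓ vs ∣ ω″ ∣ t →
              ρ ⊢ cons d e ∣ ω ⇓ v ∷ vs ∣ ω″ ∣ suc (s + t)
    ⇓uncons : ∀ {τ} {e : Expr Γ (list τ)} {vs ω ω′ t} →
              ρ ⊢ e ∣ ω ⇓ vs ∣ ω′ ∣ t →
              ρ ⊢ uncons e ∣ ω ⇓ unconsValue vs ∣ ω′ ∣ suc t
    ⇓loop   : ∀ {σ τ} {b : Expr (σ ∷ Γ) (σ ⊕ τ)} {e : Expr Γ σ} {v w ω ω′ ω″ s t} →
              ρ ⊢ e ∣ ω ⇓ v ∣ ω′ ∣ s →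
              ρ ⊢loop b , v ∣ ω′ ⇓ w ∣ ω″ ∣ t →
              ρ ⊢ loop b e ∣ ω ⇓ w ∣ ω″ ∣ suc (s + t)
    ⇓toss   : ∀ {c ω} → ρ ⊢ toss ∣ c ∷ ω ⇓ c ∣ ω ∣ 1

  data _⊢loop_,_∣_⇓_∣_∣_ {Γ} (ρ : Env Γ) {σ τ} (b : Expr (σ ∷ Γ) (σ ⊕ τ)) (v : ⟦ σ ⟧)
       : List Bool → ⟦ τ ⟧ → List Bool → ℕ → Set where
    stop     : ∀ {w ω ω′ t} →
               v ∷ ρ ⊢ b ∣ ω ⇓ inj₂ w ∣ ω′ ∣ t →
               ρ ⊢loop b , v ∣ ω ⇓ w ∣ ω′ ∣ suc t
    continue : ∀ {v′ w ω ω′ ω″ s t} →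
               v ∷ ρ ⊢ b ∣ ω ⇓ inj₁ v′ ∣ ω′ ∣ s →
               ρ ⊢loop b , v′ ∣ ω′ ⇓ w ∣ ω″ ∣ t →
               ρ ⊢loop b , v ∣ ω ⇓ w ∣ ω″ ∣ suc (s + t)

-- On input x, p halts with cost at most T on every sequence of coin
-- outcomes.  No run needs more than `coins` tosses, so the distribution
-- of the result is its distribution over uniform strings in
-- {0,1}^coins (tosses left over at the end do not affect it).
record RunsWithin {σ τ} (p : Program σ τ) (x : ⟦ σ ⟧) (T : ℕ) : Set where
  field
    coins  : ℕ
    result : Vec Bool coins → ⟦ τ ⟧
    halts  : ∀ r → ∃[ ω ] ∃[ t ] (x ∷ [] ⊢ p ∣ toList r ⇓ result r ∣ ω ∣ t) × t ≤ T

#_ : ∀ {n} → (Vec Bool n → Bool) → ℕ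
#_ {zero}  P = if P [] then 1 else 0
#_ {suc n} P = # (P ∘ (false ∷_)) + # (P ∘ (true ∷_))

Pr : ∀ {n} → (Vec Bool n → Bool) → ℚᵘ
Pr {n} P = ℚᵘ._/_ (ℤ.+ (# P)) (2 ^ n) {{m^n≢0 2 n}}

------------------------------------------------------------------------
-- Algorithms for Additive Transversal

num : Ty
num = list bit

-- The w lowest binary digits of n, least significant first.
toBits : ℕ → ℕ → List Bool
toBits zero    n = []
toBits (suc w) n = (n % 2 ≡ᵇ 1) ∷ toBits w (n / 2)

InputTy : Ty
InputTy = num ⊗ num ⊗ list num ⊗ list num

-- inj₁ reports failure.
OutputTy : Ty
OutputTy = 𝟙 ⊕ list num

module _ (I : Instance) where
  open Instance I

  -- Every number occurring in an instance is at most m < 2 ^ width.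
  width : ℕ
  width = suc ⌊log₂ m ⌋

  encodeElements : List (Fin m) → List (List Bool)
  encodeElements = map (toBits width ∘ toℕ)

  encode : ⟦ InputTy ⟧
  encode = toBits width m , toBits width k , encodeElements (toList A) , encodeElements (elements B)

  inputSize : ℕ
  inputSize = size InputTy encode

  FailureOrSolution : ⟦ OutputTy ⟧ → Set
  FailureOrSolution o =
    o ≡ inj₁ tt ⊎ (∃[ b ] IsSolution I b × o ≡ inj₂ (encodeElements (toList b)))

succeeds : ⟦ OutputTy ⟧ → Bool
succeeds (inj₁ _) = false
succeeds (inj₂ _) = true

record Solves (p : Program InputTy OutputTy) (I : Instance) (T : ℕ) (α : ℚᵘ) : Set where
  field
    runs : RunsWithin p (encode I) T
  open RunsWithin runs public
  field
    correct  : ∀ r → FailureOrSolution I (result r)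
    reliable : Solvable I → α ℚᵘ.≤ Pr (succeeds ∘ result)

-- Up to n runs of p on the same input with fresh coins, returning the
-- first solution found.
repeat : ℕ → Program InputTy OutputTy → Program InputTy OutputTy
repeat zero    p = inl unit
repeat (suc n) p = case p (call (repeat n p) (var (there (here refl)))) (inr (var (here refl)))

------------------------------------------------------------------------
-- Polynomial bounds

data Poly (n : ℕ) : Set where
  con       : ℕ → Poly n
  var       : Fin n → Poly n
  _:+_ _:*_ : Poly n → Poly n → Poly n

eval : ∀ {n} → Poly n → Vec ℕ n → ℕ
eval (con c)  xs = c
eval (var i)  xs = Vec.lookup xs i
eval (p :+ q) xs = eval p xs + eval q xs
eval (p :* q) xs = eval p xs * eval q xs

-- (k + 1)^(s - 1) · q(k, s, log m)
timeBound : Poly 3 → Instance → ℕ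
timeBound q I = suc k ^ (s ∸ 1) * eval q (k ∷ s ∷ ⌊log₂ m ⌋ ∷ [])
  where
  open Instance I
  s = supportSize I

RandomizedPolyTimeSolvable : (Instance → Set) → Set
RandomizedPolyTimeSolvable C =
  Σ[ p ∈ Program InputTy OutputTy ] Σ[ q ∈ Poly 1 ]
    (∀ I → C I → Solves p I (eval q (inputSize I ∷ [])) (ℤ.+ 2 ℚᵘ./ 3))

{-# OPTIONS --safe #-}
module Submission where

-- A solution is the same as a colouring φ : B → supp A that uses each v
-- exactly as often as A does (n_v times) and makes b ↦ b + φ b injective.
-- Over 𝔽₂[z] take a variable y_v for each v ∈ supp A but one (whose y_v
-- is 1), scalars x_{b,v}, and a node t_c for each c ∈ ℤ_m, namely the
-- polynomial whose coefficients are the bits of c.  Then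
--
--   det (∑_v x_{b,v} y_v t_{b+v}^j)_{b ∈ B, j < k}
--     = ∑_φ ∏_b x_{b,φ b} · ∏_b y_{φ b} · Vandermonde (t_{b+φ b})_b ,
--
-- so the coefficient of ∏_v y_v^{n_v} is a sum over the solutions, and is
-- a nonzero polynomial in the x_{b,v} iff there is one.  Up to a nonzero
-- factor, this coefficient is a weighted sum of the determinant over the
-- (k + 1)^(s - 1) points y_v = z^j, j ≤ k: if the weights w_j are the
-- coefficients of ∏ (z^e + T) over the e ≤ k other than n_v, then
-- ∑_j w_j z^(j c) = ∏ (z^e + z^c) vanishes for c ≤ k unless c = n_v.
-- As it is affine in every x_{b,v}, it is nonzero with high probability
-- for random x_{b,v} (Schwartz–Zippel), and as it is additive in every row
-- the colours of the elements of B can then be fixed one after the other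
-- while it stays nonzero.  Characteristic 2 makes all signs disappear, and
-- Bird's algorithm computes determinants without division.

-- The scalars x keep solutions from cancelling: each colouring φ has its own monomial in them. Its
-- coefficient is nonzero because distinct elements of ℤ_m have distinct bit patterns and 𝔽₂[z] is
-- an integral domain. Working over 𝔽₂[z] avoids the search for an irreducible polynomial but leaves
-- no inverses, so interpolation is done only up to a nonzero factor. Setting one variable to 1
-- loses nothing, since the determinant is homogeneous of degree k in the y_v, and it saves a factor
-- k + 1 in the size of the grid.
--
-- The running time concerns programs of a language whose only iteration is a loop and which has no
-- arithmetic. Hence every function of the algorithm is built from combinators that carry a program,
-- its evaluation, a cost bound and a bound on the size of the output. The coins are tossed in
-- advance into a list whose length depends on the input alone, so that the rest is deterministic.
-- Sizes are controlled through degrees: sums take the maximum of the degrees, products add them.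

open import Defs

-- Programs with cost bounds

module Cost where

  open import Data.Bool using (Bool; true; false; if_then_else_)
  open import Data.Fin using (Fin; zero; suc)
  open import Data.List using (List; []; _∷_; length)
  open import Data.List.Relation.Unary.All using ([]; _∷_)
  open import Data.List.Relation.Unary.Any using (here; there)
  open import Data.Nat using (ℕ; zero; suc; _+_; _*_; _≤_; s≤s; z≤n)
  open import Data.Nat.Properties
  open import Data.Product using (∃-syntax; _×_; _,_; proj₁; proj₂)
  open import Data.Sum using (_⊎_; inj₁; inj₂; [_,_]′)
  open import Data.Unit using (tt)
  open import Data.Vec as Vec using (Vec; []; _∷_)
  open import Function using (id)
  open import Relation.Binary.PropositionalEquality using (_≡_; refl; sym; cong₂)

  ⟪_⟫ : Poly 1 → ℕ → ℕ
  ⟪ q ⟫ n = eval q (n ∷ [])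

  X : Poly 1
  X = var zero

  -- Coefficients are natural numbers, so a bound stays valid when a size is replaced by an upper
  -- bound for it. This is what lets cost bounds compose.
  eval-mono : ∀ {n} (q : Poly n) {xs ys : Vec ℕ n} → (∀ i → Vec.lookup xs i ≤ Vec.lookup ys i) →
              eval q xs ≤ eval q ys
  eval-mono (con c)  le = ≤-refl
  eval-mono (var i)  le = le i
  eval-mono (p :+ q) le = +-mono-≤ (eval-mono p le) (eval-mono q le)
  eval-mono (p :* q) le = *-mono-≤ (eval-mono p le) (eval-mono q le)

  mono : ∀ q {m n} → m ≤ n → ⟪ q ⟫ m ≤ ⟪ q ⟫ n
  mono q le = eval-mono q λ { zero → le }

  infixl 21 _⊙_

  -- Substitution of polynomials: it turns a cost in the size of an intermediate value into a cost
  -- in the size of the original input.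
  _⊙_ : ∀ {n} → Poly 1 → Poly n → Poly n
  con c    ⊙ r = con c
  var zero ⊙ r = r
  (p :+ q) ⊙ r = (p ⊙ r) :+ (q ⊙ r)
  (p :* q) ⊙ r = (p ⊙ r) :* (q ⊙ r)

  eval-⊙ : ∀ {n} q (r : Poly n) xs → eval (q ⊙ r) xs ≡ ⟪ q ⟫ (eval r xs)
  eval-⊙ (con c)    r xs = refl
  eval-⊙ (var zero) r xs = refl
  eval-⊙ (p :+ q)   r xs = cong₂ _+_ (eval-⊙ p r xs) (eval-⊙ q r xs)
  eval-⊙ (p :* q)   r xs = cong₂ _*_ (eval-⊙ p r xs) (eval-⊙ q r xs)

  ≤-⊙ : ∀ {n} q (r : Poly n) {m} xs → m ≤ eval r xs → ⟪ q ⟫ m ≤ eval (q ⊙ r) xs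
  ≤-⊙ q r xs le = ≤-trans (mono q le) (≤-reflexive (sym (eval-⊙ q r xs)))

  1≤size : ∀ τ (v : ⟦ τ ⟧) → 1 ≤ size τ v
  1≤size 𝟙        _        = ≤-refl
  1≤size bit      _        = ≤-refl
  1≤size (σ ⊕ τ)  (inj₁ _) = s≤s z≤n
  1≤size (σ ⊕ τ)  (inj₂ _) = s≤s z≤n
  1≤size (σ ⊗ τ)  _        = s≤s z≤n
  1≤size (list τ) []       = s≤s z≤n
  1≤size (list τ) (_ ∷ _)  = s≤s z≤n

  length≤size : ∀ τ (xs : List ⟦ τ ⟧) → suc (length xs) ≤ size (list τ) xs
  length≤size τ []       = ≤-refl
  length≤size τ (x ∷ xs) = s≤s (≤-trans (length≤size τ xs) (m≤n+m _ _))

  variable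
    σ τ υ γ : Ty

  -- The factor ν isolates the superpolynomial part of the running time: it
  -- is 1 except for the sum over the grid and what is built on it.
  record Comp (ν : ⟦ σ ⟧ → ℕ) (f : ⟦ σ ⟧ → ⟦ τ ⟧) : Set where
    field
      prog     : Program σ τ
      cost out : Poly 1
      1≤ν      : ∀ x → 1 ≤ ν x
      -- The stream ω comes back untouched: these programs toss no coins.
      runs     : ∀ x ω → ∃[ t ] (x ∷ [] ⊢ prog ∣ ω ⇓ f x ∣ ω ∣ t) × t ≤ ν x * ⟪ cost ⟫ (size σ x)
      -- No factor ν here. Even a computation with superpolynomial running time has a result of
      -- polynomial size, so later stages do not pay for ν again.
      small    : ∀ x → size τ (f x) ≤ ⟪ out ⟫ (size σ x)

  open Comp public

  one : ∀ {A : Set} → A → ℕ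
  one _ = 1

  PT : (⟦ σ ⟧ → ⟦ τ ⟧) → Set
  PT {σ} f = Comp {σ} one f

  weaken : ∀ {n c} → 1 ≤ n → c ≤ n * c
  weaken {n} {c} 1≤n = ≤-trans (≤-reflexive (sym (*-identityˡ c))) (*-monoˡ-≤ c 1≤n)

  step₁ : ∀ {n s} c → 1 ≤ n → s ≤ n * c → suc s ≤ n * (1 + c)
  step₁ {n} c 1≤n le = ≤-trans (+-mono-≤ 1≤n le) (≤-reflexive (sym (*-suc n c)))

  step₂ : ∀ {n s t} c d → 1 ≤ n → s ≤ n * c → t ≤ n * d → suc (s + t) ≤ n * (1 + (c + d))
  step₂ {n} c d 1≤n le le′ =
    step₁ {n} (c + d) 1≤n (≤-trans (+-mono-≤ le le′) (≤-reflexive (sym (*-distribˡ-+ n c d))))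

  reweigh : {ν μ : ⟦ σ ⟧ → ℕ} {f : ⟦ σ ⟧ → ⟦ τ ⟧} → (∀ x → μ x ≤ ν x) → Comp μ f → Comp ν f
  reweigh le p .prog = p .prog
  reweigh le p .cost = p .cost
  reweigh le p .out = p .out
  reweigh le p .1≤ν x = ≤-trans (p .1≤ν x) (le x)
  reweigh le p .runs x ω = let t , d , b = p .runs x ω in t , d , ≤-trans b (*-monoˡ-≤ _ (le x))
  reweigh le p .small = p .small

  weigh : {ν : ⟦ σ ⟧ → ℕ} {f : ⟦ σ ⟧ → ⟦ τ ⟧} → (∀ x → 1 ≤ ν x) → PT f → Comp ν f
  weigh = reweigh

  -- The program is unchanged. A function is compiled in the shape that the combinators offer, such
  -- as a fold or a case split, and is then credited to its readable definition.
  convert : {ν : ⟦ σ ⟧ → ℕ} {f g : ⟦ σ ⟧ → ⟦ τ ⟧} → (∀ x → f x ≡ g x) → Comp ν f → Comp ν g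
  convert eq p .prog = p .prog
  convert eq p .cost = p .cost
  convert eq p .out = p .out
  convert eq p .1≤ν = p .1≤ν
  convert {f = f} eq p .runs x ω with f x | eq x | p .runs x ω
  ... | _ | refl | r = r
  convert {f = f} eq p .small x with f x | eq x | p .small x
  ... | _ | refl | r = r

  idᶜ : PT {σ} id
  idᶜ .prog = var (here refl)
  idᶜ .cost = X
  idᶜ .out = X
  idᶜ .1≤ν _ = ≤-refl
  idᶜ .runs x ω = _ , ⇓var , weaken ≤-refl
  idᶜ .small x = ≤-refl

  unitᶜ : PT {σ} (λ _ → tt)
  unitᶜ .prog = unit
  unitᶜ .cost = con 1
  unitᶜ .out = con 1
  unitᶜ .1≤ν _ = ≤-refl
  unitᶜ .runs x ω = _ , ⇓unit , ≤-refl
  unitᶜ .small x = ≤-refl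

  constᶜ : ∀ b → PT {σ} (λ _ → b)
  constᶜ b .prog = const b
  constᶜ b .cost = con 1
  constᶜ b .out = con 1
  constᶜ b .1≤ν _ = ≤-refl
  constᶜ b .runs x ω = _ , ⇓const , ≤-refl
  constᶜ b .small x = ≤-refl

  nilᶜ : PT {σ} {list τ} (λ _ → [])
  nilᶜ .prog = nil
  nilᶜ .cost = con 1
  nilᶜ .out = con 1
  nilᶜ .1≤ν _ = ≤-refl
  nilᶜ .runs x ω = _ , ⇓nil , ≤-refl
  nilᶜ .small x = ≤-refl

  module _ {ν : ⟦ σ ⟧ → ℕ} where

    fstᶜ : {f : ⟦ σ ⟧ → ⟦ τ ⟧ × ⟦ υ ⟧} → Comp {τ = τ ⊗ υ} ν f → Comp {τ = τ} ν (λ x → proj₁ (f x))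
    fstᶜ p .prog = fst (p .prog)
    fstᶜ p .cost = con 1 :+ p .cost
    fstᶜ p .out = p .out
    fstᶜ p .1≤ν = p .1≤ν
    fstᶜ p .runs x ω = let t , d , b = p .runs x ω in _ , ⇓fst d , step₁ {ν x} _ (p .1≤ν x) b
    fstᶜ p .small x = ≤-trans (≤-trans (m≤m+n _ _) (n≤1+n _)) (p .small x)

    sndᶜ : {f : ⟦ σ ⟧ → ⟦ τ ⟧ × ⟦ υ ⟧} → Comp {τ = τ ⊗ υ} ν f → Comp {τ = υ} ν (λ x → proj₂ (f x))
    sndᶜ p .prog = snd (p .prog)
    sndᶜ p .cost = con 1 :+ p .cost
    sndᶜ p .out = p .out
    sndᶜ p .1≤ν = p .1≤ν
    sndᶜ p .runs x ω = let t , d , b = p .runs x ω in _ , ⇓snd d , step₁ {ν x} _ (p .1≤ν x) b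
    sndᶜ p .small x = ≤-trans (≤-trans (m≤n+m _ _) (n≤1+n _)) (p .small x)

    inlᶜ : {f : ⟦ σ ⟧ → ⟦ τ ⟧} → Comp {τ = τ} ν f → Comp {τ = τ ⊕ υ} ν (λ x → inj₁ (f x))
    inlᶜ p .prog = inl (p .prog)
    inlᶜ p .cost = con 1 :+ p .cost
    inlᶜ p .out = con 1 :+ p .out
    inlᶜ p .1≤ν = p .1≤ν
    inlᶜ p .runs x ω = let t , d , b = p .runs x ω in _ , ⇓inl d , step₁ {ν x} _ (p .1≤ν x) b
    inlᶜ p .small x = s≤s (p .small x)

    inrᶜ : {f : ⟦ σ ⟧ → ⟦ υ ⟧} → Comp {τ = υ} ν f → Comp {τ = τ ⊕ υ} ν (λ x → inj₂ (f x))
    inrᶜ p .prog = inr (p .prog)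
    inrᶜ p .cost = con 1 :+ p .cost
    inrᶜ p .out = con 1 :+ p .out
    inrᶜ p .1≤ν = p .1≤ν
    inrᶜ p .runs x ω = let t , d , b = p .runs x ω in _ , ⇓inr d , step₁ {ν x} _ (p .1≤ν x) b
    inrᶜ p .small x = s≤s (p .small x)

    pairᶜ : {f : ⟦ σ ⟧ → ⟦ τ ⟧} {g : ⟦ σ ⟧ → ⟦ υ ⟧} → Comp {τ = τ} ν f → Comp {τ = υ} ν g →
            Comp {τ = τ ⊗ υ} ν (λ x → f x , g x)
    pairᶜ p q .prog = pair (p .prog) (q .prog)
    pairᶜ p q .cost = con 1 :+ (p .cost :+ q .cost)
    pairᶜ p q .out = con 1 :+ (p .out :+ q .out)
    pairᶜ p q .1≤ν = p .1≤ν
    pairᶜ p q .runs x ω =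
      let t , d , b = p .runs x ω
          t′ , d′ , b′ = q .runs x ω
      in _ , ⇓pair d d′ , step₂ {ν x} _ _ (p .1≤ν x) b b′
    pairᶜ p q .small x = s≤s (+-mono-≤ (p .small x) (q .small x))

    consᶜ : {f : ⟦ σ ⟧ → ⟦ τ ⟧} {g : ⟦ σ ⟧ → List ⟦ τ ⟧} → Comp {τ = τ} ν f → Comp {τ = list τ} ν g →
            Comp {τ = list τ} ν (λ x → f x ∷ g x)
    consᶜ p q .prog = cons (p .prog) (q .prog)
    consᶜ p q .cost = con 1 :+ (p .cost :+ q .cost)
    consᶜ p q .out = con 1 :+ (p .out :+ q .out)
    consᶜ p q .1≤ν = p .1≤ν
    consᶜ p q .runs x ω =
      let t , d , b = p .runs x ω
          t′ , d′ , b′ = q .runs x ω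
      in _ , ⇓cons d d′ , step₂ {ν x} _ _ (p .1≤ν x) b b′
    consᶜ p q .small x = s≤s (+-mono-≤ (p .small x) (q .small x))

    unconsᶜ : {f : ⟦ σ ⟧ → List ⟦ τ ⟧} → Comp {τ = list τ} ν f →
              Comp {τ = 𝟙 ⊕ τ ⊗ list τ} ν (λ x → unconsValue (f x))
    unconsᶜ p .prog = uncons (p .prog)
    unconsᶜ p .cost = con 1 :+ p .cost
    unconsᶜ p .out = con 1 :+ p .out
    unconsᶜ p .1≤ν = p .1≤ν
    unconsᶜ p .runs x ω = let t , d , b = p .runs x ω in _ , ⇓uncons d , step₁ {ν x} _ (p .1≤ν x) b
    unconsᶜ {f = f} p .small x = ≤-trans (uncons-size (f x)) (s≤s (p .small x))
      where
      uncons-size : ∀ {τ} (vs : List ⟦ τ ⟧) →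
                    size (𝟙 ⊕ τ ⊗ list τ) (unconsValue vs) ≤ suc (size (list τ) vs)
      uncons-size []       = ≤-refl
      uncons-size (_ ∷ _)  = ≤-refl

    condᶜ : {c : ⟦ σ ⟧ → Bool} {f g : ⟦ σ ⟧ → ⟦ τ ⟧} → Comp {τ = bit} ν c → Comp {τ = τ} ν f →
            Comp {τ = τ} ν g → Comp {τ = τ} ν (λ x → if c x then f x else g x)
    condᶜ p q r .prog = cond (p .prog) (q .prog) (r .prog)
    condᶜ p q r .cost = con 1 :+ (p .cost :+ (q .cost :+ r .cost))
    condᶜ p q r .out = q .out :+ r .out
    condᶜ p q r .1≤ν = p .1≤ν
    condᶜ {c = c} p q r .runs x ω with c x | p .runs x ω
    ... | true  | t , d , b =
      let t′ , d′ , b′ = q .runs x ω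
      in _ , ⇓true d d′ , step₂ {ν x} _ _ (p .1≤ν x) b (≤-trans b′ (*-monoʳ-≤ (ν x) (m≤m+n _ _)))
    ... | false | t , d , b =
      let t′ , d′ , b′ = r .runs x ω
      in _ , ⇓false d d′ , step₂ {ν x} _ _ (p .1≤ν x) b (≤-trans b′ (*-monoʳ-≤ (ν x) (m≤n+m _ _)))
    condᶜ {c = c} p q r .small x with c x
    ... | true  = ≤-trans (q .small x) (m≤m+n _ _)
    ... | false = ≤-trans (r .small x) (m≤n+m _ _)

    private
      branch-cost : ∀ n {sx s sv t o} c d → 1 ≤ n → s ≤ n * c → sv ≤ o → t ≤ n * d →
                    suc (s + suc (suc (sv + sx) + t)) ≤ n * (1 + (c + (1 + (1 + (o + sx) + d))))
      branch-cost n {sx} {o = o} c d 1≤n le le′ le″ =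
        step₂ {n} c _ 1≤n le
          (step₂ {n} (1 + (o + sx)) d 1≤n (≤-trans (s≤s (+-monoˡ-≤ sx le′)) (weaken 1≤n)) le″)

    -- A called program sees a single variable, so the branch receives the matched value paired with
    -- the old input. Copying this pair is charged, which is why `p .out` enters the cost.
    caseᶜ : {c : ⟦ σ ⟧ → ⟦ γ ⟧ ⊎ ⟦ υ ⟧} {f : ⟦ γ ⟧ × ⟦ σ ⟧ → ⟦ τ ⟧} {g : ⟦ υ ⟧ × ⟦ σ ⟧ → ⟦ τ ⟧} →
            Comp {τ = γ ⊕ υ} ν c → Comp {γ ⊗ σ} {τ} (λ x → ν (proj₂ x)) f → Comp {υ ⊗ σ} {τ} (λ x → ν (proj₂ x)) g →
            Comp {τ = τ} ν (λ x → [ (λ a → f (a , x)) , (λ b → g (b , x)) ]′ (c x))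
    caseᶜ p q r .prog = case (p .prog) (call (q .prog) (pair (var (here refl)) (var (there (here refl)))))
                                       (call (r .prog) (pair (var (here refl)) (var (there (here refl)))))
    caseᶜ p q r .cost = con 1 :+ (p .cost :+ (con 1 :+ ((con 1 :+ (p .out :+ X)) :+
                          (q .cost :+ r .cost) ⊙ (con 1 :+ (p .out :+ X)))))
    caseᶜ p q r .out = (q .out :+ r .out) ⊙ (con 1 :+ (p .out :+ X))
    caseᶜ p q r .1≤ν = p .1≤ν
    caseᶜ {c = c} p q r .runs x ω with c x | p .runs x ω | p .small x
    ... | inj₁ a | t , d , b | sm =
      let t′ , d′ , b′ = q .runs (a , x) ω
          sm′ = ≤-trans (n≤1+n _) sm
      in _ , ⇓case₁ d (⇓call (⇓pair ⇓var ⇓var) d′) ,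
         branch-cost (ν x) _ _ (p .1≤ν x) b sm′ (≤-trans b′ (*-monoʳ-≤ (ν x)
           (≤-trans (m≤m+n _ _) (≤-⊙ (q .cost :+ r .cost) (con 1 :+ (p .out :+ X)) _ (s≤s (+-monoˡ-≤ _ sm′))))))
    ... | inj₂ a | t , d , b | sm =
      let t′ , d′ , b′ = r .runs (a , x) ω
          sm′ = ≤-trans (n≤1+n _) sm
      in _ , ⇓case₂ d (⇓call (⇓pair ⇓var ⇓var) d′) ,
         branch-cost (ν x) _ _ (p .1≤ν x) b sm′ (≤-trans b′ (*-monoʳ-≤ (ν x)
           (≤-trans (m≤n+m _ _) (≤-⊙ (q .cost :+ r .cost) (con 1 :+ (p .out :+ X)) _ (s≤s (+-monoˡ-≤ _ sm′))))))
    caseᶜ {c = c} p q r .small x with c x | p .small x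
    ... | inj₁ a | sm = ≤-trans (q .small (a , x)) (≤-trans (m≤m+n _ _)
                          (≤-⊙ (q .out :+ r .out) (con 1 :+ (p .out :+ X)) _ (s≤s (+-monoˡ-≤ _ (≤-trans (n≤1+n _) sm)))))
    ... | inj₂ a | sm = ≤-trans (r .small (a , x)) (≤-trans (m≤n+m _ _)
                          (≤-⊙ (q .out :+ r .out) (con 1 :+ (p .out :+ X)) _ (s≤s (+-monoˡ-≤ _ (≤-trans (n≤1+n _) sm)))))

    after : {μ : ⟦ τ ⟧ → ℕ} {f : ⟦ σ ⟧ → ⟦ τ ⟧} {g : ⟦ τ ⟧ → ⟦ υ ⟧} → (∀ x → μ (f x) ≤ ν x) →
            Comp {τ} {υ} μ g → Comp {σ} {τ} ν f → Comp {σ} {υ} ν (λ x → g (f x))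
    after le q p .prog = call (q .prog) (p .prog)
    after le q p .cost = con 1 :+ (p .cost :+ q .cost ⊙ p .out)
    after le q p .out = q .out ⊙ p .out
    after le q p .1≤ν = p .1≤ν
    after {f = f} le q p .runs x ω =
      let t , d , b = p .runs x ω
          t′ , d′ , b′ = q .runs (f x) ω
      in _ , ⇓call d d′ , step₂ {ν x} _ _ (p .1≤ν x) b
           (≤-trans b′ (*-mono-≤ (le x) (≤-⊙ (q .cost) (p .out) _ (p .small x))))
    after {f = f} le q p .small x = ≤-trans (q .small (f x)) (≤-⊙ (q .out) (p .out) _ (p .small x))

  infixr 5 _▹_

  _▹_ : {f : ⟦ σ ⟧ → ⟦ τ ⟧} {g : ⟦ τ ⟧ → ⟦ υ ⟧} → PT {τ} {υ} g → PT {σ} {τ} f → PT {σ} {υ} (λ x → g (f x))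
  _▹_ = after (λ _ → ≤-refl)

  -- A terminating run of the loop with its number of rounds. The bound `M` is demanded of every
  -- state, because the cost of a round is known only in terms of the state at its beginning.
  data Iterates (γ : Ty) {σ τ} (b : ⟦ γ ⟧ × ⟦ σ ⟧ → ⟦ σ ⟧ ⊎ ⟦ τ ⟧) (c : ⟦ γ ⟧) (M : ℕ) :
                ⟦ σ ⟧ → ⟦ τ ⟧ → ℕ → Set where
    stop     : ∀ {s w} → size σ s ≤ M → b (c , s) ≡ inj₂ w → Iterates γ b c M s w 1
    continue : ∀ {s s′ w n} → size σ s ≤ M → b (c , s) ≡ inj₁ s′ → Iterates γ b c M s′ w n →
               Iterates γ b c M s w (suc n)

  module _ {μ : ⟦ γ ⟧ → ℕ} {b : ⟦ γ ⟧ × ⟦ σ ⟧ → ⟦ σ ⟧ ⊎ ⟦ τ ⟧} (B : Comp {γ ⊗ σ} {σ ⊕ τ} (λ x → μ (proj₁ x)) b) where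

    private
      body : Expr (σ ∷ γ ⊗ σ ∷ []) (σ ⊕ τ)
      body = call (B .prog) (pair (fst (var (there (here refl)))) (var (here refl)))

      step-cost : Poly 1 → Poly 1
      step-cost r = con 1 :+ (con 1 :+ ((con 1 :+ ((con 1 :+ X) :+ r)) :+ B .cost ⊙ (con 1 :+ (X :+ r))))

      module _ (c : ⟦ γ ⟧) (s₀ : ⟦ σ ⟧) (r : Poly 1) where
        N = size (γ ⊗ σ) (c , s₀)

        body-runs : ∀ s ω → size σ s ≤ ⟪ r ⟫ N →
                    ∃[ t ] (s ∷ (c , s₀) ∷ [] ⊢ body ∣ ω ⇓ b (c , s) ∣ ω ∣ t) × suc t ≤ μ c * ⟪ step-cost r ⟫ N
        body-runs s ω le =
          let t , d , t≤ = B .runs (c , s) ω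
              1≤μ = B .1≤ν (c , s)
          in _ , ⇓call (⇓pair (⇓fst ⇓var) ⇓var) d ,
             step₁ {μ c} _ 1≤μ (step₂ {μ c} (1 + ((1 + N) + ⟪ r ⟫ N)) _ 1≤μ
               (≤-trans (s≤s (+-monoʳ-≤ (1 + N) le)) (weaken 1≤μ))
               (≤-trans t≤ (*-monoʳ-≤ (μ c) (≤-⊙ (B .cost) (con 1 :+ (X :+ r)) _
                 (s≤s (+-mono-≤ (≤-trans (m≤m+n _ _) (n≤1+n _)) le))))))

        loop-runs : ∀ {s w n} ω → Iterates γ b c (⟪ r ⟫ N) s w n →
                    ∃[ t ] ((c , s₀) ∷ [] ⊢loop body , s ∣ ω ⇓ w ∣ ω ∣ t) × t ≤ n * (μ c * ⟪ step-cost r ⟫ N)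
        loop-runs {s} ω (stop le eq) with b (c , s) | eq | body-runs s ω le
        ... | _ | refl | t , d , t≤ = _ , stop d , ≤-trans t≤ (≤-reflexive (sym (*-identityˡ _)))
        loop-runs {s} ω (continue le eq it) with b (c , s) | eq | body-runs s ω le
        ... | _ | refl | t , d , t≤ =
          let t′ , d′ , t′≤ = loop-runs ω it
          in _ , continue d d′ , +-mono-≤ t≤ t′≤

        last-small : ∀ {s w n} → Iterates γ b c (⟪ r ⟫ N) s w n → size τ w ≤ ⟪ B .out ⊙ (con 1 :+ (X :+ r)) ⟫ N
        last-small {s} (stop le eq) with b (c , s) | eq | B .small (c , s)
        ... | _ | refl | sm = ≤-trans (≤-trans (n≤1+n _) sm) (≤-⊙ (B .out) (con 1 :+ (X :+ r)) _
                                (s≤s (+-mono-≤ (≤-trans (m≤m+n _ _) (n≤1+n _)) le)))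
        last-small (continue _ _ it) = last-small it

    -- Rounds times weight must be absorbed by ν up to a polynomial. This covers both uses: a fold,
    -- with polynomially many rounds of a possibly expensive body, and the sweep over the grid,
    -- where the number of rounds is ν itself.
    loopᶜ : {f : ⟦ γ ⟧ × ⟦ σ ⟧ → ⟦ τ ⟧} {ν : ⟦ γ ⟧ × ⟦ σ ⟧ → ℕ} (r p : Poly 1) (n : ⟦ γ ⟧ × ⟦ σ ⟧ → ℕ) →
            (∀ x → Iterates γ b (proj₁ x) (⟪ r ⟫ (size (γ ⊗ σ) x)) (proj₂ x) (f x) (n x)) →
            (∀ x → 1 ≤ ν x) → (∀ x → n x * μ (proj₁ x) ≤ ν x * ⟪ p ⟫ (size (γ ⊗ σ) x)) →
            Comp {γ ⊗ σ} {τ} ν f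
    loopᶜ r p n it 1≤ν le .prog = loop body (snd (var (here refl)))
    loopᶜ r p n it 1≤ν le .cost = con 1 :+ ((con 1 :+ X) :+ (p :* step-cost r))
    loopᶜ r p n it 1≤ν le .out = B .out ⊙ (con 1 :+ (X :+ r))
    loopᶜ r p n it 1≤ν le .1≤ν = 1≤ν
    loopᶜ {f} {ν} r p n it 1≤ν le .runs x@(c , s) ω =
      let t , d , t≤ = loop-runs c s r ω (it x)
      in _ , ⇓loop (⇓snd ⇓var) d ,
         step₂ {ν x} (1 + size (γ ⊗ σ) x) _ (1≤ν x) (weaken (1≤ν x))
           (≤-trans t≤ (≤-trans (≤-reflexive (sym (*-assoc (n x) (μ c) _)))
             (≤-trans (*-monoˡ-≤ (⟪ step-cost r ⟫ (size (γ ⊗ σ) x)) (le x)) (≤-reflexive (*-assoc (ν x) _ _)))))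
    loopᶜ r p n it 1≤ν le .small x@(c , s) = last-small c s r (it x)

-- Folds over lists in bounded time

module Folds where

  open Cost
  open import Data.Bool using (Bool; true; false; if_then_else_)
  open import Data.List using (List; []; _∷_; length; foldl; foldr; reverse; map; _++_; drop; filterᵇ)
  open import Data.List.Properties using (reverse-foldr; reverse-involutive; ʳ++-defn; ++-identityʳ)
  open import Data.Nat using (ℕ; suc; _+_; _*_; _≤_; s≤s; z≤n)
  open import Data.Nat.Properties
  open import Data.Nat.Tactic.RingSolver using (solve-∀)
  open import Data.Product using (_×_; _,_; proj₁; proj₂)
  open import Data.Sum using (_⊎_; inj₁; inj₂; [_,_]′)
  open import Data.Unit using (⊤; tt)
  open import Function using (id)
  open import Relation.Binary.PropositionalEquality

  variable
    α β δ : Ty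

  argᶜ : {ν : ⟦ σ ⟧ → ℕ} → (∀ x → 1 ≤ ν x) → Comp {σ} {σ} ν id
  argᶜ pos = weigh pos idᶜ

  -- Two measures, because the outputs collected by mapAccL (measured by M)
  -- depend on its accumulator (measured by K).
  record Growth {γ α σ} (h : ⟦ γ ⟧ × (⟦ α ⟧ × ⟦ σ ⟧) → ⟦ σ ⟧) : Set where
    field
      K M      : ⟦ σ ⟧ → ℕ
      R r₁ r₂  : Poly 1
      K≤size   : ∀ s → K s ≤ size σ s
      M≤size   : ∀ s → M s ≤ size σ s
      size≤    : ∀ s → size σ s ≤ ⟪ R ⟫ (K s + M s)
      growK    : ∀ c x s → K (h (c , (x , s))) ≤ K s + ⟪ r₁ ⟫ (size γ c + size α x)
      growM    : ∀ c x s → M (h (c , (x , s))) ≤ M s + ⟪ r₂ ⟫ (size γ c + size α x + K s)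

  -- The common case of one measure. The increment must not depend on the state: growth by a
  -- constant factor would compound to an exponential over the fold.
  additive : {h : ⟦ γ ⟧ × (⟦ α ⟧ × ⟦ σ ⟧) → ⟦ σ ⟧} (r : Poly 1) →
             (∀ c x s → size σ (h (c , (x , s))) ≤ size σ s + ⟪ r ⟫ (size γ c + size α x)) →
             Growth {γ} {α} {σ} h
  additive {σ = σ} r le = record
    { K = size σ ; M = λ _ → 0 ; R = X ; r₁ = r ; r₂ = con 0
    ; K≤size = λ _ → ≤-refl ; M≤size = λ _ → z≤n ; size≤ = λ s → m≤m+n _ 0
    ; growK = le ; growM = λ _ _ _ → z≤n }

  module _ {γ α σ : Ty} {h : ⟦ γ ⟧ × (⟦ α ⟧ × ⟦ σ ⟧) → ⟦ σ ⟧} where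

    foldlᶜ : {μ : ⟦ γ ⟧ → ℕ} → (∀ c → 1 ≤ μ c) → Comp {γ ⊗ α ⊗ σ} {σ} (λ x → μ (proj₁ x)) h → Growth {γ} {α} {σ} h →
             Comp {γ ⊗ list α ⊗ σ} {σ} (λ x → μ (proj₁ x))
               (λ x → foldl (λ s y → h (proj₁ x , (y , s))) (proj₂ (proj₂ x)) (proj₁ (proj₂ x)))
    foldlᶜ {μ} pos H G = loopᶜ body states X
        (λ x → suc (length (proj₁ (proj₂ x)))) iterates (λ x → pos (proj₁ x))
        (λ { x@(c , xs , s) → ≤-trans (≤-reflexive (*-comm _ (μ c))) (*-monoʳ-≤ (μ c)
             (≤-trans (length≤size α xs) (≤-trans (m≤m+n _ _)
               (≤-trans (n≤1+n _) (≤-trans (m≤n+m _ (size γ c)) (n≤1+n _)))))) })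
      where
      open Growth G
      b : ⟦ γ ⟧ × (List ⟦ α ⟧ × ⟦ σ ⟧) → (List ⟦ α ⟧ × ⟦ σ ⟧) ⊎ ⟦ σ ⟧
      b x = [ (λ _ → inj₂ (proj₂ (proj₂ x)))
            , (λ y → inj₁ (proj₂ y , h (proj₁ x , (proj₁ y , proj₂ (proj₂ x))))) ]′ (unconsValue (proj₁ (proj₂ x)))
      arg : ∀ {τ} → Comp {τ ⊗ γ ⊗ list α ⊗ σ} (λ x → μ (proj₁ (proj₂ x))) id
      arg = argᶜ (λ x → pos (proj₁ (proj₂ x)))
      body : Comp {γ ⊗ list α ⊗ σ} {(list α ⊗ σ) ⊕ σ} (λ x → μ (proj₁ x)) b
      body = caseᶜ (unconsᶜ (fstᶜ (sndᶜ (argᶜ (λ x → pos (proj₁ x))))))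
               (inrᶜ (sndᶜ (sndᶜ (sndᶜ arg))))
               (inlᶜ (pairᶜ (sndᶜ (fstᶜ arg))
                 (after (λ _ → ≤-refl) H (pairᶜ (fstᶜ (sndᶜ arg)) (pairᶜ (fstᶜ (fstᶜ arg)) (sndᶜ (sndᶜ (sndᶜ arg))))))))
      boundK boundM states : Poly 1
      -- For input size n there are at most n steps, each adding at most `r₁` of n to `K`. `M` can
      -- be bounded only after that, since its increments depend on `K`.
      boundK = X :+ (X :* r₁)
      boundM = X :+ (X :* r₂ ⊙ (X :+ boundK))
      states = con 1 :+ (X :+ R ⊙ (boundK :+ boundM))

      module _ (c : ⟦ γ ⟧) (n : ℕ) (c≤n : size γ c ≤ n) where
        k m : ℕ
        k = ⟪ r₁ ⟫ n
        m = ⟪ r₂ ⟫ (n + (n + n * k))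

        -- The invariant is a budget: the present measure plus the increments still to come stays
        -- below the bound.
        run : ∀ xs s → size γ c + size (list α) xs ≤ n → K s + length xs * k ≤ n + n * k →
              M s + length xs * m ≤ n + n * m →
              Iterates γ b c (⟪ states ⟫ n) (xs , s) (foldl (λ s y → h (c , (y , s))) s xs) (suc (length xs))
        fits : ∀ xs s → size γ c + size (list α) xs ≤ n → K s + length xs * k ≤ n + n * k →
              M s + length xs * m ≤ n + n * m → size (list α ⊗ σ) (xs , s) ≤ ⟪ states ⟫ n
        fits xs s le leK leM = s≤s (+-mono-≤ (≤-trans (m≤n+m _ _) le) (≤-trans (size≤ s)
          (≤-⊙ R (boundK :+ boundM) _ (+-mono-≤ {K s} {n + n * k} {M s} (≤-trans (m≤m+n _ _) leK)
            (≤-trans (m≤m+n _ _) (≤-trans leM (≤-reflexive (cong (λ z → n + n * z) (sym (eval-⊙ r₂ (X :+ boundK) _))))))))))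

        run [] s le leK leM = stop (fits [] s le leK leM) refl
        run (x ∷ xs) s le leK leM = continue (fits (x ∷ xs) s le leK leM) refl
          (run xs (h (c , (x , s)))
            (≤-trans (+-monoʳ-≤ (size γ c) (≤-trans (m≤n+m _ (size α x)) (n≤1+n _))) le)
            (grown {m = k} {length xs} (growK c x s) (mono r₁ cx≤n) leK)
            (grown {m = m} {length xs} (growM c x s) (mono r₂ (+-mono-≤ cx≤n (≤-trans (m≤m+n (K s) (length (x ∷ xs) * k)) leK))) leM))
          where
          cx≤n : size γ c + size α x ≤ n
          cx≤n = ≤-trans (+-monoʳ-≤ (size γ c) (≤-trans (m≤m+n _ (size (list α) xs)) (n≤1+n _))) le
          grown : ∀ {a a′ r m l B} → a′ ≤ a + r → r ≤ m → a + (m + l * m) ≤ B → a′ + l * m ≤ B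
          grown {a} {m = m} {l} le₁ le₂ le₃ = ≤-trans (+-monoˡ-≤ (l * m) (≤-trans le₁ (+-monoʳ-≤ a le₂)))
                                                (≤-trans (≤-reflexive (+-assoc a m _)) le₃)

      iterates : ∀ x → Iterates γ b (proj₁ x) (⟪ states ⟫ (size (γ ⊗ list α ⊗ σ) x)) (proj₂ x)
                   (foldl (λ s y → h (proj₁ x , (y , s))) (proj₂ (proj₂ x)) (proj₁ (proj₂ x))) (suc (length (proj₁ (proj₂ x))))
      iterates (c , xs , s) = run c n (≤-trans (m≤m+n _ _) (n≤1+n _)) xs s
          (≤-trans (+-monoʳ-≤ (size γ c) (≤-trans (m≤m+n _ _) (n≤1+n _))) (n≤1+n _))
          (+-mono-≤ (≤-trans (K≤size s) s≤n) (*-monoˡ-≤ _ len≤n))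
          (+-mono-≤ (≤-trans (M≤size s) s≤n) (*-monoˡ-≤ _ len≤n))
        where
        n : ℕ
        n = size (γ ⊗ list α ⊗ σ) (c , xs , s)
        s≤n : size σ s ≤ n
        s≤n = ≤-trans (m≤n+m _ (size (list α) xs)) (≤-trans (n≤1+n _) (≤-trans (m≤n+m _ (size γ c)) (n≤1+n _)))
        len≤n : length xs ≤ n
        len≤n = ≤-trans (n≤1+n _) (≤-trans (length≤size α xs)
          (≤-trans (m≤m+n _ (size σ s)) (≤-trans (n≤1+n _) (≤-trans (m≤n+m _ (size γ c)) (n≤1+n _)))))

  abstract
    reverseᶜ : PT {list α} {list α} reverse
    reverseᶜ {α} = foldlᶜ {𝟙} {α} {list α} {h = λ x → proj₁ (proj₂ x) ∷ proj₂ (proj₂ x)} (λ _ → ≤-refl)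
        (consᶜ (fstᶜ (sndᶜ idᶜ)) (sndᶜ (sndᶜ idᶜ)))
        (additive (con 1 :+ X) λ c x s → ≤-trans (≤-reflexive (cong suc (+-comm (size α x) _)))
          (≤-trans (n≤1+n _) (≤-reflexive (lem (size (list α) s) (size α x)))))
      ▹ pairᶜ unitᶜ (pairᶜ idᶜ nilᶜ)
      where
      lem : ∀ a b → suc (suc (a + b)) ≡ a + (1 + (1 + b))
      lem = solve-∀

  -- A loop can consume a list only from the front, so a right fold is run as a left fold over the
  -- reversed list.
  foldrᶜ : {h : ⟦ γ ⟧ × (⟦ α ⟧ × ⟦ σ ⟧) → ⟦ σ ⟧} {μ : ⟦ γ ⟧ → ℕ} → (∀ c → 1 ≤ μ c) →
           Comp {γ ⊗ α ⊗ σ} {σ} (λ x → μ (proj₁ x)) h → Growth {γ} {α} {σ} h →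
           Comp {γ ⊗ list α ⊗ σ} {σ} (λ x → μ (proj₁ x))
             (λ x → foldr (λ y s → h (proj₁ x , (y , s))) (proj₂ (proj₂ x)) (proj₁ (proj₂ x)))
  foldrᶜ {γ} {α} {σ} {h} {μ} pos H G =
    convert (λ { (c , xs , s) → trans (sym (reverse-foldr (λ y s → h (c , (y , s))) s (reverse xs)))
                                  (cong (foldr (λ y s → h (c , (y , s))) s) (reverse-involutive xs)) })
      (after (λ _ → ≤-refl) (foldlᶜ {γ} {α} {σ} pos H G)
        (pairᶜ (fstᶜ arg) (pairᶜ (after (λ x → pos (proj₁ x)) reverseᶜ (fstᶜ (sndᶜ arg))) (sndᶜ (sndᶜ arg)))))
    where
    arg : Comp {γ ⊗ list α ⊗ σ} (λ x → μ (proj₁ x)) id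
    arg = argᶜ (λ x → pos (proj₁ x))

  mapᶜ : {h : ⟦ γ ⟧ × ⟦ α ⟧ → ⟦ β ⟧} → PT {γ ⊗ α} {β} h →
         PT {γ ⊗ list α} {list β} (λ x → map (λ y → h (proj₁ x , y)) (proj₂ x))
  mapᶜ {γ} {α} {β} {h} H =
    convert (λ { (c , xs) → lem c xs })
      (foldrᶜ {γ} {α} {list β} {h = λ x → h (proj₁ x , proj₁ (proj₂ x)) ∷ proj₂ (proj₂ x)} (λ _ → ≤-refl)
        (consᶜ (H ▹ pairᶜ (fstᶜ idᶜ) (fstᶜ (sndᶜ idᶜ))) (sndᶜ (sndᶜ idᶜ)))
        (additive (con 1 :+ H .out ⊙ (con 1 :+ X)) λ c x s →
          ≤-trans (≤-reflexive (trans (cong suc (+-comm (size β (h (c , x))) _)) (sym (+-suc _ _))))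
            (+-monoʳ-≤ (size (list β) s) (s≤s (≤-trans (H .small (c , x)) (≤-⊙ (H .out) (con 1 :+ X) _ ≤-refl)))))
        ▹ pairᶜ (fstᶜ idᶜ) (pairᶜ (sndᶜ idᶜ) nilᶜ))
    where
    lem : ∀ c xs → foldr (λ y s → h (c , y) ∷ s) [] xs ≡ map (λ y → h (c , y)) xs
    lem c []       = refl
    lem c (x ∷ xs) = cong (_ ∷_) (lem c xs)

  filterᶜ : {h : ⟦ γ ⟧ × ⟦ α ⟧ → Bool} → PT {γ ⊗ α} {bit} h →
            PT {γ ⊗ list α} {list α} (λ x → filterᵇ (λ y → h (proj₁ x , y)) (proj₂ x))
  filterᶜ {γ} {α} {h} H =
    convert (λ { (c , xs) → lem c xs })
      (foldrᶜ {γ} {α} {list α}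
        {h = λ x → if h (proj₁ x , proj₁ (proj₂ x)) then proj₁ (proj₂ x) ∷ proj₂ (proj₂ x) else proj₂ (proj₂ x)} (λ _ → ≤-refl)
        (condᶜ (H ▹ pairᶜ (fstᶜ idᶜ) (fstᶜ (sndᶜ idᶜ))) (consᶜ (fstᶜ (sndᶜ idᶜ)) (sndᶜ (sndᶜ idᶜ))) (sndᶜ (sndᶜ idᶜ)))
        (additive (con 1 :+ X) λ c x s → grow (h (c , x)) c x s)
        ▹ pairᶜ (fstᶜ idᶜ) (pairᶜ (sndᶜ idᶜ) nilᶜ))
    where
    lem : ∀ c xs → foldr (λ y s → if h (c , y) then y ∷ s else s) [] xs ≡ filterᵇ (λ y → h (c , y)) xs
    lem c [] = refl
    lem c (x ∷ xs) with h (c , x)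
    ... | true  = cong (x ∷_) (lem c xs)
    ... | false = lem c xs
    grow : ∀ b (c : ⟦ γ ⟧) (x : ⟦ α ⟧) s → size (list α) (if b then x ∷ s else s) ≤ size (list α) s + (1 + (size γ c + size α x))
    grow true  c x s = ≤-trans (≤-reflexive (trans (cong suc (+-comm (size α x) _)) (sym (+-suc _ _))))
                         (+-monoʳ-≤ (size (list α) s) (s≤s (m≤n+m _ _)))
    grow false c x s = m≤m+n _ _

  abstract
    appendᶜ : PT {list α ⊗ list α} {list α} (λ x → proj₁ x ++ proj₂ x)
    appendᶜ {α} =
      convert (λ { (xs , ys) → lem xs ys })
        (foldrᶜ {𝟙} {α} {list α} {h = λ x → proj₁ (proj₂ x) ∷ proj₂ (proj₂ x)} (λ _ → ≤-refl)
          (consᶜ (fstᶜ (sndᶜ idᶜ)) (sndᶜ (sndᶜ idᶜ)))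
          (additive X λ c x s → ≤-reflexive (trans (cong suc (+-comm (size α x) _)) (sym (+-suc _ _))))
          ▹ pairᶜ unitᶜ idᶜ)
      where
      lem : ∀ (xs ys : List ⟦ α ⟧) → foldr _∷_ ys xs ≡ xs ++ ys
      lem []       ys = refl
      lem (x ∷ xs) ys = cong (x ∷_) (lem xs ys)

  headᵈ : ∀ {A : Set} → A → List A → A
  headᵈ d []      = d
  headᵈ d (x ∷ _) = x

  abstract
    headᶜ : PT {α ⊗ list α} {α} (λ x → headᵈ (proj₁ x) (proj₂ x))
    headᶜ = convert (λ { (d , []) → refl ; (d , _ ∷ _) → refl })
      (caseᶜ (unconsᶜ (sndᶜ idᶜ)) (fstᶜ (sndᶜ idᶜ)) (fstᶜ (fstᶜ idᶜ)))

  abstract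
    tailᶜ : PT {list α} {list α} (drop 1)
    tailᶜ = convert (λ { [] → refl ; (_ ∷ _) → refl })
      (caseᶜ (unconsᶜ idᶜ) nilᶜ (sndᶜ (fstᶜ idᶜ)))

  size-tail : ∀ α (xs : List ⟦ α ⟧) → size (list α) (drop 1 xs) ≤ size (list α) xs
  size-tail α []       = ≤-refl
  size-tail α (x ∷ xs) = ≤-trans (m≤n+m _ (size α x)) (n≤1+n _)

  mapAccR : ∀ {A C D : Set} → (C → A → C × D) → C → List A → C × List D
  mapAccR h c []       = c , []
  mapAccR h c (x ∷ xs) = let p = mapAccR h c xs ; q = h (proj₁ p) x in proj₁ q , proj₂ q ∷ proj₂ p

  mapAccL : ∀ {A C D : Set} → (C → A → C × D) → C → List A → C × List D
  mapAccL h c []       = c , []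
  mapAccL h c (x ∷ xs) = let p = h c x ; q = mapAccL h (proj₁ p) xs in proj₁ q , proj₂ p ∷ proj₂ q

  module _ {γ α σ δ : Ty} {h : ⟦ γ ⟧ × (⟦ α ⟧ × ⟦ σ ⟧) → ⟦ σ ⟧ × ⟦ δ ⟧} (H : PT {γ ⊗ α ⊗ σ} {σ ⊗ δ} h) (r : Poly 1)
           (le : ∀ c x s → size σ (proj₁ (h (c , (x , s)))) ≤ size σ s + ⟪ r ⟫ (size γ c + size α x)) where

    private
      accumulate : ⟦ γ ⟧ × (⟦ α ⟧ × (⟦ σ ⟧ × List ⟦ δ ⟧)) → ⟦ σ ⟧ × List ⟦ δ ⟧
      accumulate y = let p = h (proj₁ y , (proj₁ (proj₂ y) , proj₁ (proj₂ (proj₂ y))))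
                     in proj₁ p , proj₂ p ∷ proj₂ (proj₂ (proj₂ y))

      accumulateᶜ : PT {γ ⊗ α ⊗ σ ⊗ list δ} {σ ⊗ list δ} accumulate
      accumulateᶜ = pairᶜ (fstᶜ (H ▹ args)) (consᶜ (sndᶜ (H ▹ args)) (sndᶜ (sndᶜ (sndᶜ idᶜ))))
        where
        args : PT {γ ⊗ α ⊗ σ ⊗ list δ} {γ ⊗ α ⊗ σ} (λ y → proj₁ y , (proj₁ (proj₂ y) , proj₁ (proj₂ (proj₂ y))))
        args = pairᶜ (fstᶜ idᶜ) (pairᶜ (fstᶜ (sndᶜ idᶜ)) (fstᶜ (sndᶜ (sndᶜ idᶜ))))

      growth : Growth {γ} {α} {σ ⊗ list δ} accumulate
      growth = record
        { K = λ s → size σ (proj₁ s) ; M = λ s → size (list δ) (proj₂ s) ; R = con 1 :+ X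
        ; r₁ = r ; r₂ = con 1 :+ H .out ⊙ (con 2 :+ X)
        ; K≤size = λ s → ≤-trans (m≤m+n _ _) (n≤1+n _)
        ; M≤size = λ s → ≤-trans (m≤n+m _ _) (n≤1+n _)
        ; size≤ = λ s → ≤-refl
        ; growK = λ c x s → le c x (proj₁ s)
        ; growM = λ c x s → ≤-trans (≤-reflexive (trans (cong suc (+-comm (size δ _) _)) (sym (+-suc _ _))))
            (+-monoʳ-≤ (size (list δ) (proj₂ s)) (s≤s (≤-trans (≤-trans (m≤n+m _ _) (n≤1+n _)) (≤-trans (H .small (c , (x , proj₁ s)))
              (≤-⊙ (H .out) (con 2 :+ X) _ (≤-reflexive (lem (size γ c) (size α x) (size σ (proj₁ s)))))))))
        }
        where
        lem : ∀ a b c → suc (a + suc (b + c)) ≡ 2 + (a + b + c)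
        lem = solve-∀

    mapAccRᶜ : PT {γ ⊗ list α ⊗ σ} {σ ⊗ list δ}
                 (λ x → mapAccR (λ s y → h (proj₁ x , (y , s))) (proj₂ (proj₂ x)) (proj₁ (proj₂ x)))
    mapAccRᶜ = convert (λ { (c , xs , s) → lem c xs s })
        (foldrᶜ {γ} {α} {σ ⊗ list δ} (λ _ → ≤-refl) accumulateᶜ growth
          ▹ pairᶜ (fstᶜ idᶜ) (pairᶜ (fstᶜ (sndᶜ idᶜ)) (pairᶜ (sndᶜ (sndᶜ idᶜ)) nilᶜ)))
      where
      lem : ∀ c xs s → foldr (λ y s → accumulate (c , (y , s))) (s , []) xs ≡ mapAccR (λ s y → h (c , (y , s))) s xs
      lem c []       s = refl
      lem c (x ∷ xs) s = cong (λ p → accumulate (c , (x , p))) (lem c xs s)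

    mapAccLᶜ : PT {γ ⊗ list α ⊗ σ} {σ ⊗ list δ}
                 (λ x → mapAccL (λ s y → h (proj₁ x , (y , s))) (proj₂ (proj₂ x)) (proj₁ (proj₂ x)))
    mapAccLᶜ = convert (λ { (c , xs , s) → lem c xs s [] })
        (pairᶜ (fstᶜ fold) (reverseᶜ ▹ sndᶜ fold))
      where
      fold = foldlᶜ {γ} {α} {σ ⊗ list δ} (λ _ → ≤-refl) accumulateᶜ growth
               ▹ pairᶜ (fstᶜ idᶜ) (pairᶜ (fstᶜ (sndᶜ idᶜ)) (pairᶜ (sndᶜ (sndᶜ idᶜ)) nilᶜ))
      lem : ∀ c xs s ds → let p = foldl (λ s y → accumulate (c , (y , s))) (s , ds) xs
                              q = mapAccL (λ s y → h (c , (y , s))) s xs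
                          in (proj₁ p , reverse (proj₂ p)) ≡ (proj₁ q , reverse ds ++ proj₂ q)
      lem c []       s ds = cong (s ,_) (sym (++-identityʳ _))
      lem c (x ∷ xs) s ds = let p = h (c , (x , s)) in
        trans (lem c xs (proj₁ p) (proj₂ p ∷ ds))
          (cong (_ ,_) (trans (sym (ʳ++-defn (proj₂ p ∷ ds))) (ʳ++-defn ds)))

  mapAccL-size : ∀ (σ : Ty) {A D : Set} (h : ⟦ σ ⟧ → A → ⟦ σ ⟧ × D) → (∀ s x → size σ (proj₁ (h s x)) ≤ size σ s) →
                 ∀ s xs → size σ (proj₁ (mapAccL h s xs)) ≤ size σ s
  mapAccL-size σ h le s []       = ≤-refl
  mapAccL-size σ h le s (x ∷ xs) = ≤-trans (mapAccL-size σ h le (proj₁ (h s x)) xs) (le s x)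

  length-mapAccL : ∀ {A C D : Set} (h : C → A → C × D) c xs → length (proj₂ (mapAccL h c xs)) ≡ length xs
  length-mapAccL h c []       = refl
  length-mapAccL h c (x ∷ xs) = cong suc (length-mapAccL h _ xs)

  -- The first list determines the length and the second is padded. With `[]` or `false` as padding,
  -- missing entries of a vector or digits of a numeral count as zero.
  zipᵈ : ∀ {A B : Set} → B → List A → List B → List (A × B)
  zipᵈ d []       ys = []
  zipᵈ d (x ∷ xs) ys = (x , headᵈ d ys) ∷ zipᵈ d xs (drop 1 ys)

  abstract
    zipᶜ : PT {β ⊗ list α ⊗ list β} {list (α ⊗ β)} (λ x → zipᵈ (proj₁ x) (proj₁ (proj₂ x)) (proj₂ (proj₂ x)))
    zipᶜ {β} {α} = convert (λ { (d , xs , ys) → lem d xs ys })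
        (sndᶜ (mapAccLᶜ {β} {α} {list β} {α ⊗ β} {h = λ x → drop 1 (proj₂ (proj₂ x)) , (proj₁ (proj₂ x) , headᵈ (proj₁ x) (proj₂ (proj₂ x)))}
          (pairᶜ (tailᶜ ▹ sndᶜ (sndᶜ idᶜ)) (pairᶜ (fstᶜ (sndᶜ idᶜ)) (headᶜ ▹ pairᶜ (fstᶜ idᶜ) (sndᶜ (sndᶜ idᶜ)))))
          (con 0) (λ c x s → ≤-trans (size-tail β s) (m≤m+n _ _))))
      where
      lem : ∀ (d : ⟦ β ⟧) (xs : List ⟦ α ⟧) (ys : List ⟦ β ⟧) → proj₂ (mapAccL (λ s y → drop 1 s , (y , headᵈ d s)) ys xs) ≡ zipᵈ d xs ys
      lem d []       ys = refl
      lem d (x ∷ xs) ys = cong (_ ∷_) (lem d xs (drop 1 ys))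

  -- The surplus of the longer list is kept, which is addition of vectors or polynomials when absent
  -- entries mean zero.
  zipLong : ∀ {A : Set} → (A → A → A) → List A → List A → List A
  zipLong op []       ys       = ys
  zipLong op (x ∷ xs) []       = x ∷ xs
  zipLong op (x ∷ xs) (y ∷ ys) = op x y ∷ zipLong op xs ys

  zipLongᶜ : {op : ⟦ α ⟧ → ⟦ α ⟧ → ⟦ α ⟧} → PT {α ⊗ α} {α} (λ x → op (proj₁ x) (proj₂ x)) →
             PT {list α ⊗ list α} {list α} (λ x → zipLong op (proj₁ x) (proj₂ x))
  zipLongᶜ {α} {op} O = convert (λ { (xs , ys) → lem xs ys })
      -- The accumulator holds the unread part of the second list, so after the pass it is exactly
      -- the surplus to be appended.
      (appendᶜ ▹ pairᶜ (sndᶜ acc) (fstᶜ acc))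
    where
    h : ⊤ × (⟦ α ⟧ × List ⟦ α ⟧) → List ⟦ α ⟧ × ⟦ α ⟧
    h (_ , (x , []))     = [] , x
    h (_ , (x , y ∷ ys)) = ys , op x y
    H : PT {𝟙 ⊗ α ⊗ list α} {list α ⊗ α} h
    H = convert (λ { (_ , (x , [])) → refl ; (_ , (x , y ∷ ys)) → refl })
      (caseᶜ (unconsᶜ (sndᶜ (sndᶜ idᶜ))) (pairᶜ nilᶜ (fstᶜ (sndᶜ (sndᶜ idᶜ))))
        (pairᶜ (sndᶜ (fstᶜ idᶜ)) (O ▹ pairᶜ (fstᶜ (sndᶜ (sndᶜ idᶜ))) (fstᶜ (fstᶜ idᶜ)))))
    le : ∀ c x s → size (list α) (proj₁ (h (c , (x , s)))) ≤ size (list α) s + 0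
    le c x []      = ≤-refl
    le c x (y ∷ s) = ≤-trans (≤-trans (m≤n+m _ (size α y)) (n≤1+n _)) (m≤m+n _ 0)
    acc : PT {list α ⊗ list α} {list α ⊗ list α} (λ x → mapAccL (λ s y → h (tt , (y , s))) (proj₂ x) (proj₁ x))
    acc = mapAccLᶜ H (con 0) le ▹ pairᶜ unitᶜ idᶜ
    lem : ∀ xs ys → let p = mapAccL (λ s y → h (tt , (y , s))) ys xs in proj₂ p ++ proj₁ p ≡ zipLong op xs ys
    lem []       ys       = refl
    lem (x ∷ xs) []       = cong (x ∷_) (lem′ xs)
      where
      lem′ : ∀ (xs : List ⟦ α ⟧) → let p = mapAccL (λ s y → h (tt , (y , s))) [] xs in proj₂ p ++ proj₁ p ≡ xs
      lem′ []       = refl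
      lem′ (x ∷ xs) = cong (x ∷_) (lem′ xs)
    lem (x ∷ xs) (y ∷ ys) = cong (_ ∷_) (lem xs ys)

  size-zipLong : ∀ α (op : ⟦ α ⟧ → ⟦ α ⟧ → ⟦ α ⟧) → (∀ x y → size α (op x y) ≤ size α x + size α y) →
                 ∀ xs ys → size (list α) (zipLong op xs ys) ≤ size (list α) xs + size (list α) ys
  size-zipLong α op le []       ys       = n≤1+n _
  size-zipLong α op le (x ∷ xs) []       = m≤m+n _ _
  size-zipLong α op le (x ∷ xs) (y ∷ ys) =
    s≤s (≤-trans (+-mono-≤ (le x y) (size-zipLong α op le xs ys)) (≤-trans (n≤1+n _)
      (≤-reflexive (lem (size α x) (size α y) (size (list α) xs) (size (list α) ys)))))
    where
    lem : ∀ a b c d → suc ((a + b) + (c + d)) ≡ a + c + suc (b + d)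
    lem = solve-∀

-- The ring 𝔽₂[z] on lists of bits

module Polynomials where

  open Folds using (zipLong)
  open import Algebra.Bundles using (CommutativeRing; CommutativeMonoid)
  open import Data.Bool using (Bool; true; false; if_then_else_; _xor_; _∧_; not)
  open import Data.Bool.Properties using (xor-assoc; xor-comm; xor-identityʳ; xor-same)
  open import Data.List using (List; []; _∷_; length; foldr)
  open import Data.Nat using (ℕ; zero; suc; _+_; _≤_; s≤s; z≤n; _⊔_)
  open import Data.Nat.Properties
  open import Data.Product using (_,_)
  open import Level using (0ℓ)
  open import Relation.Binary using (Setoid; IsEquivalence)
  open import Relation.Binary.PropositionalEquality as ≡ using (_≡_; refl; cong; cong₂)
  open import Relation.Nullary using (¬_)

  -- A list of bits stands for the polynomial over 𝔽₂ with these
  -- coefficients, constant term first.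
  Pol : Set
  Pol = List Bool

  coef : Pol → ℕ → Bool
  coef []      n       = false
  coef (x ∷ a) zero    = x
  coef (x ∷ a) (suc n) = coef a n

  infix 4 _≈_ _≉_

  -- Trailing zeros make lists ambiguous, so equality is coefficientwise. The record wrapper allows
  -- `a` and `b` to be inferred from a proof.
  record _≈_ (a b : Pol) : Set where
    constructor mk≈
    field at : ∀ n → coef a n ≡ coef b n

  open _≈_ public

  _≉_ : Pol → Pol → Set
  a ≉ b = ¬ a ≈ b

  infixl 6 _⊻_
  infixl 7 _⊛_

  _⊻_ : Pol → Pol → Pol
  _⊻_ = zipLong _xor_

  scale : Bool → Pol → Pol
  scale x b = if x then b else []

  _⊛_ : Pol → Pol → Pol
  []      ⊛ b = []
  (x ∷ a) ⊛ b = scale x b ⊻ (false ∷ a ⊛ b)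

  coef-⊻ : ∀ a b n → coef (a ⊻ b) n ≡ coef a n xor coef b n
  coef-⊻ []      b       n       = refl
  coef-⊻ (x ∷ a) []      n       = ≡.sym (xor-identityʳ _)
  coef-⊻ (x ∷ a) (y ∷ b) zero    = refl
  coef-⊻ (x ∷ a) (y ∷ b) (suc n) = coef-⊻ a b n

  ≈-isEquivalence : IsEquivalence _≈_
  ≈-isEquivalence = record
    { refl = mk≈ λ _ → refl ; sym = λ e → mk≈ λ n → ≡.sym (at e n) ; trans = λ e f → mk≈ λ n → ≡.trans (at e n) (at f n) }

  open IsEquivalence ≈-isEquivalence public using () renaming (refl to ≈-refl; sym to ≈-sym; trans to ≈-trans)

  ⊻-cong : ∀ {a b c d} → a ≈ b → c ≈ d → a ⊻ c ≈ b ⊻ d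
  ⊻-cong {a} {b} {c} {d} e f = mk≈ λ n →
    ≡.trans (coef-⊻ a c n) (≡.trans (cong₂ _xor_ (at e n) (at f n)) (≡.sym (coef-⊻ b d n)))

  ⊻-assoc : ∀ a b c → (a ⊻ b) ⊻ c ≈ a ⊻ (b ⊻ c)
  ⊻-assoc a b c = mk≈ λ n → ≡.trans (coef-⊻ (a ⊻ b) c n) (≡.trans (cong (_xor coef c n) (coef-⊻ a b n))
    (≡.trans (xor-assoc (coef a n) _ _) (≡.sym (≡.trans (coef-⊻ a (b ⊻ c) n) (cong (coef a n xor_) (coef-⊻ b c n))))))

  ⊻-comm : ∀ a b → a ⊻ b ≈ b ⊻ a
  ⊻-comm a b = mk≈ λ n → ≡.trans (coef-⊻ a b n) (≡.trans (xor-comm (coef a n) _) (≡.sym (coef-⊻ b a n)))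

  ⊻-identityʳ : ∀ a → a ⊻ [] ≈ a
  ⊻-identityʳ a = ⊻-comm a []

  ⊻-self : ∀ a → a ⊻ a ≈ []
  ⊻-self a = mk≈ λ n → ≡.trans (coef-⊻ a a n) (xor-same (coef a n))

  ⊻-commutativeMonoid : CommutativeMonoid 0ℓ 0ℓ
  ⊻-commutativeMonoid = record
    { Carrier = Pol ; _≈_ = _≈_ ; _∙_ = _⊻_ ; ε = []
    ; isCommutativeMonoid = record
      { isMonoid = record
        { isSemigroup = record
          { isMagma = record { isEquivalence = ≈-isEquivalence ; ∙-cong = ⊻-cong }
          ; assoc = ⊻-assoc }
        ; identity = (λ _ → ≈-refl) , ⊻-identityʳ }
      ; comm = ⊻-comm } }

  open import Algebra.Properties.CommutativeSemigroup (CommutativeMonoid.commutativeSemigroup ⊻-commutativeMonoid)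
    using (interchange; x∙yz≈y∙xz)
  open import Relation.Binary.Reasoning.Setoid (CommutativeMonoid.setoid ⊻-commutativeMonoid)

  ∷-cong : ∀ x {a b} → a ≈ b → x ∷ a ≈ x ∷ b
  ∷-cong x e = mk≈ λ { zero → refl ; (suc n) → at e n }

  ∷-zero : false ∷ [] ≈ []
  ∷-zero = mk≈ λ { zero → refl ; (suc n) → refl }

  scale-cong : ∀ x {a b} → a ≈ b → scale x a ≈ scale x b
  scale-cong true  e = e
  scale-cong false e = ≈-refl

  scale-⊻ : ∀ x a b → scale x (a ⊻ b) ≈ scale x a ⊻ scale x b
  scale-⊻ true  a b = ≈-refl
  scale-⊻ false a b = ≈-refl

  scale-∷ : ∀ y x a → scale y (x ∷ a) ≈ (y ∧ x) ∷ scale y a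
  scale-∷ true  x a = ≈-refl
  scale-∷ false x a = ≈-sym ∷-zero

  ⊛-congˡ : ∀ a {b c} → b ≈ c → a ⊛ b ≈ a ⊛ c
  ⊛-congˡ []      e = ≈-refl
  ⊛-congˡ (x ∷ a) e = ⊻-cong (scale-cong x e) (∷-cong false (⊛-congˡ a e))

  ⊛-distribˡ : ∀ a b c → a ⊛ (b ⊻ c) ≈ a ⊛ b ⊻ a ⊛ c
  ⊛-distribˡ []      b c = ≈-refl
  ⊛-distribˡ (x ∷ a) b c = ≈-trans (⊻-cong (scale-⊻ x b c) (∷-cong false (⊛-distribˡ a b c)))
                             (interchange (scale x b) (scale x c) (false ∷ a ⊛ b) (false ∷ a ⊛ c))

  -- The mirror image of the defining equation, with the second factor split instead of the first.
  -- Commutativity follows from it by induction.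
  ⊛-∷ : ∀ b x a → b ⊛ (x ∷ a) ≈ scale x b ⊻ (false ∷ b ⊛ a)
  ⊛-∷ []      true  a = ≈-sym ∷-zero
  ⊛-∷ []      false a = ≈-sym ∷-zero
  ⊛-∷ (y ∷ b) x     a = begin
    scale y (x ∷ a) ⊻ (false ∷ b ⊛ (x ∷ a))
      ≈⟨ ⊻-cong (scale-∷ y x a) (∷-cong false (⊛-∷ b x a)) ⟩
    ((y ∧ x) xor false) ∷ (scale y a ⊻ (scale x b ⊻ (false ∷ b ⊛ a)))
      ≈⟨ mk≈ (λ { zero → lem x y ; (suc n) → at (x∙yz≈y∙xz (scale y a) (scale x b) (false ∷ b ⊛ a)) n }) ⟩
    ((x ∧ y) xor false) ∷ (scale x b ⊻ (scale y a ⊻ (false ∷ b ⊛ a)))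
      ≈⟨ ⊻-cong (scale-∷ x y b) (≈-refl {false ∷ (scale y a ⊻ (false ∷ b ⊛ a))}) ⟨
    scale x (y ∷ b) ⊻ (false ∷ (scale y a ⊻ (false ∷ b ⊛ a))) ∎
    where
    lem : ∀ x y → (y ∧ x) xor false ≡ (x ∧ y) xor false
    lem true  true  = refl
    lem true  false = refl
    lem false true  = refl
    lem false false = refl

  ⊛-zeroʳ : ∀ a → a ⊛ [] ≈ []
  ⊛-zeroʳ []      = ≈-refl
  ⊛-zeroʳ (true  ∷ a) = ≈-trans (∷-cong false (⊛-zeroʳ a)) ∷-zero
  ⊛-zeroʳ (false ∷ a) = ≈-trans (∷-cong false (⊛-zeroʳ a)) ∷-zero

  ⊛-comm : ∀ a b → a ⊛ b ≈ b ⊛ a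
  ⊛-comm []      b = ≈-sym (⊛-zeroʳ b)
  ⊛-comm (x ∷ a) b = ≈-trans (⊻-cong (≈-refl {scale x b}) (∷-cong false (⊛-comm a b))) (≈-sym (⊛-∷ b x a))

  ⊛-cong : ∀ {a b c d} → a ≈ b → c ≈ d → a ⊛ c ≈ b ⊛ d
  ⊛-cong {a} {b} {c} {d} e f = begin
    a ⊛ c ≈⟨ ⊛-congˡ a f ⟩
    a ⊛ d ≈⟨ ⊛-comm a d ⟩
    d ⊛ a ≈⟨ ⊛-congˡ d e ⟩
    d ⊛ b ≈⟨ ⊛-comm d b ⟩
    b ⊛ d ∎

  ⊛-distribʳ : ∀ a b c → (b ⊻ c) ⊛ a ≈ b ⊛ a ⊻ c ⊛ a
  ⊛-distribʳ a b c = begin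
    (b ⊻ c) ⊛ a     ≈⟨ ⊛-comm (b ⊻ c) a ⟩
    a ⊛ (b ⊻ c)     ≈⟨ ⊛-distribˡ a b c ⟩
    a ⊛ b ⊻ a ⊛ c   ≈⟨ ⊻-cong (⊛-comm a b) (⊛-comm a c) ⟩
    b ⊛ a ⊻ c ⊛ a   ∎

  scale-⊛ : ∀ x b c → scale x b ⊛ c ≈ scale x (b ⊛ c)
  scale-⊛ true  b c = ≈-refl
  scale-⊛ false b c = ≈-refl

  ⊛-assoc : ∀ a b c → (a ⊛ b) ⊛ c ≈ a ⊛ (b ⊛ c)
  ⊛-assoc []      b c = ≈-refl
  ⊛-assoc (x ∷ a) b c = ≈-trans (⊛-distribʳ c (scale x b) (false ∷ a ⊛ b))
                          (⊻-cong (scale-⊛ x b c) (∷-cong false (⊛-assoc a b c)))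

  ⊛-identityˡ : ∀ a → (true ∷ []) ⊛ a ≈ a
  ⊛-identityˡ a = ≈-trans (⊻-cong (≈-refl {a}) ∷-zero) (⊻-identityʳ a)

  polynomials : CommutativeRing 0ℓ 0ℓ
  polynomials = record
    { Carrier = Pol ; _≈_ = _≈_ ; _+_ = _⊻_ ; _*_ = _⊛_ ; -_ = λ a → a ; 0# = [] ; 1# = true ∷ []
    ; isCommutativeRing = record
      { isRing = record
        { +-isAbelianGroup = record
          { isGroup = record
            { isMonoid = CommutativeMonoid.isMonoid ⊻-commutativeMonoid
            ; inverse = ⊻-self , ⊻-self
            ; ⁻¹-cong = λ e → e }
          ; comm = ⊻-comm }
        ; *-cong = ⊛-cong
        ; *-assoc = ⊛-assoc
        ; *-identity = ⊛-identityˡ , (λ a → ≈-trans (⊛-comm a (true ∷ [])) (⊛-identityˡ a))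
        ; distrib = ⊛-distribˡ , ⊛-distribʳ }
      ; *-comm = ⊛-comm } }

  ∷-vanishing : ∀ {x a} → x ∷ a ≈ [] → a ≈ []
  ∷-vanishing e = mk≈ λ n → at e (suc n)

  -- Factors z are stripped from both sides until both constant terms are 1; the constant term of
  -- the product is 1 as well.
  integral : ∀ a b → a ≉ [] → b ≉ [] → a ⊛ b ≉ []
  integral []          b           a≉ b≉ e = a≉ ≈-refl
  integral (false ∷ a) b           a≉ b≉ e = integral a b (λ a≈ → a≉ (≈-trans (∷-cong false a≈) ∷-zero)) b≉ (∷-vanishing e)
  integral (true ∷ a)  []          a≉ b≉ e = b≉ ≈-refl
  integral (true ∷ a)  (false ∷ b) a≉ b≉ e =
    integral (true ∷ a) b a≉ (λ b≈ → b≉ (≈-trans (∷-cong false b≈) ∷-zero))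
      (∷-vanishing (≈-trans (≈-sym (⊛-∷ (true ∷ a) false b)) e))
  integral (true ∷ a)  (true ∷ b)  a≉ b≉ e with () ← at e 0

  1≉0 : true ∷ [] ≉ []
  1≉0 e with () ← at e 0

  isZero : Pol → Bool
  isZero = foldr (λ x s → not x ∧ s) true

  isZero-sound : ∀ a → isZero a ≡ true → a ≈ []
  isZero-sound []          eq = ≈-refl
  isZero-sound (false ∷ a) eq = ≈-trans (∷-cong false (isZero-sound a eq)) ∷-zero

  isZero-complete : ∀ a → a ≈ [] → isZero a ≡ true
  isZero-complete []          e = refl
  isZero-complete (true ∷ a)  e with () ← at e 0
  isZero-complete (false ∷ a) e = isZero-complete a (∷-vanishing e)

  -- In characteristic 2 the sum doubles as the difference.
  equal : Pol → Pol → Bool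
  equal a b = isZero (a ⊻ b)

  ⊻≈0⇒≈ : ∀ a b → a ⊻ b ≈ [] → a ≈ b
  ⊻≈0⇒≈ a b e = begin
    a           ≈⟨ ⊻-identityʳ a ⟨
    a ⊻ []      ≈⟨ ⊻-cong (≈-refl {a}) (⊻-self b) ⟨
    a ⊻ (b ⊻ b) ≈⟨ ⊻-assoc a b b ⟨
    (a ⊻ b) ⊻ b ≈⟨ ⊻-cong e (≈-refl {b}) ⟩
    b           ∎

  ≈⇒≡ : ∀ a b → length a ≡ length b → a ≈ b → a ≡ b
  ≈⇒≡ []      []      eq e = refl
  ≈⇒≡ (x ∷ a) (y ∷ b) eq e = cong₂ _∷_ (at e 0) (≈⇒≡ a b (suc-injective eq) (mk≈ λ n → at e (suc n)))

  -- Codes of elements of ℤ_m all have the same width, which removes the ambiguity of trailing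
  -- zeros: on them `equal` decides equality of lists.
  equal⇒≡ : ∀ a b → length a ≡ length b → equal a b ≡ true → a ≡ b
  equal⇒≡ a b eq e = ≈⇒≡ a b eq (⊻≈0⇒≈ a b (isZero-sound _ e))

  equal-refl : ∀ a → equal a a ≡ true
  equal-refl a = isZero-complete _ (⊻-self a)

  length-⊻ : ∀ a b → length (a ⊻ b) ≡ length a ⊔ length b
  length-⊻ []      b       = refl
  length-⊻ (x ∷ a) []      = refl
  length-⊻ (x ∷ a) (y ∷ b) = cong suc (length-⊻ a b)

  -- Additivity is essential: it keeps iterated products, such as powers of a node, of polynomial
  -- size.
  length-⊛ : ∀ a b → length (a ⊛ b) ≤ length a + length b
  length-⊛ []      b = z≤n
  length-⊛ (x ∷ a) b = ≤-trans (≤-reflexive (length-⊻ (scale x b) _))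
    (⊔-lub (≤-trans (lem x) (m≤n+m _ _)) (s≤s (length-⊛ a b)))
    where
    lem : ∀ x → length (scale x b) ≤ length b
    lem true  = ≤-refl
    lem false = z≤n

open import Algebra.Bundles using (CommutativeRing)
open import Level using (0ℓ)

-- Determinants in characteristic 2: expansions, Vandermonde, Bird's recurrence

module Permanent (R : CommutativeRing 0ℓ 0ℓ)
  (char2 : ∀ x → CommutativeRing._≈_ R (CommutativeRing._+_ R x x) (CommutativeRing.0# R)) where

  open CommutativeRing R hiding (zero)
  open import Algebra.Properties.CommutativeSemigroup +-commutativeSemigroup using (interchange) renaming (x∙yz≈y∙xz to x+yz≈y+xz)
  open import Algebra.Properties.CommutativeSemigroup *-commutativeSemigroup using () renaming (x∙yz≈y∙xz to x*yz≈y*xz; interchange to *-interchange)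
  open import Relation.Binary.Reasoning.Setoid setoid
  open import Data.List using (List; []; _∷_; _++_; map; length; downFrom)
  open import Data.List.Membership.Propositional using (_∈_)
  open import Data.List.Membership.Propositional.Properties using (∈-∃++; ∈-map⁺; ∈-downFrom⁺)
  open import Data.List.Relation.Binary.Permutation.Propositional using (_↭_; prep; swap; ↭-sym)
    renaming (refl to done; trans to _then_)
  open import Data.List.Relation.Binary.Permutation.Propositional.Properties using (shift)
  open import Data.List.Relation.Unary.AllPairs using (AllPairs; []; _∷_)
  open import Data.List.Relation.Unary.All as All using (All; []; _∷_)
  open import Data.List.Relation.Unary.Any using (here; there)
  open import Data.Nat as ℕ using (ℕ; zero; suc; s≤s)
  import Data.Nat.Properties as ℕ
  open import Data.Product using (_×_; _,_)
  open import Function using (flip)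
  open import Relation.Binary.PropositionalEquality as ≡ using (_≡_)

  module _ {X : Set} where

    ∑ : List X → (X → Carrier) → Carrier
    ∑ []       f = 0#
    ∑ (x ∷ xs) f = f x + ∑ xs f

    -- ∑⟨ xs ⟩ f sums f x xs′ over all ways to split xs into an entry x
    -- and the remaining entries xs′.
    ∑⟨_⟩ : List X → (X → List X → Carrier) → Carrier
    ∑⟨ [] ⟩     f = 0#
    ∑⟨ x ∷ xs ⟩ f = f x xs + ∑⟨ xs ⟩ (λ y ys → f y (x ∷ ys))

    ∑-cong∈ : ∀ xs {f g : X → Carrier} → (∀ {x} → x ∈ xs → f x ≈ g x) → ∑ xs f ≈ ∑ xs g
    ∑-cong∈ []       eq = refl
    ∑-cong∈ (x ∷ xs) eq = +-cong (eq (here ≡.refl)) (∑-cong∈ xs (λ z → eq (there z)))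

    ∑-cong : ∀ xs {f g : X → Carrier} → (∀ x → f x ≈ g x) → ∑ xs f ≈ ∑ xs g
    ∑-cong xs eq = ∑-cong∈ xs (λ {x} _ → eq x)

    ∑-zero : ∀ xs → ∑ xs (λ _ → 0#) ≈ 0#
    ∑-zero []       = refl
    ∑-zero (x ∷ xs) = trans (+-identityˡ _) (∑-zero xs)

    ∑-+ : ∀ xs (f g : X → Carrier) → ∑ xs (λ x → f x + g x) ≈ ∑ xs f + ∑ xs g
    ∑-+ []       f g = sym (+-identityˡ 0#)
    ∑-+ (x ∷ xs) f g = trans (+-congˡ (∑-+ xs f g)) (interchange _ _ _ _)

    ∑-* : ∀ c xs (f : X → Carrier) → ∑ xs (λ x → c * f x) ≈ c * ∑ xs f
    ∑-* c []       f = sym (zeroʳ c)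
    ∑-* c (x ∷ xs) f = trans (+-congˡ (∑-* c xs f)) (sym (distribˡ c _ _))

    ∑⟨⟩-cong : ∀ xs {f g : X → List X → Carrier} → (∀ x xs′ → xs ↭ x ∷ xs′ → f x xs′ ≈ g x xs′) → ∑⟨ xs ⟩ f ≈ ∑⟨ xs ⟩ g
    ∑⟨⟩-cong []       eq = refl
    ∑⟨⟩-cong (x ∷ xs) eq = +-cong (eq x xs done)
      (∑⟨⟩-cong xs λ y ys p → eq y (x ∷ ys) (prep x p then swap x y done))

    ∑⟨⟩-+ : ∀ xs (f g : X → List X → Carrier) → ∑⟨ xs ⟩ (λ x xs′ → f x xs′ + g x xs′) ≈ ∑⟨ xs ⟩ f + ∑⟨ xs ⟩ g
    ∑⟨⟩-+ []       f g = sym (+-identityˡ 0#)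
    ∑⟨⟩-+ (x ∷ xs) f g = trans (+-congˡ (∑⟨⟩-+ xs _ _)) (interchange _ _ _ _)

    ∑⟨⟩-* : ∀ c xs (f : X → List X → Carrier) → ∑⟨ xs ⟩ (λ x xs′ → c * f x xs′) ≈ c * ∑⟨ xs ⟩ f
    ∑⟨⟩-* c []       f = sym (zeroʳ c)
    ∑⟨⟩-* c (x ∷ xs) f = trans (+-congˡ (∑⟨⟩-* c xs _)) (sym (distribˡ c _ _))

    ∑⟨⟩-zero : ∀ xs → ∑⟨ xs ⟩ (λ _ _ → 0#) ≈ 0#
    ∑⟨⟩-zero []       = refl
    ∑⟨⟩-zero (x ∷ xs) = trans (+-identityˡ _) (∑⟨⟩-zero xs)

    -- Both sides run over the ordered pairs of distinct positions; exchanging the two positions is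
    -- a bijection of these.
    ∑⟨⟩-swap : ∀ xs (f : X → X → List X → Carrier) →
               ∑⟨ xs ⟩ (λ x xs′ → ∑⟨ xs′ ⟩ (λ y ys → f x y ys)) ≈ ∑⟨ xs ⟩ (λ x xs′ → ∑⟨ xs′ ⟩ (λ y ys → f y x ys))
    ∑⟨⟩-swap []       f = refl
    ∑⟨⟩-swap (x ∷ xs) f = begin
      ∑⟨ xs ⟩ (f x) + ∑⟨ xs ⟩ (λ y ys → f y x ys + ∑⟨ ys ⟩ (λ z zs → f y z (x ∷ zs)))
        ≈⟨ +-congˡ (∑⟨⟩-+ xs _ _) ⟩
      ∑⟨ xs ⟩ (f x) + (∑⟨ xs ⟩ (λ y ys → f y x ys) + ∑⟨ xs ⟩ (λ y ys → ∑⟨ ys ⟩ (λ z zs → f y z (x ∷ zs))))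
        ≈⟨ x+yz≈y+xz _ _ _ ⟩
      ∑⟨ xs ⟩ (λ y ys → f y x ys) + (∑⟨ xs ⟩ (f x) + ∑⟨ xs ⟩ (λ y ys → ∑⟨ ys ⟩ (λ z zs → f y z (x ∷ zs))))
        ≈⟨ +-congˡ (+-congˡ (∑⟨⟩-swap xs (λ y z zs → f y z (x ∷ zs)))) ⟩
      ∑⟨ xs ⟩ (λ y ys → f y x ys) + (∑⟨ xs ⟩ (f x) + ∑⟨ xs ⟩ (λ y ys → ∑⟨ ys ⟩ (λ z zs → f z y (x ∷ zs))))
        ≈⟨ +-congˡ (∑⟨⟩-+ xs _ _) ⟨
      ∑⟨ xs ⟩ (λ y ys → f y x ys) + ∑⟨ xs ⟩ (λ y ys → f x y ys + ∑⟨ ys ⟩ (λ z zs → f z y (x ∷ zs))) ∎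

    -- Every unordered pair of positions occurs in both orders with the same value, and in
    -- characteristic 2 the two terms cancel.
    ∑⟨⟩-alternating : ∀ xs (f : X → X → List X → Carrier) → (∀ x y ys → f x y ys ≈ f y x ys) →
                      ∑⟨ xs ⟩ (λ x xs′ → ∑⟨ xs′ ⟩ (f x)) ≈ 0#
    ∑⟨⟩-alternating []       f s = refl
    ∑⟨⟩-alternating (x ∷ xs) f s = begin
      ∑⟨ xs ⟩ (f x) + ∑⟨ xs ⟩ (λ y ys → f y x ys + ∑⟨ ys ⟩ (λ z zs → f y z (x ∷ zs)))
        ≈⟨ +-congˡ (trans (∑⟨⟩-+ xs _ _) (+-cong (∑⟨⟩-cong xs λ y ys _ → s y x ys)
             (∑⟨⟩-alternating xs (λ y z zs → f y z (x ∷ zs)) (λ y z zs → s y z (x ∷ zs))))) ⟩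
      ∑⟨ xs ⟩ (f x) + (∑⟨ xs ⟩ (f x) + 0#)
        ≈⟨ trans (+-congˡ (+-identityʳ _)) (char2 _) ⟩
      0# ∎

  ∑⟨⟩-exchange : ∀ {X Y : Set} (xs : List X) (ys : List Y) (f : X → List X → Y → List Y → Carrier) →
                 ∑⟨ xs ⟩ (λ x xs′ → ∑⟨ ys ⟩ (λ y ys′ → f x xs′ y ys′)) ≈ ∑⟨ ys ⟩ (λ y ys′ → ∑⟨ xs ⟩ (λ x xs′ → f x xs′ y ys′))
  ∑⟨⟩-exchange []       ys f = sym (∑⟨⟩-zero ys)
  ∑⟨⟩-exchange (x ∷ xs) ys f = trans (+-congˡ (∑⟨⟩-exchange xs ys _)) (sym (∑⟨⟩-+ ys _ _))

  module _ {X Y : Set} where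

    none : List X → Carrier
    none []      = 1#
    none (_ ∷ _) = 0#

    -- In characteristic 2 this is also the determinant.
    perm : (X → Y → Carrier) → List X → List Y → Carrier
    perm a xs []       = none xs
    perm a xs (y ∷ ys) = ∑⟨ xs ⟩ (λ x xs′ → a x y * perm a xs′ ys)

    perm-cong : ∀ {a b : X → Y → Carrier} xs ys → (∀ x {y} → y ∈ ys → a x y ≈ b x y) → perm a xs ys ≈ perm b xs ys
    perm-cong xs []       eq = refl
    perm-cong xs (y ∷ ys) eq = ∑⟨⟩-cong xs λ x xs′ _ → *-cong (eq x (here ≡.refl)) (perm-cong xs′ ys (λ x p → eq x (there p)))

    module _ (a : X → Y → Carrier) where

      private
        perm-∷∷ : ∀ xs y z ys → perm a xs (y ∷ z ∷ ys) ≈ ∑⟨ xs ⟩ (λ x xs′ → ∑⟨ xs′ ⟩ (λ x′ xs″ → a x y * (a x′ z * perm a xs″ ys)))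
        perm-∷∷ xs y z ys = ∑⟨⟩-cong xs λ x xs′ _ → sym (∑⟨⟩-* (a x y) xs′ _)

      perm-swap : ∀ xs y z ys → perm a xs (y ∷ z ∷ ys) ≈ perm a xs (z ∷ y ∷ ys)
      perm-swap xs y z ys = begin
        perm a xs (y ∷ z ∷ ys)
          ≈⟨ perm-∷∷ xs y z ys ⟩
        ∑⟨ xs ⟩ (λ x xs′ → ∑⟨ xs′ ⟩ (λ x′ xs″ → a x y * (a x′ z * perm a xs″ ys)))
          ≈⟨ ∑⟨⟩-swap xs _ ⟩
        ∑⟨ xs ⟩ (λ x xs′ → ∑⟨ xs′ ⟩ (λ x′ xs″ → a x′ y * (a x z * perm a xs″ ys)))
          ≈⟨ ∑⟨⟩-cong xs (λ x xs′ _ → ∑⟨⟩-cong xs′ λ x′ xs″ _ → x*yz≈y*xz _ _ _) ⟩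
        ∑⟨ xs ⟩ (λ x xs′ → ∑⟨ xs′ ⟩ (λ x′ xs″ → a x z * (a x′ y * perm a xs″ ys)))
          ≈⟨ perm-∷∷ xs z y ys ⟨
        perm a xs (z ∷ y ∷ ys) ∎

      perm-cols-↭ : ∀ xs {ys zs} → ys ↭ zs → perm a xs ys ≈ perm a xs zs
      perm-cols-↭ xs done                   = refl
      perm-cols-↭ xs (prep y p)             = ∑⟨⟩-cong xs λ x xs′ _ → *-congˡ (perm-cols-↭ xs′ p)
      perm-cols-↭ xs (swap {ys} {zs} y z p) = trans (perm-swap xs y z ys)
        (∑⟨⟩-cong xs λ x xs′ _ → *-congˡ (∑⟨⟩-cong xs′ λ x′ xs″ _ → *-congˡ (perm-cols-↭ xs″ p)))
      perm-cols-↭ xs (p then q)             = trans (perm-cols-↭ xs p) (perm-cols-↭ xs q)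

      -- Once the equal columns stand side by side, exchanging the two rows assigned to them leaves
      -- a term unchanged, so the terms cancel in pairs.
      perm-repeated-col : ∀ xs {y ys} → y ∈ ys → perm a xs (y ∷ ys) ≈ 0#
      perm-repeated-col xs {y} y∈ys with us , vs , ≡.refl ← ∈-∃++ y∈ys = begin
        perm a xs (y ∷ us ++ y ∷ vs)
          ≈⟨ perm-cols-↭ xs (prep y (shift y us vs)) ⟩
        perm a xs (y ∷ y ∷ us ++ vs)
          ≈⟨ perm-∷∷ xs y y (us ++ vs) ⟩
        ∑⟨ xs ⟩ (λ x xs′ → ∑⟨ xs′ ⟩ (λ x′ xs″ → a x y * (a x′ y * perm a xs″ (us ++ vs))))
          ≈⟨ ∑⟨⟩-alternating xs (λ x x′ xs″ → a x y * (a x′ y * perm a xs″ (us ++ vs))) (λ x x′ xs″ → x*yz≈y*xz _ _ _) ⟩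
        0# ∎

      -- Laplace expansion along a row, whereas the definition expands along columns. Expanding the
      -- remaining minors along both the row and the column and exchanging the two sums gives the
      -- induction step.
      perm-row : ∀ x xs ys → perm a (x ∷ xs) ys ≈ ∑⟨ ys ⟩ (λ y ys′ → a x y * perm a xs ys′)
      perm-row x xs []       = refl
      perm-row x xs (y ∷ ys) = +-congˡ (begin
        ∑⟨ xs ⟩ (λ x′ xs′ → a x′ y * perm a (x ∷ xs′) ys)
          ≈⟨ ∑⟨⟩-cong xs (λ x′ xs′ _ → trans (*-congˡ (perm-row x xs′ ys)) (sym (∑⟨⟩-* _ ys _))) ⟩
        ∑⟨ xs ⟩ (λ x′ xs′ → ∑⟨ ys ⟩ (λ y′ ys′ → a x′ y * (a x y′ * perm a xs′ ys′)))
          ≈⟨ ∑⟨⟩-exchange xs ys _ ⟩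
        ∑⟨ ys ⟩ (λ y′ ys′ → ∑⟨ xs ⟩ (λ x′ xs′ → a x′ y * (a x y′ * perm a xs′ ys′)))
          ≈⟨ ∑⟨⟩-cong ys (λ y′ ys′ _ → trans (∑⟨⟩-cong xs λ x′ xs′ _ → x*yz≈y*xz _ _ _) (∑⟨⟩-* _ xs _)) ⟩
        ∑⟨ ys ⟩ (λ y′ ys′ → a x y′ * perm a xs (y ∷ ys′)) ∎)

      perm-row-+ : ∀ {x u v} xs ys → (∀ {y} → y ∈ ys → a x y ≈ a u y + a v y) →
                   perm a (x ∷ xs) ys ≈ perm a (u ∷ xs) ys + perm a (v ∷ xs) ys
      perm-row-+ {x} {u} {v} xs ys eq = begin
        perm a (x ∷ xs) ys ≈⟨ perm-row x xs ys ⟩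
        ∑⟨ ys ⟩ (λ y ys′ → a x y * perm a xs ys′)
          ≈⟨ ∑⟨⟩-cong ys (λ y ys′ p → trans (*-congʳ (eq (∈-resp p))) (distribʳ _ _ _)) ⟩
        ∑⟨ ys ⟩ (λ y ys′ → a u y * perm a xs ys′ + a v y * perm a xs ys′)
          ≈⟨ ∑⟨⟩-+ ys _ _ ⟩
        ∑⟨ ys ⟩ (λ y ys′ → a u y * perm a xs ys′) + ∑⟨ ys ⟩ (λ y ys′ → a v y * perm a xs ys′)
          ≈⟨ +-cong (perm-row u xs ys) (perm-row v xs ys) ⟨
        perm a (u ∷ xs) ys + perm a (v ∷ xs) ys ∎
        where
        open import Data.List.Relation.Binary.Permutation.Propositional.Properties using (∈-resp-↭)
        ∈-resp : ∀ {y ys′} → ys ↭ y ∷ ys′ → y ∈ ys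
        ∈-resp p = ∈-resp-↭ (↭-sym p) (here ≡.refl)

      perm-row-* : ∀ {x u} c xs ys → (∀ {y} → y ∈ ys → a x y ≈ c * a u y) →
                   perm a (x ∷ xs) ys ≈ c * perm a (u ∷ xs) ys
      perm-row-* {x} {u} c xs ys eq = begin
        perm a (x ∷ xs) ys ≈⟨ perm-row x xs ys ⟩
        ∑⟨ ys ⟩ (λ y ys′ → a x y * perm a xs ys′)
          ≈⟨ ∑⟨⟩-cong ys (λ y ys′ p → trans (*-congʳ (eq (∈-resp p))) (*-assoc _ _ _)) ⟩
        ∑⟨ ys ⟩ (λ y ys′ → c * (a u y * perm a xs ys′))
          ≈⟨ ∑⟨⟩-* c ys _ ⟩
        c * ∑⟨ ys ⟩ (λ y ys′ → a u y * perm a xs ys′)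
          ≈⟨ *-congˡ (perm-row u xs ys) ⟨
        c * perm a (u ∷ xs) ys ∎
        where
        open import Data.List.Relation.Binary.Permutation.Propositional.Properties using (∈-resp-↭)
        ∈-resp : ∀ {y ys′} → ys ↭ y ∷ ys′ → y ∈ ys
        ∈-resp p = ∈-resp-↭ (↭-sym p) (here ≡.refl)

      perm-row-0 : ∀ {x} xs ys → (∀ {y} → y ∈ ys → a x y ≈ 0#) → perm a (x ∷ xs) ys ≈ 0#
      perm-row-0 {x} xs ys eq = trans (perm-row-* {u = x} 0# xs ys (λ p → trans (eq p) (sym (zeroˡ _)))) (zeroˡ _)

  -- Invariance under transposition: expansion along rows on one side is expansion along columns on
  -- the other. It carries facts about columns over to rows.
  perm-flip : ∀ {X Y : Set} (a : X → Y → Carrier) xs ys → perm a xs ys ≈ perm (flip a) ys xs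
  perm-flip a []       []       = refl
  perm-flip a []       (y ∷ ys) = refl
  perm-flip a (x ∷ xs) ys       = trans (perm-row a x xs ys) (∑⟨⟩-cong ys λ y ys′ _ → *-congˡ (perm-flip a xs ys′))

  perm-rows-↭ : ∀ {X Y : Set} (a : X → Y → Carrier) {xs xs′} ys → xs ↭ xs′ → perm a xs ys ≈ perm a xs′ ys
  perm-rows-↭ a {xs} {xs′} ys p = trans (perm-flip a xs ys) (trans (perm-cols-↭ (flip a) ys p) (sym (perm-flip a xs′ ys)))

  ∑⟨⟩-map : ∀ {X Z : Set} (f : X → Z) xs {g h} → (∀ x xs′ → g x xs′ ≈ h (f x) (map f xs′)) → ∑⟨ xs ⟩ g ≈ ∑⟨ map f xs ⟩ h
  ∑⟨⟩-map f []       eq = refl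
  ∑⟨⟩-map f (x ∷ xs) eq = +-cong (eq x xs) (∑⟨⟩-map f xs λ y ys → eq y (x ∷ ys))

  perm-map-rows : ∀ {X Y Z : Set} (a : Z → Y → Carrier) (f : X → Z) xs ys → perm (λ x → a (f x)) xs ys ≈ perm a (map f xs) ys
  perm-map-rows a f []       []       = refl
  perm-map-rows a f (x ∷ xs) []       = refl
  perm-map-rows a f xs       (y ∷ ys) = ∑⟨⟩-map f xs λ x xs′ → *-congˡ (perm-map-rows a f xs′ ys)

  perm-map-cols : ∀ {X Y Z : Set} (a : X → Z → Carrier) (f : Y → Z) xs ys → perm (λ x y → a x (f y)) xs ys ≈ perm a xs (map f ys)
  perm-map-cols a f []       []       = refl
  perm-map-cols a f (x ∷ xs) []       = refl
  perm-map-cols a f xs       (y ∷ ys) = ∑⟨⟩-cong xs λ x xs′ _ → *-congˡ (perm-map-cols a f xs′ ys)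

  -- The Vandermonde determinant

  infixr 8 _^_

  _^_ : Carrier → ℕ → Carrier
  t ^ zero  = 1#
  t ^ suc j = t * t ^ j

  ∏ : ∀ {X : Set} → List X → (X → Carrier) → Carrier
  ∏ []       f = 1#
  ∏ (x ∷ xs) f = f x * ∏ xs f

  ∏-zero : ∀ {X : Set} {xs : List X} {f x} → x ∈ xs → f x ≈ 0# → ∏ xs f ≈ 0#
  ∏-zero (here ≡.refl) eq = trans (*-congʳ eq) (zeroˡ _)
  ∏-zero (there p)     eq = trans (*-congˡ (∏-zero p eq)) (zeroʳ _)

  private
    -- (e , us) stands for the monic polynomial T^e ∏ (T + u).
    value : Carrier → ℕ × List Carrier → Carrier
    value t (e , us) = t ^ e * ∏ us (t +_)

    powers : ℕ → List (ℕ × List Carrier)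
    powers d = map (_, []) (downFrom d)

    value-∷ : ∀ t e u us → value t (e , u ∷ us) ≈ value t (suc e , us) + u * value t (e , us)
    value-∷ t e u us = begin
      t ^ e * ((t + u) * ∏ us (t +_))                           ≈⟨ x*yz≈y*xz _ _ _ ⟩
      (t + u) * (t ^ e * ∏ us (t +_))                           ≈⟨ distribʳ _ _ _ ⟩
      t * (t ^ e * ∏ us (t +_)) + u * (t ^ e * ∏ us (t +_))     ≈⟨ +-congʳ (*-assoc _ _ _) ⟨
      t * t ^ e * ∏ us (t +_) + u * (t ^ e * ∏ us (t +_))       ∎

    perm-∷ : ∀ ts e u us ys → perm value ts ((e , u ∷ us) ∷ ys) ≈
             perm value ts ((suc e , us) ∷ ys) + u * perm value ts ((e , us) ∷ ys)
    perm-∷ ts e u us ys = begin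
      ∑⟨ ts ⟩ (λ t ts′ → value t (e , u ∷ us) * perm value ts′ ys)
        ≈⟨ ∑⟨⟩-cong ts (λ t ts′ _ → trans (*-congʳ (value-∷ t e u us)) (trans (distribʳ _ _ _) (+-congˡ (*-assoc _ _ _)))) ⟩
      ∑⟨ ts ⟩ (λ t ts′ → value t (suc e , us) * perm value ts′ ys + u * (value t (e , us) * perm value ts′ ys))
        ≈⟨ trans (∑⟨⟩-+ ts _ _) (+-congˡ (∑⟨⟩-* u ts _)) ⟩
      perm value ts ((suc e , us) ∷ ys) + u * perm value ts ((e , us) ∷ ys) ∎

    -- The values of a polynomial of degree below d lie in the span of the columns T^(d-1), ..., 1.
    -- Multiplying out the factors T + u reduces to a power, which repeats one of these columns.
    low-degree : ∀ ts e us d → e ℕ.+ length us ℕ.< d → perm value ts ((e , us) ∷ powers d) ≈ 0#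
    low-degree ts e []       d le = perm-repeated-col value ts
      (∈-map⁺ (_, []) (∈-downFrom⁺ (≡.subst (ℕ._< d) (ℕ.+-identityʳ e) le)))
    low-degree ts e (u ∷ us) d le = begin
      perm value ts ((e , u ∷ us) ∷ powers d)
        ≈⟨ perm-∷ ts e u us (powers d) ⟩
      perm value ts ((suc e , us) ∷ powers d) + u * perm value ts ((e , us) ∷ powers d)
        ≈⟨ +-cong (low-degree ts (suc e) us d le′) (*-congˡ (low-degree ts e us d (ℕ.<-trans (ℕ.n<1+n _) le′))) ⟩
      0# + u * 0# ≈⟨ trans (+-identityˡ _) (zeroʳ u) ⟩
      0# ∎
      where
      le′ : suc e ℕ.+ length us ℕ.< d
      le′ = ≡.subst (ℕ._< d) (ℕ.+-suc e (length us)) le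

    -- A column operation: in place of T^d any monic polynomial of degree d may stand, since its
    -- lower terms contribute nothing by `low-degree`.
    leading : ∀ ts e us d → e ℕ.+ length us ≡ d → perm value ts ((e , us) ∷ powers d) ≈ perm value ts (powers (suc d))
    leading ts e []       d ≡.refl rewrite ℕ.+-identityʳ e = refl
    leading ts e (u ∷ us) d eq = begin
      perm value ts ((e , u ∷ us) ∷ powers d)
        ≈⟨ perm-∷ ts e u us (powers d) ⟩
      perm value ts ((suc e , us) ∷ powers d) + u * perm value ts ((e , us) ∷ powers d)
        ≈⟨ +-cong (leading ts (suc e) us d eq′) (*-congˡ (low-degree ts e us d (ℕ.≤-reflexive eq′))) ⟩
      perm value ts (powers (suc d)) + u * 0# ≈⟨ trans (+-congˡ (zeroʳ u)) (+-identityʳ _) ⟩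
      perm value ts (powers (suc d)) ∎
      where
      eq′ : suc e ℕ.+ length us ≡ d
      eq′ = ≡.trans (≡.sym (ℕ.+-suc e (length us))) eq

  vandermonde : List Carrier → Carrier
  vandermonde ts = perm _^_ ts (downFrom (length ts))

  -- The top column is replaced by the values of ∏ (T + u) over the nodes u in `ts`. This polynomial
  -- vanishes at all of them, so only the row of t survives the expansion.
  vandermonde-∷ : ∀ t ts → vandermonde (t ∷ ts) ≈ ∏ ts (t +_) * vandermonde ts
  vandermonde-∷ t ts = begin
    vandermonde (t ∷ ts)
      ≈⟨ as-value (t ∷ ts) (suc (length ts)) ⟩
    perm value (t ∷ ts) (powers (suc (length ts)))
      ≈⟨ leading (t ∷ ts) 0 ts (length ts) ≡.refl ⟨
    value t (0 , ts) * perm value ts (powers (length ts)) +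
      ∑⟨ ts ⟩ (λ x xs′ → value x (0 , ts) * perm value (t ∷ xs′) (powers (length ts)))
      ≈⟨ +-cong (*-cong (*-identityˡ _) (sym (as-value ts (length ts))))
           (trans (∑⟨⟩-cong ts λ x xs′ p → trans (*-congʳ (vanishes x (∈-resp p))) (zeroˡ _)) (∑⟨⟩-zero ts)) ⟩
    ∏ ts (t +_) * vandermonde ts + 0#
      ≈⟨ +-identityʳ _ ⟩
    ∏ ts (t +_) * vandermonde ts ∎
    where
    open import Data.List.Relation.Binary.Permutation.Propositional.Properties using (∈-resp-↭)
    as-value : ∀ ts d → perm _^_ ts (downFrom d) ≈ perm value ts (powers d)
    as-value ts d = trans (perm-cong ts (downFrom d) (λ t {j} _ → sym (*-identityʳ _))) (perm-map-cols value (_, []) ts (downFrom d))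
    ∈-resp : ∀ {x xs′} → ts ↭ x ∷ xs′ → x ∈ ts
    ∈-resp p = ∈-resp-↭ (↭-sym p) (here ≡.refl)
    vanishes : ∀ x → x ∈ ts → value x (0 , ts) ≈ 0#
    vanishes x x∈ts = trans (*-identityˡ _) (∏-zero x∈ts (char2 x))

  perm-scale : ∀ {X Y : Set} (a : X → Y → Carrier) (s : X → Carrier) xs ys →
               perm (λ x y → s x * a x y) xs ys ≈ ∏ xs s * perm a xs ys
  perm-scale a s []       []       = sym (*-identityˡ _)
  perm-scale a s []       (y ∷ ys) = sym (zeroʳ _)
  perm-scale a s (x ∷ xs) ys       = begin
    perm (λ x y → s x * a x y) (x ∷ xs) ys
      ≈⟨ perm-row _ x xs ys ⟩
    ∑⟨ ys ⟩ (λ y ys′ → s x * a x y * perm (λ x y → s x * a x y) xs ys′)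
      ≈⟨ ∑⟨⟩-cong ys (λ y ys′ _ → trans (*-congˡ (perm-scale a s xs ys′)) (*-interchange _ _ _ _)) ⟩
    ∑⟨ ys ⟩ (λ y ys′ → s x * ∏ xs s * (a x y * perm a xs ys′))
      ≈⟨ ∑⟨⟩-* _ ys _ ⟩
    ∏ (x ∷ xs) s * ∑⟨ ys ⟩ (λ y ys′ → a x y * perm a xs ys′)
      ≈⟨ *-congˡ (perm-row a x xs ys) ⟨
    ∏ (x ∷ xs) s * perm a (x ∷ xs) ys ∎

  ∏-* : ∀ {X : Set} (xs : List X) (f g : X → Carrier) → ∏ xs (λ x → f x * g x) ≈ ∏ xs f * ∏ xs g
  ∏-* []       f g = sym (*-identityˡ _)
  ∏-* (x ∷ xs) f g = trans (*-congˡ (∏-* xs f g)) (*-interchange _ _ _ _)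

  ∑-++ : ∀ {X : Set} (xs ys : List X) (f : X → Carrier) → ∑ (xs ++ ys) f ≈ ∑ xs f + ∑ ys f
  ∑-++ []       ys f = sym (+-identityˡ _)
  ∑-++ (x ∷ xs) ys f = trans (+-congˡ (∑-++ xs ys f)) (sym (+-assoc _ _ _))

  ∑-map : ∀ {X Y : Set} (g : X → Y) xs (f : Y → Carrier) → ∑ (map g xs) f ≈ ∑ xs (λ x → f (g x))
  ∑-map g []       f = refl
  ∑-map g (x ∷ xs) f = +-congˡ (∑-map g xs f)

  -- Bird's recurrence

  module _ {X : Set} where

    -- ∑⊂ p L f sums f over the sublists of L of length p.
    ∑⊂ : ℕ → List X → (List X → Carrier) → Carrier
    ∑⊂ zero    L       f = f []
    ∑⊂ (suc p) []      f = 0#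
    ∑⊂ (suc p) (x ∷ L) f = ∑⊂ p L (λ S → f (x ∷ S)) + ∑⊂ (suc p) L f

    ∑⊂-cong : ∀ p L {f g : List X → Carrier} → (∀ S → f S ≈ g S) → ∑⊂ p L f ≈ ∑⊂ p L g
    ∑⊂-cong zero    L       eq = eq []
    ∑⊂-cong (suc p) []      eq = refl
    ∑⊂-cong (suc p) (x ∷ L) eq = +-cong (∑⊂-cong p L λ S → eq (x ∷ S)) (∑⊂-cong (suc p) L eq)

    ∑⊂-+ : ∀ p L (f g : List X → Carrier) → ∑⊂ p L (λ S → f S + g S) ≈ ∑⊂ p L f + ∑⊂ p L g
    ∑⊂-+ zero    L       f g = refl
    ∑⊂-+ (suc p) []      f g = sym (+-identityˡ 0#)
    ∑⊂-+ (suc p) (x ∷ L) f g = trans (+-cong (∑⊂-+ p L _ _) (∑⊂-+ (suc p) L f g)) (interchange _ _ _ _)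

    ∑⊂-zero : ∀ p L → ∑⊂ p L (λ _ → 0#) ≈ 0#
    ∑⊂-zero zero    L       = refl
    ∑⊂-zero (suc p) []      = refl
    ∑⊂-zero (suc p) (x ∷ L) = trans (+-cong (∑⊂-zero p L) (∑⊂-zero (suc p) L)) (+-identityˡ 0#)

    ∑⊂-* : ∀ p L c (f : List X → Carrier) → ∑⊂ p L (λ S → c * f S) ≈ c * ∑⊂ p L f
    ∑⊂-* zero    L       c f = refl
    ∑⊂-* (suc p) []      c f = sym (zeroʳ c)
    ∑⊂-* (suc p) (x ∷ L) c f = trans (+-cong (∑⊂-* p L c _) (∑⊂-* (suc p) L c f)) (sym (distribˡ c _ _))

    ∑⊂-∑ : ∀ p L (M : List X) (f : X → List X → Carrier) → ∑⊂ p L (λ S → ∑ M (λ l → f l S)) ≈ ∑ M (λ l → ∑⊂ p L (f l))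
    ∑⊂-∑ p L []      f = ∑⊂-zero p L
    ∑⊂-∑ p L (l ∷ M) f = trans (∑⊂-+ p L _ _) (+-congˡ (∑⊂-∑ p L M f))

    -- Choosing p + 1 entries and marking one of them is the same as choosing p entries and one more
    -- outside of them. The right side also lets l lie in S, and these terms vanish by hypothesis.
    ∑⊂-split : ∀ p L (g : X → List X → Carrier) → (∀ {l S} → l ∈ S → g l S ≈ 0#) →
               ∑⊂ (suc p) L (λ T → ∑⟨ T ⟩ g) ≈ ∑⊂ p L (λ S → ∑ L (λ l → g l S))
    ∑⊂-split p       []      g g0 = sym (∑⊂-zero p [])
    ∑⊂-split zero    (x ∷ L) g g0 = +-cong (+-identityʳ _) (∑⊂-split zero L g g0)
    ∑⊂-split (suc p) (x ∷ L) g g0 = begin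
      ∑⊂ (suc p) L (λ S → g x S + ∑⟨ S ⟩ (λ l S′ → g l (x ∷ S′))) + ∑⊂ (suc (suc p)) L (λ T → ∑⟨ T ⟩ g)
        ≈⟨ +-cong (trans (∑⊂-+ (suc p) L _ _) (trans (+-congˡ (∑⊂-split p L (λ l S → g l (x ∷ S)) (λ l∈S → g0 (there l∈S)))) (+-comm _ _)))
             (∑⊂-split (suc p) L g g0) ⟩
      (∑⊂ p L (λ S → ∑ L (λ l → g l (x ∷ S))) + ∑⊂ (suc p) L (g x)) + ∑⊂ (suc p) L (λ S → ∑ L (λ l → g l S))
        ≈⟨ +-assoc _ _ _ ⟩
      ∑⊂ p L (λ S → ∑ L (λ l → g l (x ∷ S))) + (∑⊂ (suc p) L (g x) + ∑⊂ (suc p) L (λ S → ∑ L (λ l → g l S)))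
        ≈⟨ +-cong (∑⊂-cong p L λ S → trans (+-congʳ (g0 (here ≡.refl))) (+-identityˡ _)) (∑⊂-+ (suc p) L _ _) ⟨
      ∑⊂ p L (λ S → g x (x ∷ S) + ∑ L (λ l → g l (x ∷ S))) + ∑⊂ (suc p) L (λ S → g x S + ∑ L (λ l → g l S)) ∎

    ∑⊂-long : ∀ p L f → length L ℕ.< p → ∑⊂ p L f ≈ 0#
    ∑⊂-long (suc p) []      f le       = refl
    ∑⊂-long (suc p) (x ∷ L) f (s≤s le) = trans (+-cong (∑⊂-long p L _ le) (∑⊂-long (suc p) L f (ℕ.m<n⇒m<1+n le))) (+-identityˡ 0#)

    ∑⊂-full : ∀ L f → ∑⊂ (length L) L f ≈ f L
    ∑⊂-full []      f = refl
    ∑⊂-full (x ∷ L) f = trans (+-cong (∑⊂-full L _) (∑⊂-long (suc (length L)) L f (ℕ.n<1+n _))) (+-identityʳ _)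

    module _ (a : X → X → Carrier) where

      -- The entry (i , j) of Bird's matrix after p steps, if L lists the
      -- indices after i.
      minors : ℕ → List X → X → X → Carrier
      minors p L i j = ∑⊂ p L (λ S → perm a (i ∷ S) (j ∷ S))

      principal : ℕ → List X → Carrier
      principal p L = ∑⊂ p L (λ S → perm a S S)

      -- Expansion along column j. Row i leaves a principal minor; a row l leaves, after a
      -- reordering of the columns, the minor with column l in place of j. A repeated column kills
      -- the terms with l in S, so `∑⊂-split` applies.
      minors-suc : ∀ p L i j → minors (suc p) L i j ≈ principal (suc p) L * a i j + ∑ L (λ l → minors p L i l * a l j)
      minors-suc p L i j = begin
        minors (suc p) L i j
          ≈⟨ ∑⊂-cong (suc p) L (λ T → +-congˡ (∑⟨⟩-cong T λ l S T↭ → *-congˡ (perm-cols-↭ a (i ∷ S) T↭))) ⟩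
        ∑⊂ (suc p) L (λ T → a i j * perm a T T + ∑⟨ T ⟩ g)
          ≈⟨ ∑⊂-+ (suc p) L _ _ ⟩
        ∑⊂ (suc p) L (λ T → a i j * perm a T T) + ∑⊂ (suc p) L (λ T → ∑⟨ T ⟩ g)
          ≈⟨ +-cong (trans (∑⊂-* (suc p) L _ _) (*-comm _ _))
               (∑⊂-split p L g (λ {l} {S} l∈S → trans (*-congˡ (perm-repeated-col a (i ∷ S) l∈S)) (zeroʳ _))) ⟩
        principal (suc p) L * a i j + ∑⊂ p L (λ S → ∑ L (λ l → g l S))
          ≈⟨ +-congˡ (trans (∑⊂-∑ p L L g) (∑-cong L λ l → trans (∑⊂-* p L (a l j) _) (*-comm _ _))) ⟩
        principal (suc p) L * a i j + ∑ L (λ l → minors p L i l * a l j) ∎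
        where
        g : X → List X → Carrier
        g l S = a l j * perm a (i ∷ S) (l ∷ S)

-- Division-free determinants by Bird's algorithm

module Determinant where

  open Cost
  open Folds
  open Polynomials
  open Permanent polynomials ⊻-self using (perm; ∑; minors; minors-suc; principal; ∑⊂-full)
  open import Algebra.Bundles using (CommutativeRing)
  open import Data.Bool using (Bool; true; false; if_then_else_; _xor_; not)
  open import Data.List using (List; []; _∷_; length; foldl; foldr; map; drop)
  open import Data.List.Relation.Unary.All as All using (All; []; _∷_)
  open import Data.Nat using (ℕ; suc; _+_; _*_; _≤_; s≤s; z≤n)
  open import Data.Nat.Properties
  open import Data.Nat.Tactic.RingSolver using (solve-∀)
  open import Data.Product using (_×_; _,_; proj₁; proj₂)
  open import Data.Unit using (⊤; tt)
  open import Relation.Binary.PropositionalEquality as ≡ using (_≡_; refl; cong; cong₂)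

  private module P = CommutativeRing polynomials

  size-num : ∀ (a : Pol) → size num a ≡ 1 + 2 * length a
  size-num []      = refl
  size-num (x ∷ a) = ≡.trans (cong (λ z → suc (suc z)) (size-num a)) (lem (length a))
    where
    lem : ∀ n → suc (suc (1 + 2 * n)) ≡ 1 + 2 * (1 + n)
    lem = solve-∀

  length≤num : ∀ (a : Pol) → length a ≤ size num a
  length≤num a = ≤-trans (n≤1+n _) (length≤size bit a)

  abstract
    xorᶜ : PT {bit ⊗ bit} {bit} (λ x → proj₁ x xor proj₂ x)
    xorᶜ = convert (λ { (true , true) → refl ; (true , false) → refl ; (false , _) → refl })
      (condᶜ (fstᶜ idᶜ) (condᶜ (sndᶜ idᶜ) (constᶜ false) (constᶜ true)) (sndᶜ idᶜ))

  abstract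
    ⊻ᶜ : PT {num ⊗ num} {num} (λ x → proj₁ x ⊻ proj₂ x)
    ⊻ᶜ = zipLongᶜ {bit} xorᶜ

  size-⊻ : ∀ a b → size num (a ⊻ b) ≤ size num a + size num b
  size-⊻ = size-zipLong bit _xor_ (λ _ _ → s≤s z≤n)

  abstract
    ⊛ᶜ : PT {num ⊗ num} {num} (λ x → proj₁ x ⊛ proj₂ x)
    ⊛ᶜ = convert (λ { (a , b) → structural a b }) (foldrᶜ {num} {bit} {num} {h = λ x → scale (proj₁ (proj₂ x)) (proj₁ x) ⊻ (false ∷ proj₂ (proj₂ x))} (λ _ → ≤-refl)
        (⊻ᶜ ▹ pairᶜ (condᶜ (fstᶜ (sndᶜ idᶜ)) (fstᶜ idᶜ) nilᶜ) (consᶜ (constᶜ false) (sndᶜ (sndᶜ idᶜ))))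
        (additive (con 2 :+ X) λ b x s → ≤-trans (size-⊻ (scale x b) (false ∷ s))
          (≤-trans (+-monoˡ-≤ _ (size-scale x b)) (≤-trans (≤-reflexive (lem (size num b) (size num s))) (+-monoʳ-≤ (size num s) (m≤m+n _ 1)))))
      ▹ pairᶜ (sndᶜ idᶜ) (pairᶜ (fstᶜ idᶜ) nilᶜ))
      where
      structural : ∀ a b → foldr (λ x s → scale x b ⊻ (false ∷ s)) [] a ≡ a ⊛ b
      structural []      b = refl
      structural (x ∷ a) b = cong (λ s → scale x b ⊻ (false ∷ s)) (structural a b)
      size-scale : ∀ x b → size num (scale x b) ≤ size num b
      size-scale true  b = ≤-refl
      size-scale false b = 1≤size num b
      lem : ∀ b s → b + suc (suc s) ≡ s + (2 + b)
      lem = solve-∀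

  size-⊛ : ∀ a b → size num (a ⊛ b) ≤ size num a + size num b
  size-⊛ a b = ≤-trans (≤-reflexive (size-num (a ⊛ b))) (≤-trans (s≤s (*-monoʳ-≤ 2 (length-⊛ a b)))
    (≤-trans (n≤1+n _) (≤-reflexive (≡.trans (lem (length a) (length b)) (≡.sym (cong₂ _+_ (size-num a) (size-num b)))))))
    where
    lem : ∀ a b → suc (1 + 2 * (a + b)) ≡ (1 + 2 * a) + (1 + 2 * b)
    lem = solve-∀

  abstract
    isZeroᶜ : PT {num} {bit} isZero
    isZeroᶜ = convert (λ a → lem a)
        (foldrᶜ {𝟙} {bit} {bit} {h = λ x → if proj₁ (proj₂ x) then false else proj₂ (proj₂ x)} (λ _ → ≤-refl)
          (condᶜ (fstᶜ (sndᶜ idᶜ)) (constᶜ false) (sndᶜ (sndᶜ idᶜ)))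
          (additive (con 0) λ _ _ _ → s≤s z≤n)
        ▹ pairᶜ unitᶜ (pairᶜ idᶜ (constᶜ true)))
      where
      lem : ∀ a → foldr (λ x s → if x then false else s) true a ≡ isZero a
      lem []          = refl
      lem (true  ∷ a) = refl
      lem (false ∷ a) = lem a

  abstract
    equalᶜ : PT {num ⊗ num} {bit} (λ x → equal (proj₁ x) (proj₂ x))
    equalᶜ = isZeroᶜ ▹ ⊻ᶜ

  abstract
    notᶜ : PT {bit} {bit} not
    notᶜ = convert (λ { true → refl ; false → refl }) (condᶜ idᶜ (constᶜ false) (constᶜ true))

  vec mat : Ty
  vec = list num
  mat = list vec

  infixl 6 _⊞_

  _⊞_ : List Pol → List Pol → List Pol
  _⊞_ = zipLong _⊻_

  abstract
    ⊞ᶜ : PT {vec ⊗ vec} {vec} (λ x → proj₁ x ⊞ proj₂ x)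
    ⊞ᶜ = zipLongᶜ {num} ⊻ᶜ

  lincomb : List (List Pol × Pol) → List Pol
  lincomb = foldr (λ p s → map (proj₂ p ⊛_) (proj₁ p) ⊞ s) []

  abstract
    scaleVecᶜ : PT {num ⊗ vec} {vec} (λ x → map (proj₁ x ⊛_) (proj₂ x))
    scaleVecᶜ = mapᶜ ⊛ᶜ

  abstract
    lincombᶜ : PT {list (vec ⊗ num)} {vec} lincomb
    lincombᶜ = foldrᶜ {𝟙} {vec ⊗ num} {vec} (λ _ → ≤-refl) H
        (additive (H′ .out) λ c p s → ≤-trans (size-zipLong num _⊻_ size-⊻ (map (proj₂ p ⊛_) (proj₁ p)) s)
          (≤-trans (+-monoˡ-≤ _ (≤-trans (H′ .small p) (mono (H′ .out) (n≤1+n (size (vec ⊗ num) p))))) (≤-reflexive (+-comm (⟪ H′ .out ⟫ (suc (size (vec ⊗ num) p))) (size vec s)))))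
      ▹ pairᶜ unitᶜ (pairᶜ idᶜ nilᶜ)
      where
      H′ : PT {vec ⊗ num} {vec} (λ p → map (proj₂ p ⊛_) (proj₁ p))
      H′ = scaleVecᶜ ▹ pairᶜ (sndᶜ idᶜ) (fstᶜ idᶜ)
      H : PT {𝟙 ⊗ (vec ⊗ num) ⊗ vec} {vec} (λ x → map (proj₂ (proj₁ (proj₂ x)) ⊛_) (proj₁ (proj₁ (proj₂ x))) ⊞ proj₂ (proj₂ x))
      H = ⊞ᶜ ▹ pairᶜ (H′ ▹ fstᶜ (sndᶜ idᶜ)) (sndᶜ (sndᶜ idᶜ))

  -- Bird's matrix is kept triangular: row i holds only the columns from i on, and so needs only the
  -- submatrix on the indices from i on.
  trailing : List (List Pol) → List (List (List Pol))
  trailing A = proj₂ (mapAccL (λ B _ → map (drop 1) (drop 1 B) , B) A A)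

  -- `d` is the sum of the diagonal entries in the rows below. Bird's step replaces the diagonal
  -- entry by it (by its negative in other characteristics) and multiplies the row by the matrix.
  birdRow : Pol → List Pol × List (List Pol) → Pol × List Pol
  birdRow d y = d ⊻ headᵈ [] (proj₁ y) , lincomb (zipᵈ [] (proj₂ y) (d ∷ drop 1 (proj₁ y)))

  birdStep : List (List (List Pol)) → List (List Pol) → List (List Pol)
  birdStep T X = proj₂ (mapAccR birdRow [] (zipᵈ [] X T))

  -- The initial matrix is the upper triangle of `A`, and for n rows there are n - 1 steps, counted
  -- by `drop 1 A`.
  det : List (List Pol) → Pol
  det A = headᵈ [] (headᵈ [] (foldl (λ X _ → birdStep (trailing A) X) (map (headᵈ []) (trailing A)) (drop 1 A)))

  infixr 5 _∷_

  -- Entries past the end of the list are read as zero and surplus entries are ignored, so the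
  -- lengths of rows never have to be tracked.
  data Row {J : Set} (f : J → Pol) : List Pol → List J → Set where
    []  : ∀ {r} → Row f r []
    _∷_ : ∀ {r j js} → headᵈ [] r ≈ f j → Row f (drop 1 r) js → Row f r (j ∷ js)

  Row-cong : ∀ {J : Set} {f g : J → Pol} {r js} → (∀ j → f j ≈ g j) → Row f r js → Row g r js
  Row-cong eq []       = []
  Row-cong eq (e ∷ es) = ≈-trans e (eq _) ∷ Row-cong eq es

  Row-zero : ∀ {J : Set} (js : List J) → Row (λ _ → []) [] js
  Row-zero []       = []
  Row-zero (j ∷ js) = ≈-refl ∷ Row-zero js

  Row-⊞ : ∀ {J : Set} {f g : J → Pol} r s {js} → Row f r js → Row g s js → Row (λ j → f j ⊻ g j) (r ⊞ s) js
  Row-⊞ r       s       []       []         = []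
  Row-⊞ []      s       (e ∷ es) (e′ ∷ es′) = ⊻-cong e e′ ∷ Row-⊞ [] (drop 1 s) es es′
  Row-⊞ (x ∷ r) []      (e ∷ es) (e′ ∷ es′) =
    ≈-trans (≈-sym (⊻-identityʳ x)) (⊻-cong e e′) ∷ ≡.subst (λ z → Row _ z _) (zipLong-[] r) (Row-⊞ r [] es es′)
    where
    zipLong-[] : ∀ r → r ⊞ [] ≡ r
    zipLong-[] []      = refl
    zipLong-[] (_ ∷ _) = refl
  Row-⊞ (x ∷ r) (y ∷ s) (e ∷ es) (e′ ∷ es′) = ⊻-cong e e′ ∷ Row-⊞ r s es es′

  Row-⊛ : ∀ {J : Set} {f : J → Pol} c r {js} → Row f r js → Row (λ j → c ⊛ f j) (map (c ⊛_) r) js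
  Row-⊛ c r       []       = []
  Row-⊛ c []      (e ∷ es) = ≈-trans (≈-sym (⊛-zeroʳ c)) (⊛-congˡ c e) ∷ Row-⊛ c [] es
  Row-⊛ c (x ∷ r) (e ∷ es) = ⊛-congˡ c e ∷ Row-⊛ c r es

  Matrix : ∀ {I J : Set} → (I → J → Pol) → List (List Pol) → List I → List J → Set
  Matrix a []      []       js = ⊤
  Matrix a (r ∷ A) (i ∷ is) js = Row (a i) r js × Matrix a A is js
  Matrix a _       _        js = ⊥
    where open import Data.Empty using (⊥)

  Matrix-tail : ∀ {I J : Set} (a : I → J → Pol) A is j js → Matrix a A is (j ∷ js) → Matrix a (map (drop 1) A) is js
  Matrix-tail a []      []       j js _              = tt
  Matrix-tail a (r ∷ A) (i ∷ is) j js ((_ ∷ es) , m) = es , Matrix-tail a A is j js m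

  Row-lincomb : ∀ {I J : Set} (a : I → J → Pol) (g : I → Pol) A c is js → Matrix a A is js → Row g c is →
                Row (λ j → ∑ is (λ l → g l ⊛ a l j)) (lincomb (zipᵈ [] A c)) js
  Row-lincomb a g []      c []       js m       rs       = Row-zero js
  Row-lincomb a g (r ∷ A) c (i ∷ is) js (e , m) (e′ ∷ rs) =
    Row-⊞ (map (headᵈ [] c ⊛_) r) _ (Row-cong (λ j → ⊛-cong e′ (≈-refl {a i j})) (Row-⊛ (headᵈ [] c) r e))
      (Row-lincomb a g A (drop 1 c) is js m rs)

  module _ {I : Set} (a : I → I → Pol) where

    Trailing : List (List (List Pol)) → List I → Set
    Trailing []      []       = ⊤
    Trailing (A ∷ T) (i ∷ is) = Matrix a A (i ∷ is) (i ∷ is) × Trailing T is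
    Trailing _       _        = ⊥
      where open import Data.Empty using (⊥)

    Minors : ℕ → List (List Pol) → List I → Set
    Minors p []      []       = ⊤
    Minors p (x ∷ X) (i ∷ is) = Row (minors a p is i) x (i ∷ is) × Minors p X is
    Minors p _       _        = ⊥
      where open import Data.Empty using (⊥)

    trailing-correct : ∀ A is → Matrix a A is is → Trailing (trailing A) is
    trailing-correct A is m = go A A is m (Matrix-length A is m)
      where
      Matrix-length : ∀ A is {js} → Matrix a A is js → length A ≡ length is
      Matrix-length []      []       _       = refl
      Matrix-length (r ∷ A) (i ∷ is) (_ , m) = cong suc (Matrix-length A is m)
      go : ∀ (U : List (List Pol)) A is → Matrix a A is is → length U ≡ length is →
           Trailing (proj₂ (mapAccL (λ B _ → map (drop 1) (drop 1 B) , B) A U)) is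
      go []      []      []       m       eq = tt
      go (_ ∷ U) (r ∷ A) (i ∷ is) (e , m) eq = (e , m) , go U (map (drop 1) A) is (Matrix-tail a A is i is m) (suc-injective eq)

    first-minors : ∀ T is → Trailing T is → Minors 0 (map (headᵈ []) T) is
    first-minors []            []       _             = tt
    first-minors ((r ∷ A) ∷ T) (i ∷ is) ((e , _) , t) =
      Row-cong (λ j → ≈-trans (≈-sym (P.*-identityʳ (a i j))) (≈-sym (P.+-identityʳ _))) e , first-minors T is t

    -- The accumulator and the new rows are treated together. A set of indices either contains the
    -- head `i`, which gives the diagonal minor of row i, or lies in the tail, so the diagonal sums
    -- are the sums of principal minors that `minors-suc` requires.
    birdStep-correct : ∀ p X T is → Minors p X is → Trailing T is →
                       let r = mapAccR birdRow [] (zipᵈ [] X T)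
                       in proj₁ r ≈ principal a (suc p) is × Minors (suc p) (proj₂ r) is
    birdStep-correct p []      []            []       _            _             = ≈-refl , tt
    birdStep-correct p (x ∷ X) ((r ∷ A) ∷ T) (i ∷ is) ((e ∷ es) , m) ((e′ , es′) , t) =
      let d , m′ = birdStep-correct p X T is m t
          d′ = proj₁ (mapAccR birdRow [] (zipᵈ [] X T))
      in ≈-trans (⊻-comm d′ (headᵈ [] x)) (⊻-cong e d) ,
         Row-cong
           (λ j → ≈-trans (⊻-cong (⊛-cong d (≈-refl {a i j})) (≈-refl {∑ is (λ l → minors a p is i l ⊛ a l j)}))
                          (≈-sym (minors-suc a p is i j)))
           (Row-⊞ (map (d′ ⊛_) r) _ (Row-⊛ d′ r e′) (Row-lincomb a (minors a p is i) A (drop 1 x) is (i ∷ is) es′ es)) ,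
         m′

    iterate-correct : ∀ (U : List (List Pol)) p X T is → Minors p X is → Trailing T is →
                      Minors (p + length U) (foldl (λ X _ → birdStep T X) X U) is
    iterate-correct []      p X T is m t rewrite +-identityʳ p = m
    iterate-correct (_ ∷ U) p X T is m t rewrite +-suc p (length U) =
      iterate-correct U (suc p) (birdStep T X) T is (proj₂ (birdStep-correct p X T is m t)) t

    head-minor : ∀ p X i is → Minors p X (i ∷ is) → headᵈ [] (headᵈ [] X) ≈ minors a p is i i
    head-minor p (x ∷ X) i is ((e ∷ _) , _) = e

    -- The number of steps equals the number of indices after `i`, so the sum over sublists has a
    -- single term, the full list.
    det-correct : ∀ A i is → Matrix a A (i ∷ is) (i ∷ is) → det A ≈ perm a (i ∷ is) (i ∷ is)
    det-correct (r ∷ A) i is m =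
        ≈-trans (head-minor (length A) _ i is (iterate-correct A 0 _ (trailing (r ∷ A)) (i ∷ is) (first-minors _ (i ∷ is) t) t))
          (≈-trans (P.reflexive (cong (λ n → minors a n is i i) (rows-length A is (proj₂ m)))) (∑⊂-full is _))
      where
      t : Trailing (trailing (r ∷ A)) (i ∷ is)
      t = trailing-correct (r ∷ A) (i ∷ is) m
      rows-length : ∀ A is {js} → Matrix a A is js → length A ≡ length is
      rows-length []      []       _       = refl
      rows-length (r ∷ A) (i ∷ is) (_ , m) = cong suc (rows-length A is m)

-- Degree and size bounds for Bird's algorithm

module DeterminantCost where

  open Cost
  open Folds
  open Polynomials
  open Determinant
  open import Data.Bool using (Bool)
  open import Data.List using (List; []; _∷_; length; foldr; map; drop)
  open import Data.List.Properties using (length-map)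
  open import Data.List.Relation.Unary.All as All using (All; []; _∷_)
  open import Data.Nat using (ℕ; suc; _+_; _*_; _≤_; s≤s; z≤n; _⊔_)
  open import Data.Nat.Properties
  open import Data.Product using (_×_; _,_; proj₁; proj₂)
  open import Relation.Binary.PropositionalEquality as ≡ using (_≡_; refl; cong)

  maximum : ∀ {A : Set} → (A → ℕ) → List A → ℕ
  maximum f = foldr (λ x n → f x ⊔ n) 0

  maximum≤ : ∀ {A : Set} (f : A → ℕ) {B xs} → All (λ x → f x ≤ B) xs → maximum f xs ≤ B
  maximum≤ f []       = z≤n
  maximum≤ f (p ∷ ps) = ⊔-lub p (maximum≤ f ps)

  ≤maximum : ∀ {A : Set} (f : A → ℕ) {B} xs → maximum f xs ≤ B → All (λ x → f x ≤ B) xs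
  ≤maximum f []       le = []
  ≤maximum f (x ∷ xs) le = ≤-trans (m≤m⊔n _ _) le ∷ ≤maximum f xs (≤-trans (m≤n⊔m (f x) _) le)

  size-list≤ : ∀ α {B} xs → All (λ x → size α x ≤ B) xs → size (list α) xs ≤ 1 + length xs * (1 + B)
  size-list≤ α []       []       = ≤-refl
  size-list≤ α (x ∷ xs) (p ∷ ps) = s≤s (≤-trans (+-mono-≤ p (size-list≤ α xs ps)) (≤-reflexive (+-suc _ _)))

  elements-size≤ : ∀ α xs → All (λ x → size α x ≤ size (list α) xs) xs
  elements-size≤ α []       = []
  elements-size≤ α (x ∷ xs) = ≤-trans (m≤m+n _ _) (n≤1+n _) ∷
    All.map (λ le → ≤-trans le (≤-trans (m≤n+m _ (size α x)) (n≤1+n _))) (elements-size≤ α xs)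

  -- Dimension and degree are measured together by a maximum. Sizes would add up in a linear
  -- combination and grow exponentially over the steps; maxima do not.
  rowNorm : List Pol → ℕ
  rowNorm r = length r ⊔ maximum length r

  norm : List (List Pol) → ℕ
  norm A = length A ⊔ maximum rowNorm A

  numBound rowBound matBound : Poly 1
  numBound = con 1 :+ (con 2 :* X)
  rowBound = con 1 :+ (X :* (con 1 :+ numBound))
  matBound = con 1 :+ (X :* (con 1 :+ rowBound))

  size-row≤ : ∀ r {B} → rowNorm r ≤ B → size vec r ≤ ⟪ rowBound ⟫ B
  size-row≤ r {B} le = ≤-trans (size-list≤ num r (All.map (λ {a} l → ≤-trans (≤-reflexive (size-num a)) (s≤s (*-monoʳ-≤ 2 l)))
      (≤maximum length r (≤-trans (m≤n⊔m (length r) _) le))))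
    (s≤s (*-monoˡ-≤ (1 + ⟪ numBound ⟫ B) (≤-trans (m≤m⊔n (length r) _) le)))

  size-mat≤ : ∀ A {B} → norm A ≤ B → size mat A ≤ ⟪ matBound ⟫ B
  size-mat≤ A {B} le = ≤-trans (size-list≤ vec A (All.map (λ {r} → size-row≤ r) (≤maximum rowNorm A (≤-trans (m≤n⊔m (length A) _) le))))
    (s≤s (*-monoˡ-≤ (1 + ⟪ rowBound ⟫ B) (≤-trans (m≤m⊔n (length A) _) le)))

  rowNorm≤size : ∀ r → rowNorm r ≤ size vec r
  rowNorm≤size r = ⊔-lub (≤-trans (n≤1+n _) (length≤size num r))
    (maximum≤ length (All.map (λ {a} → ≤-trans (length≤num a)) (elements-size≤ num r)))

  norm≤size : ∀ A → norm A ≤ size mat A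
  norm≤size A = ⊔-lub (≤-trans (n≤1+n _) (length≤size vec A))
    (maximum≤ rowNorm (All.map (λ {r} → ≤-trans (rowNorm≤size r)) (elements-size≤ vec A)))

  rowNorm-⊞ : ∀ r s {B} → rowNorm r ≤ B → rowNorm s ≤ B → rowNorm (r ⊞ s) ≤ B
  rowNorm-⊞ r s {B} le le′ = ⊔-lub
      (≤-trans (≤-reflexive (length-⊞ r s)) (⊔-lub (≤-trans (m≤m⊔n (length r) _) le) (≤-trans (m≤m⊔n (length s) _) le′)))
      (maximum≤ length (entries r s (≤maximum length r (≤-trans (m≤n⊔m (length r) _) le)) (≤maximum length s (≤-trans (m≤n⊔m (length s) _) le′))))
    where
    length-⊞ : ∀ r s → length (r ⊞ s) ≡ length r ⊔ length s
    length-⊞ []      s       = refl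
    length-⊞ (x ∷ r) []      = refl
    length-⊞ (x ∷ r) (y ∷ s) = cong suc (length-⊞ r s)
    entries : ∀ r s → All (λ a → length a ≤ B) r → All (λ a → length a ≤ B) s → All (λ a → length a ≤ B) (r ⊞ s)
    entries []      s       ps       qs       = qs
    entries (x ∷ r) []      ps       qs       = ps
    entries (x ∷ r) (y ∷ s) (p ∷ ps) (q ∷ qs) = ≤-trans (≤-reflexive (length-⊻ x y)) (⊔-lub p q) ∷ entries r s ps qs

  -- The bound does not depend on the number of summands: only the single product in each summand
  -- raises the degree.
  rowNorm-lincomb : ∀ {N S} ps → All (λ p → rowNorm (proj₁ p) ≤ S × length (proj₂ p) ≤ N) ps → rowNorm (lincomb ps) ≤ N + S
  rowNorm-lincomb []             []               = z≤n
  rowNorm-lincomb {N} {S} ((r , c) ∷ ps) ((le , le′) ∷ qs) = rowNorm-⊞ (map (c ⊛_) r) (lincomb ps)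
    (⊔-lub (≤-trans (≤-reflexive (length-map (c ⊛_) r)) (≤-trans (m≤m⊔n (length r) _) (≤-trans le (m≤n+m S N))))
      (maximum≤ length (scaled r (≤maximum length r (≤-trans (m≤n⊔m (length r) _) le)))))
    (rowNorm-lincomb ps qs)
    where
    scaled : ∀ r → All (λ a → length a ≤ S) r → All (λ a → length a ≤ N + S) (map (c ⊛_) r)
    scaled []      []       = []
    scaled (a ∷ r) (q ∷ qs) = ≤-trans (length-⊛ c a) (+-mono-≤ le′ q) ∷ scaled r qs

  All-zipᵈ : ∀ {A B : Set} {P : A → Set} {Q : B → Set} d xs ys → Q d → All P xs → All Q ys →
             All (λ p → P (proj₁ p) × Q (proj₂ p)) (zipᵈ d xs ys)
  All-zipᵈ d []       ys       qd ps       qs       = []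
  All-zipᵈ d (x ∷ xs) []       qd (p ∷ ps) qs       = (p , qd) ∷ All-zipᵈ d xs [] qd ps qs
  All-zipᵈ d (x ∷ xs) (y ∷ ys) qd (p ∷ ps) (q ∷ qs) = (p , q) ∷ All-zipᵈ d xs ys qd ps qs

  All-drop1 : ∀ {A : Set} {P : A → Set} {xs} → All P xs → All P (drop 1 xs)
  All-drop1 []       = []
  All-drop1 (p ∷ ps) = ps

  birdStep-norm : ∀ {N S} zs → All (λ z → rowNorm (proj₁ z) ≤ N × size mat (proj₂ z) ≤ S) zs →
                  let r = mapAccR birdRow [] zs
                  in length (proj₁ r) ≤ N × length (proj₂ r) ≡ length zs × All (λ y → rowNorm y ≤ N + S) (proj₂ r)
  birdStep-norm []             []               = z≤n , refl , []
  birdStep-norm {N} {S} ((x , A) ∷ zs) ((le , le′) ∷ ps) =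
    let a , b , c = birdStep-norm zs ps
        d = proj₁ (mapAccR birdRow [] zs)
        xs = ≤maximum length x (≤-trans (m≤n⊔m (length x) _) le)
    in ≤-trans (≤-reflexive (length-⊻ d (headᵈ [] x))) (⊔-lub a (first xs)) , cong suc b ,
       rowNorm-lincomb (zipᵈ [] A (d ∷ drop 1 x))
         (All-zipᵈ [] A _ z≤n (All.map (λ {r} l → ≤-trans (rowNorm≤size r) (≤-trans l le′)) (elements-size≤ vec A)) (a ∷ All-drop1 xs)) ∷ c
    where
    first : ∀ {x : List Pol} → All (λ a → length a ≤ N) x → length (headᵈ [] x) ≤ N
    first []      = z≤n
    first (p ∷ _) = p

  -- The increment depends on the input matrix alone, so the norm grows linearly in the number of
  -- steps.
  norm-birdStep : ∀ T X → norm (birdStep T X) ≤ norm X + size (list mat) T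
  norm-birdStep T X =
    let _ , b , c = birdStep-norm {norm X} {size (list mat) T} (zipᵈ [] X T) (All-zipᵈ [] X T (1≤size (list mat) T)
                      (≤maximum rowNorm X (m≤n⊔m (length X) _)) (elements-size≤ mat T))
    in ⊔-lub (≤-trans (≤-reflexive (≡.trans b (length-zipᵈ X T))) (≤-trans (m≤m⊔n (length X) _) (m≤m+n _ _))) (maximum≤ rowNorm c)
    where
    length-zipᵈ : ∀ (X : List (List Pol)) (T : List (List (List Pol))) → length (zipᵈ [] X T) ≡ length X
    length-zipᵈ []      T = refl
    length-zipᵈ (x ∷ X) T = cong suc (length-zipᵈ X (drop 1 T))

  size-head : ∀ (x : List Pol) → size num (headᵈ [] x) ≤ size vec x
  size-head []      = ≤-refl
  size-head (a ∷ x) = ≤-trans (m≤m+n _ _) (n≤1+n _)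

  abstract
    trailingᶜ : PT {mat} {list mat} trailing
    trailingᶜ = sndᶜ (mapAccLᶜ {𝟙} {vec} {mat} {mat} {h = λ x → map (drop 1) (drop 1 (proj₂ (proj₂ x))) , proj₂ (proj₂ x)}
        (pairᶜ (mapᶜ (tailᶜ ▹ sndᶜ idᶜ) ▹ pairᶜ unitᶜ (tailᶜ ▹ sndᶜ (sndᶜ idᶜ))) (sndᶜ (sndᶜ idᶜ)))
        (con 0) (λ _ _ B → ≤-trans (size-map-tail (drop 1 B)) (≤-trans (size-tail vec B) (m≤m+n _ 0)))
      ▹ pairᶜ unitᶜ (pairᶜ idᶜ idᶜ))
      where
      size-map-tail : ∀ A → size mat (map (drop 1) A) ≤ size mat A
      size-map-tail []      = ≤-refl
      size-map-tail (r ∷ A) = s≤s (+-mono-≤ (size-tail num r) (size-map-tail A))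

    birdStepᶜ : PT {list mat ⊗ mat} {mat} (λ y → birdStep (proj₁ y) (proj₂ y))
    birdStepᶜ = sndᶜ (mapAccRᶜ {𝟙} {vec ⊗ mat} {num} {vec} {h = λ x → birdRow (proj₂ (proj₂ x)) (proj₁ (proj₂ x))}
        (pairᶜ (⊻ᶜ ▹ pairᶜ (sndᶜ (sndᶜ idᶜ)) (headᶜ ▹ pairᶜ nilᶜ (fstᶜ (fstᶜ (sndᶜ idᶜ)))))
          (lincombᶜ ▹ zipᶜ ▹ pairᶜ nilᶜ (pairᶜ (sndᶜ (fstᶜ (sndᶜ idᶜ)))
            (consᶜ (sndᶜ (sndᶜ idᶜ)) (tailᶜ ▹ fstᶜ (fstᶜ (sndᶜ idᶜ)))))))
        X (λ _ y d → ≤-trans (size-⊻ d _) (+-monoʳ-≤ (size num d)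
            (≤-trans (size-head (proj₁ y)) (≤-trans (m≤m+n _ _) (≤-trans (n≤1+n _) (n≤1+n _))))))
      ▹ pairᶜ unitᶜ (pairᶜ (zipᶜ ▹ pairᶜ nilᶜ (pairᶜ (sndᶜ idᶜ) (fstᶜ idᶜ))) nilᶜ))

    detᶜ : PT {mat} {num} det
    detᶜ = headᶜ ▹ pairᶜ nilᶜ (headᶜ ▹ pairᶜ nilᶜ
        (foldlᶜ {list mat} {vec} {mat} {h = λ x → birdStep (proj₁ x) (proj₂ (proj₂ x))} (λ _ → ≤-refl)
          (birdStepᶜ ▹ pairᶜ (fstᶜ idᶜ) (sndᶜ (sndᶜ idᶜ)))
          (record
            { K = norm ; M = λ _ → 0 ; R = matBound ; r₁ = X ; r₂ = con 0
            ; K≤size = norm≤size ; M≤size = λ _ → z≤n ; size≤ = λ A → size-mat≤ A (m≤m+n _ 0)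
            ; growK = λ T _ A → ≤-trans (norm-birdStep T A) (+-monoʳ-≤ (norm A) (m≤m+n _ _))
            ; growM = λ _ _ _ → z≤n })
        ▹ pairᶜ trailingᶜ (pairᶜ tailᶜ (mapᶜ {𝟙} {vec′} (headᶜ ▹ pairᶜ nilᶜ (sndᶜ idᶜ)) ▹ pairᶜ unitᶜ trailingᶜ))))
      where
      vec′ : Ty
      vec′ = mat

-- The algorithm and the programs for its basic parts

module Algorithm where

  open Cost
  open Folds
  open Polynomials
  open Determinant
  open DeterminantCost using ()
  open import Data.Bool using (Bool; true; false; if_then_else_; _xor_; _∧_; _∨_; not)
  open import Data.List using (List; []; _∷_; length; foldl; foldr; map; drop; _++_; null; filterᵇ; concat; concatMap)
  open import Data.Nat using (ℕ; suc; _+_; _≤_; s≤s)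
  open import Data.Nat.Properties
  open import Data.Nat.Tactic.RingSolver using (solve-∀)
  open import Data.Product using (_×_; _,_; proj₁; proj₂)
  open import Data.Sum using (inj₁; inj₂)
  open import Data.Unit using (tt)
  open import Relation.Binary.PropositionalEquality as ≡ using (_≡_; refl; cong)

  subDigit : Bool → Bool × Bool → Bool × Bool
  subDigit c p = (if proj₁ p then proj₂ p ∧ c else (proj₂ p ∨ c)) , (proj₁ p xor proj₂ p) xor c

  -- The flag is the final borrow; x and y must have the same width.
  sub : Pol → Pol → Bool × Pol
  sub x y = mapAccL subDigit false (zipᵈ false x y)

  -- Subtraction suffices and nothing overflows the width: a + b - m is computed as a - (m - b). A
  -- borrow means a + b < m, and in this case a + b is m - ((m - b) - a).
  addMod : Pol → Pol → Pol → Pol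
  addMod m a b = let d = proj₂ (sub m b) ; r = sub a d
                 in if proj₁ r then proj₂ (sub m (proj₂ (sub d a))) else proj₂ r

  support : List Pol → List Pol
  support = foldr (λ a s → a ∷ filterᵇ (λ b → not (equal a b)) s) []

  -- z ^ n for the multiplicity n of u in A.
  zPower : List Pol → Pol → Pol
  zPower A u = foldr (λ a s → if equal u a then false ∷ s else s) (true ∷ []) A

  -- Two runs of powers, one below z^n and one above it. Each entry of A emits one power: the n
  -- entries equal to `u` from the lower run, all others from the upper one. In this way z^n is left
  -- out without any arithmetic on exponents.
  splitPowers : Pol → Pol × Pol → Pol → (Pol × Pol) × Pol
  splitPowers u s a = (if equal u a then ((false ∷ proj₁ s) , proj₂ s) else (proj₁ s , (false ∷ proj₂ s))) ,
                      (if equal u a then proj₁ s else proj₂ s)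

  -- The powers z ^ e with e ≤ length A, except for e = n, the multiplicity
  -- of u in A.
  otherPowers : List Pol → Pol → List Pol
  otherPowers A u = proj₂ (mapAccL (splitPowers u) (true ∷ [] , false ∷ zPower A u) A)

  -- The coefficients in T of ∏ (f + T) over the given f.
  coefficients : List Pol → List Pol
  coefficients = foldr (λ f s → map (f ⊛_) s ⊞ ([] ∷ s)) ((true ∷ []) ∷ [])

  Option : Set
  Option = Pol × Pol

  -- Pairs of a value z ^ j of the variable of colour u, and its weight.
  options : List Pol → Pol → List Option
  options A u = proj₂ (mapAccL (λ q w → false ∷ q , (q , w)) (true ∷ []) (coefficients (otherPowers A u)))

  grids : List Pol → List (Pol × List Option)
  grids A = map (λ u → u , options A u) (drop 1 (support A))

  -- A choice (v , b , x , p) pairs b with the colour v; x is its random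
  -- scalar and p lists the powers of the node for b + v.
  Choice : Set
  Choice = Pol × (Pol × (Pol × List Pol))

  -- Only its length matters: the number of random bits of a scalar.
  unary : List Pol → List Pol
  unary A = [] ∷ [] ∷ (A ++ support A)

  tosses : List Pol × List Pol → List Pol
  tosses x = concat (map (λ _ → concat (map (λ _ → unary (proj₁ x)) (support (proj₁ x)))) (proj₂ x))

  takeBits : List Pol → Pol → Pol × Pol
  takeBits us r = mapAccL (λ r _ → drop 1 r , headᵈ false r) r us

  nodePowers : List Pol → Pol → List Pol
  nodePowers A t = proj₂ (mapAccL (λ q _ → t ⊛ q , q) (true ∷ []) A)

  mkChoice : Pol → List Pol → Pol → Pol → Pol → Pol × Choice
  mkChoice m A b r v = let p = takeBits (unary A) r in proj₁ p , (v , (b , (proj₂ p , nodePowers A (addMod m b v))))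

  mkRow : Pol → List Pol → Pol → Pol → Pol × List Choice
  mkRow m A r b = mapAccL (mkChoice m A b) r (support A)

  mkRows : Pol → List Pol → List Pol → Pol → List (List Choice)
  mkRows m A B r = proj₂ (mapAccL (mkRow m A) r B)

  Point : Set
  Point = List (Pol × Option)

  weight : Point → Pol
  weight = foldr (λ p s → proj₂ (proj₂ p) ⊛ s) (true ∷ [])

  -- A colour missing from the point is the one without a variable; the scalar is then returned
  -- unscaled.
  scaleAt : Point → Pol → Pol → Pol
  scaleAt g v x = foldr (λ p s → if equal (proj₁ p) v then proj₁ (proj₂ p) ⊛ s else s) x g

  rowAt : Point → List Choice → List Pol
  rowAt g row = lincomb (map (λ c → proj₂ (proj₂ (proj₂ c)) , scaleAt g (proj₁ c) (proj₁ (proj₂ (proj₂ c)))) row)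

  term : List (List Choice) → Point → Pol
  term rows g = weight g ⊛ det (map (rowAt g) rows)

  -- A digit of an odometer: a colour, the list of all its options for the reset, and the suffix
  -- whose head is the current option.
  Digit : Set
  Digit = Pol × (List Option × List Option)

  point : List Digit → Point
  point = map (λ d → proj₁ d , headᵈ ([] , []) (proj₂ (proj₂ d)))

  advanceDigit : Bool → Digit → Bool × Digit
  advanceDigit c d = (if c then null (drop 1 (proj₂ (proj₂ d))) else false) ,
    (proj₁ d , (proj₁ (proj₂ d) , (if c then (if null (drop 1 (proj₂ (proj₂ d))) then proj₁ (proj₂ d) else drop 1 (proj₂ (proj₂ d)))
                                        else proj₂ (proj₂ d))))

  advance : List Digit → Bool × List Digit
  advance = mapAccL advanceDigit true

  -- The empty list has one position too, because an odometer is always in some state.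
  positions : List Option → List (List Option)
  positions []           = [] ∷ []
  positions (o ∷ [])     = (o ∷ []) ∷ []
  positions (o ∷ p ∷ os) = (o ∷ p ∷ os) ∷ positions (p ∷ os)

  -- The successive states of the odometer.
  trace : List Digit → List (List Digit)
  trace []                     = [] ∷ []
  trace ((u , (full , cur)) ∷ ds) =
    map (λ c → (u , (full , c)) ∷ ds) (positions cur) ++
    concatMap (λ es → map (λ c → (u , (full , c)) ∷ es) (positions full)) (drop 1 (trace ds))

  start : List (Pol × List Option) → List Digit
  start = map (λ f → proj₁ f , (proj₂ f , proj₂ f))

  gridSize : List (Pol × List Option) → ℕ
  gridSize fs = length (trace (start fs))

  gridSum : List (Pol × List Option) → List (List Choice) → Pol
  gridSum fs rows = foldl (λ s ds → s ⊻ term rows (point ds)) [] (trace (start fs))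

  pick : List (Pol × List Option) → List (List Choice) → List Choice → List Choice
  pick fs rest = foldr (λ c s → if isZero (gridSum fs ((c ∷ []) ∷ rest)) then s else c ∷ []) []

  -- The front row is decided and moved to the back. After as many rotations as there are rows, each
  -- is decided and the original order is restored.
  rotate : List (Pol × List Option) → List (List Choice) → List (List Choice)
  rotate fs rows = drop 1 rows ++ (pick fs (drop 1 rows) (headᵈ [] rows) ∷ [])

  refine : List (Pol × List Option) → List (List Choice) → List (List Choice)
  refine fs rows = foldl (λ s _ → rotate fs s) rows rows

  chosen : List Choice → Pol × Pol
  chosen row = let c = headᵈ ([] , ([] , ([] , []))) row in proj₁ c , proj₁ (proj₂ c)

  -- The first component plays the role of an optional value: it is empty until a pair of colour `a`
  -- has been taken out, and this blocks taking another.
  extractStep : Pol → Pol × Pol → List Pol × List (Pol × Pol) → List Pol × List (Pol × Pol)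
  extractStep a p s = if null (proj₁ s) ∧ equal a (proj₁ p) then (proj₂ p ∷ [] , proj₂ s) else (proj₁ s , p ∷ proj₂ s)

  extract : Pol → List (Pol × Pol) → List Pol × List (Pol × Pol)
  extract a = foldr (extractStep a) ([] , [])

  align : List Pol → List (Pol × Pol) → List Pol
  align A ps = proj₂ (mapAccL (λ s a → proj₂ (extract a s) , headᵈ [] (proj₁ (extract a s))) ps A)

  solve : ⟦ InputTy ⟧ → Pol → ⟦ OutputTy ⟧
  solve (m , (k , (A , B))) r = let rows = mkRows m A B r in
    if isZero (gridSum (grids A) rows) then inj₁ tt else inj₂ (align A (map chosen (refine (grids A) rows)))

  optionTy choiceTy rowsTy digitTy gridTy pointTy : Ty
  optionTy = num ⊗ num
  choiceTy = num ⊗ num ⊗ num ⊗ vec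
  rowsTy   = list (list choiceTy)
  digitTy  = num ⊗ list optionTy ⊗ list optionTy
  gridTy   = list (num ⊗ list optionTy)
  pointTy  = list (num ⊗ optionTy)

  p₁ : PT {σ ⊗ τ} {σ} proj₁
  p₁ = fstᶜ idᶜ

  p₂ : PT {σ ⊗ τ} {τ} proj₂
  p₂ = sndᶜ idᶜ

  size-++ : ∀ α xs ys → suc (size (list α) (xs ++ ys)) ≡ size (list α) xs + size (list α) ys
  size-++ α []       ys = refl
  size-++ α (x ∷ xs) ys = cong suc (≡.trans (≡.sym (+-suc (size α x) _))
    (≡.trans (cong (size α x +_) (size-++ α xs ys)) (≡.sym (+-assoc (size α x) _ _))))

  abstract
    andᶜ : PT {bit ⊗ bit} {bit} (λ x → proj₁ x ∧ proj₂ x)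
    andᶜ = convert (λ { (true , _) → refl ; (false , _) → refl }) (condᶜ p₁ p₂ (constᶜ false))

    orᶜ : PT {bit ⊗ bit} {bit} (λ x → proj₁ x ∨ proj₂ x)
    orᶜ = convert (λ { (true , _) → refl ; (false , _) → refl }) (condᶜ p₁ (constᶜ true) p₂)

    nullᶜ : PT {list α} {bit} null
    nullᶜ = convert (λ { [] → refl ; (_ ∷ _) → refl }) (caseᶜ (unconsᶜ idᶜ) (constᶜ true) (constᶜ false))

    concatᶜ : PT {list (list α)} {list α} concat
    concatᶜ {α} = foldrᶜ {𝟙} {list α} {list α} {h = λ x → proj₁ (proj₂ x) ++ proj₂ (proj₂ x)} (λ _ → ≤-refl)
        (appendᶜ ▹ p₂)
        (additive X λ _ xs s → ≤-trans (n≤1+n _) (≤-trans (≤-reflexive (size-++ α xs s))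
          (≤-trans (≤-reflexive (+-comm (size (list α) xs) _)) (+-monoʳ-≤ (size (list α) s) (n≤1+n _)))))
      ▹ pairᶜ unitᶜ (pairᶜ idᶜ nilᶜ)

    subᶜ : PT {num ⊗ num} {bit ⊗ num} (λ x → sub (proj₁ x) (proj₂ x))
    subᶜ = mapAccLᶜ {𝟙} {bit ⊗ bit} {bit} {bit} {h = λ x → subDigit (proj₂ (proj₂ x)) (proj₁ (proj₂ x))}
        (pairᶜ (condᶜ (p₁ ▹ p₁ ▹ p₂) (andᶜ ▹ pairᶜ (p₂ ▹ p₁ ▹ p₂) (p₂ ▹ p₂)) (orᶜ ▹ pairᶜ (p₂ ▹ p₁ ▹ p₂) (p₂ ▹ p₂)))
          (xorᶜ ▹ pairᶜ (xorᶜ ▹ p₁ ▹ p₂) (p₂ ▹ p₂)))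
        (con 0) (λ _ _ _ → ≤-refl)
      ▹ pairᶜ unitᶜ (pairᶜ (zipᶜ ▹ pairᶜ (constᶜ false) idᶜ) (constᶜ false))

    addModᶜ : PT {num ⊗ num ⊗ num} {num} (λ x → addMod (proj₁ x) (proj₁ (proj₂ x)) (proj₂ (proj₂ x)))
    addModᶜ = condᶜ (p₁ ▹ r) (p₂ ▹ subᶜ ▹ pairᶜ p₁ (p₂ ▹ subᶜ ▹ pairᶜ d (p₁ ▹ p₂))) (p₂ ▹ r)
      where
      d : PT {num ⊗ num ⊗ num} {num} (λ x → proj₂ (sub (proj₁ x) (proj₂ (proj₂ x))))
      d = p₂ ▹ subᶜ ▹ pairᶜ p₁ (p₂ ▹ p₂)
      r : PT {num ⊗ num ⊗ num} {bit ⊗ num} (λ x → sub (proj₁ (proj₂ x)) (proj₂ (sub (proj₁ x) (proj₂ (proj₂ x)))))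
      r = subᶜ ▹ pairᶜ (p₁ ▹ p₂) d

    size-filter : ∀ α (f : ⟦ α ⟧ → Bool) xs → size (list α) (filterᵇ f xs) ≤ size (list α) xs
    size-filter α f [] = ≤-refl
    size-filter α f (x ∷ xs) with f x
    ... | true  = s≤s (+-monoʳ-≤ (size α x) (size-filter α f xs))
    ... | false = ≤-trans (size-filter α f xs) (≤-trans (m≤n+m _ (size α x)) (n≤1+n _))

    supportᶜ : PT {vec} {vec} support
    supportᶜ = foldrᶜ {𝟙} {num} {vec}
        {h = λ x → proj₁ (proj₂ x) ∷ filterᵇ (λ b → not (equal (proj₁ (proj₂ x)) b)) (proj₂ (proj₂ x))} (λ _ → ≤-refl)
        (consᶜ (p₁ ▹ p₂) (filterᶜ (notᶜ ▹ equalᶜ) ▹ p₂))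
        (additive X λ _ a s → ≤-trans (s≤s (+-monoʳ-≤ (size num a) (size-filter num _ s))) (≤-reflexive (lem (size num a) (size vec s))))
      ▹ pairᶜ unitᶜ (pairᶜ idᶜ nilᶜ)
      where
      lem : ∀ a b → suc (a + b) ≡ b + (1 + a)
      lem = solve-∀

    zPowerᶜ : PT {vec ⊗ num} {num} (λ x → zPower (proj₁ x) (proj₂ x))
    zPowerᶜ = foldrᶜ {num} {num} {num}
        {h = λ x → if equal (proj₁ x) (proj₁ (proj₂ x)) then false ∷ proj₂ (proj₂ x) else proj₂ (proj₂ x)} (λ _ → ≤-refl)
        (condᶜ (equalᶜ ▹ pairᶜ p₁ (p₁ ▹ p₂)) (consᶜ (constᶜ false) (p₂ ▹ p₂)) (p₂ ▹ p₂))
        (additive (con 2) λ u a s → lem (equal u a) s)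
      ▹ pairᶜ p₂ (pairᶜ p₁ (consᶜ (constᶜ true) nilᶜ))
      where
      lem : ∀ b s → size num (if b then false ∷ s else s) ≤ size num s + 2
      lem true  s = ≤-reflexive (+-comm 2 _)
      lem false s = m≤m+n _ _

    otherPowersᶜ : PT {vec ⊗ num} {vec} (λ x → otherPowers (proj₁ x) (proj₂ x))
    otherPowersᶜ = p₂ ▹ mapAccLᶜ {num} {num} {num ⊗ num} {num}
        {h = λ x → splitPowers (proj₁ x) (proj₂ (proj₂ x)) (proj₁ (proj₂ x))}
        (pairᶜ (condᶜ eq (pairᶜ (consᶜ (constᶜ false) (p₁ ▹ p₂ ▹ p₂)) (p₂ ▹ p₂ ▹ p₂))
                         (pairᶜ (p₁ ▹ p₂ ▹ p₂) (consᶜ (constᶜ false) (p₂ ▹ p₂ ▹ p₂))))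
               (condᶜ eq (p₁ ▹ p₂ ▹ p₂) (p₂ ▹ p₂ ▹ p₂)))
        (con 2) (λ u a s → lem (equal u a) s)
      ▹ pairᶜ p₂ (pairᶜ p₁ (pairᶜ (consᶜ (constᶜ true) nilᶜ) (consᶜ (constᶜ false) zPowerᶜ)))
      where
      eq : PT {num ⊗ num ⊗ (num ⊗ num)} {bit} (λ x → equal (proj₁ x) (proj₁ (proj₂ x)))
      eq = equalᶜ ▹ pairᶜ p₁ (p₁ ▹ p₂)
      lem : ∀ b s → size (num ⊗ num) (if b then ((false ∷ proj₁ s) , proj₂ s) else (proj₁ s , (false ∷ proj₂ s))) ≤ size (num ⊗ num) s + 2
      lem true  (a , b) = ≤-reflexive (+-comm 2 (size (num ⊗ num) (a , b)))
      lem false (a , b) = ≤-reflexive (lem′ (size num a) (size num b))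
        where
        lem′ : ∀ a b → suc (a + suc (suc b)) ≡ suc (a + b) + 2
        lem′ = solve-∀

-- Running time of the algorithm

module AlgorithmCost where

  open Cost
  open Folds
  open Polynomials
  open Determinant
  open DeterminantCost
  open Algorithm
  open import Data.Bool using (Bool; true; false; if_then_else_; _∧_)
  open import Data.List using (List; []; _∷_; length; foldl; map; drop; null; concat)
  open import Data.List.Properties using (length-map; ∷-injective)
  open import Data.List.Relation.Unary.All as All using (All; []; _∷_)
  open import Data.Nat using (ℕ; suc; _+_; _≤_; s≤s; z≤n)
  open import Data.Nat.Properties
  open import Data.Nat.Tactic.RingSolver using (solve-∀)
  open import Data.Product using (_×_; _,_; proj₁; proj₂)
  open import Data.Sum using (_⊎_; inj₁; inj₂)
  open import Relation.Binary.PropositionalEquality as ≡ using (_≡_; refl; cong)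

  abstract
    coefficientsᶜ : PT {vec} {vec} coefficients
    coefficientsᶜ = foldrᶜ {𝟙} {num} {vec} {h = λ x → map (proj₁ (proj₂ x) ⊛_) (proj₂ (proj₂ x)) ⊞ ([] ∷ proj₂ (proj₂ x))} (λ _ → ≤-refl)
        (⊞ᶜ ▹ pairᶜ (scaleVecᶜ ▹ p₂) (consᶜ nilᶜ (p₂ ▹ p₂)))
        -- A step adds two copies of the coefficient list, so a bound by sizes would double each
        -- time. Its length and the degrees grow only additively.
        (record
          { K = rowNorm ; M = λ _ → 0 ; R = rowBound ; r₁ = X ; r₂ = con 0
          ; K≤size = rowNorm≤size ; M≤size = λ _ → z≤n ; size≤ = λ r → size-row≤ r (m≤m+n _ 0)
          ; growK = λ _ f s → grow f s ; growM = λ _ _ _ → z≤n })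
      ▹ pairᶜ unitᶜ (pairᶜ idᶜ (consᶜ (consᶜ (constᶜ true) nilᶜ) nilᶜ))
      where
      grow : ∀ f s → rowNorm (map (f ⊛_) s ⊞ ([] ∷ s)) ≤ rowNorm s + (1 + size num f)
      grow f s = rowNorm-⊞ (map (f ⊛_) s) ([] ∷ s)
          (⊔-lub (≤-trans (≤-reflexive (length-map (f ⊛_) s)) (≤-trans (m≤m⊔n (length s) _) (m≤m+n _ _)))
                 (maximum≤ length (scaled s (≤maximum length s (m≤n⊔m (length s) _)))))
          (⊔-lub (≤-trans (s≤s (m≤m⊔n (length s) _)) (≤-trans (≤-reflexive (+-comm 1 _)) (+-monoʳ-≤ (rowNorm s) (m≤m+n 1 _))))
                 (maximum≤ length {rowNorm s + (1 + size num f)} {[] ∷ s} (z≤n ∷ All.map (λ le → ≤-trans le (m≤m+n _ _)) (≤maximum length s (m≤n⊔m (length s) _)))))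
        where
        scaled : ∀ s {N} → All (λ a → length a ≤ N) s → All (λ a → length a ≤ N + (1 + size num f)) (map (f ⊛_) s)
        scaled []      []       = []
        scaled (a ∷ s) {N} (q ∷ qs) = ≤-trans (length-⊛ f a) (≤-trans (+-mono-≤ (≤-trans (length≤num f) (n≤1+n _)) q) (≤-reflexive (+-comm (1 + size num f) N))) ∷ scaled s qs

    optionsᶜ : PT {vec ⊗ num} {list optionTy} (λ x → options (proj₁ x) (proj₂ x))
    optionsᶜ = p₂ ▹ mapAccLᶜ {𝟙} {num} {num} {optionTy} {h = λ x → false ∷ proj₂ (proj₂ x) , (proj₂ (proj₂ x) , proj₁ (proj₂ x))}
        (pairᶜ (consᶜ (constᶜ false) (p₂ ▹ p₂)) (pairᶜ (p₂ ▹ p₂) (p₁ ▹ p₂)))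
        (con 2) (λ _ _ q → ≤-reflexive (+-comm 2 _))
      ▹ pairᶜ unitᶜ (pairᶜ (coefficientsᶜ ▹ otherPowersᶜ) (consᶜ (constᶜ true) nilᶜ))

    gridsᶜ : PT {vec} {gridTy} grids
    gridsᶜ = mapᶜ (pairᶜ p₂ optionsᶜ) ▹ pairᶜ idᶜ (tailᶜ ▹ supportᶜ)

    unaryᶜ : PT {vec} {vec} unary
    unaryᶜ = consᶜ nilᶜ (consᶜ nilᶜ (appendᶜ ▹ pairᶜ idᶜ supportᶜ))

    tossesᶜ : PT {vec ⊗ vec} {vec} tosses
    tossesᶜ = concatᶜ ▹ mapᶜ {h = λ y → concat (map (λ _ → unary (proj₁ y)) (support (proj₁ y)))}
        (concatᶜ ▹ mapᶜ {h = λ y → unary (proj₁ y)} (unaryᶜ ▹ p₁) ▹ pairᶜ p₁ (supportᶜ ▹ p₁))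

    takeBitsᶜ : PT {vec ⊗ num} {num ⊗ num} (λ x → takeBits (proj₁ x) (proj₂ x))
    takeBitsᶜ = mapAccLᶜ {𝟙} {num} {num} {bit} {h = λ x → drop 1 (proj₂ (proj₂ x)) , headᵈ false (proj₂ (proj₂ x))}
        (pairᶜ (tailᶜ ▹ p₂ ▹ p₂) (headᶜ ▹ pairᶜ (constᶜ false) (p₂ ▹ p₂)))
        (con 0) (λ _ _ r → ≤-trans (size-tail bit r) (m≤m+n _ 0))
      ▹ pairᶜ unitᶜ idᶜ

    nodePowersᶜ : PT {vec ⊗ num} {vec} (λ x → nodePowers (proj₁ x) (proj₂ x))
    nodePowersᶜ = p₂ ▹ mapAccLᶜ {num} {num} {num} {num} {h = λ x → proj₁ x ⊛ proj₂ (proj₂ x) , proj₂ (proj₂ x)}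
        (pairᶜ (⊛ᶜ ▹ pairᶜ p₁ (p₂ ▹ p₂)) (p₂ ▹ p₂))
        X (λ t _ q → ≤-trans (size-⊛ t q) (≤-trans (≤-reflexive (+-comm (size num t) _)) (+-monoʳ-≤ (size num q) (m≤m+n _ _))))
      ▹ pairᶜ p₂ (pairᶜ p₁ (consᶜ (constᶜ true) nilᶜ))

  size-takeBits : ∀ us r → size num (proj₁ (takeBits us r)) ≤ size num r
  size-takeBits us r = mapAccL-size num (λ r _ → drop 1 r , headᵈ false r) (λ r _ → size-tail bit r) r us

  size-mkRow : ∀ m A r b → size num (proj₁ (mkRow m A r b)) ≤ size num r
  size-mkRow m A r b = mapAccL-size num (mkChoice m A b) (λ r _ → size-takeBits (unary A) r) r (support A)

  abstract
    mkRowsᶜ : PT {num ⊗ vec ⊗ vec ⊗ num} {rowsTy}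
                (λ x → mkRows (proj₁ x) (proj₁ (proj₂ x)) (proj₁ (proj₂ (proj₂ x))) (proj₂ (proj₂ (proj₂ x))))
    mkRowsᶜ = p₂ ▹ mapAccLᶜ {num ⊗ vec} {num} {num} {list choiceTy}
        {h = λ x → mkRow (proj₁ (proj₁ x)) (proj₂ (proj₁ x)) (proj₂ (proj₂ x)) (proj₁ (proj₂ x))}
        mkRowᶜ (con 0) (λ c b r → ≤-trans (size-mkRow (proj₁ c) (proj₂ c) r b) (m≤m+n _ 0))
      ▹ pairᶜ (pairᶜ p₁ (p₁ ▹ p₂)) (p₂ ▹ p₂)
      where
      mkChoiceᶜ : PT {((num ⊗ vec) ⊗ num) ⊗ num ⊗ num} {num ⊗ choiceTy}
                    (λ x → mkChoice (proj₁ (proj₁ (proj₁ x))) (proj₂ (proj₁ (proj₁ x))) (proj₂ (proj₁ x)) (proj₂ (proj₂ x)) (proj₁ (proj₂ x)))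
      mkChoiceᶜ = pairᶜ (p₁ ▹ taken) (pairᶜ v (pairᶜ b (pairᶜ (p₂ ▹ taken) (nodePowersᶜ ▹ pairᶜ A (addModᶜ ▹ pairᶜ (p₁ ▹ p₁ ▹ p₁) (pairᶜ b v))))))
        where
        A : PT {((num ⊗ vec) ⊗ num) ⊗ num ⊗ num} {vec} (λ x → proj₂ (proj₁ (proj₁ x)))
        A = p₂ ▹ p₁ ▹ p₁
        b : PT {((num ⊗ vec) ⊗ num) ⊗ num ⊗ num} {num} (λ x → proj₂ (proj₁ x))
        b = p₂ ▹ p₁
        v : PT {((num ⊗ vec) ⊗ num) ⊗ num ⊗ num} {num} (λ x → proj₁ (proj₂ x))
        v = p₁ ▹ p₂
        taken : PT {((num ⊗ vec) ⊗ num) ⊗ num ⊗ num} {num ⊗ num} (λ x → takeBits (unary (proj₂ (proj₁ (proj₁ x)))) (proj₂ (proj₂ x)))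
        taken = takeBitsᶜ ▹ pairᶜ (unaryᶜ ▹ A) (p₂ ▹ p₂)
      mkRowᶜ : PT {(num ⊗ vec) ⊗ num ⊗ num} {num ⊗ list choiceTy}
                 (λ x → mkRow (proj₁ (proj₁ x)) (proj₂ (proj₁ x)) (proj₂ (proj₂ x)) (proj₁ (proj₂ x)))
      mkRowᶜ = mapAccLᶜ {(num ⊗ vec) ⊗ num} {num} {num} {choiceTy} mkChoiceᶜ (con 0)
          (λ c _ r → ≤-trans (size-takeBits (unary (proj₂ (proj₁ c))) r) (m≤m+n _ 0))
        ▹ pairᶜ (pairᶜ p₁ (p₁ ▹ p₂)) (pairᶜ (supportᶜ ▹ p₂ ▹ p₁) (p₂ ▹ p₂))

    weightᶜ : PT {pointTy} {num} weight
    weightᶜ = foldrᶜ {𝟙} {num ⊗ optionTy} {num} {h = λ x → proj₂ (proj₂ (proj₁ (proj₂ x))) ⊛ proj₂ (proj₂ x)} (λ _ → ≤-refl)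
        (⊛ᶜ ▹ pairᶜ (p₂ ▹ p₂ ▹ p₁ ▹ p₂) (p₂ ▹ p₂))
        (additive X λ _ p s → ≤-trans (size-⊛ (proj₂ (proj₂ p)) s) (≤-trans (≤-reflexive (+-comm _ (size num s)))
          (+-monoʳ-≤ (size num s) (≤-trans (size₂ (size num (proj₁ p)) (size num (proj₁ (proj₂ p)))) (n≤1+n _)))))
      ▹ pairᶜ unitᶜ (pairᶜ idᶜ (consᶜ (constᶜ true) nilᶜ))
      where
      size₂ : ∀ a b {c} → c ≤ suc (a + suc (b + c))
      size₂ a b = ≤-trans (m≤n+m _ b) (≤-trans (n≤1+n _) (≤-trans (m≤n+m _ a) (n≤1+n _)))

    scaleAtᶜ : PT {pointTy ⊗ num ⊗ num} {num} (λ x → scaleAt (proj₁ x) (proj₁ (proj₂ x)) (proj₂ (proj₂ x)))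
    scaleAtᶜ = foldrᶜ {num} {num ⊗ optionTy} {num}
        {h = λ x → if equal (proj₁ (proj₁ (proj₂ x))) (proj₁ x) then proj₁ (proj₂ (proj₁ (proj₂ x))) ⊛ proj₂ (proj₂ x) else proj₂ (proj₂ x)} (λ _ → ≤-refl)
        (condᶜ (equalᶜ ▹ pairᶜ (p₁ ▹ p₁ ▹ p₂) p₁) (⊛ᶜ ▹ pairᶜ (p₁ ▹ p₂ ▹ p₁ ▹ p₂) (p₂ ▹ p₂)) (p₂ ▹ p₂))
        (additive X λ v p s → grow (equal (proj₁ p) v) (size num v) p s)
      ▹ pairᶜ (p₁ ▹ p₂) (pairᶜ p₁ (p₂ ▹ p₂))
      where
      grow : ∀ b n (p : ⟦ num ⊗ optionTy ⟧) s → size num (if b then proj₁ (proj₂ p) ⊛ s else s) ≤ size num s + (n + size (num ⊗ optionTy) p)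
      grow true  n (u , q , w) s = ≤-trans (size-⊛ q s) (≤-trans (≤-reflexive (+-comm _ (size num s))) (+-monoʳ-≤ (size num s)
        (≤-trans (≤-trans (m≤m+n _ (size num w)) (≤-trans (n≤1+n _) (≤-trans (m≤n+m _ (size num u)) (n≤1+n _)))) (m≤n+m _ n))))
      grow false n p s = m≤m+n _ _

    termᶜ : PT {rowsTy ⊗ pointTy} {num} (λ x → term (proj₁ x) (proj₂ x))
    termᶜ = ⊛ᶜ ▹ pairᶜ (weightᶜ ▹ p₂) (detᶜ ▹ mapᶜ rowAtᶜ ▹ pairᶜ p₂ p₁)
      where
      rowAtᶜ : PT {pointTy ⊗ list choiceTy} {vec} (λ x → rowAt (proj₁ x) (proj₂ x))
      rowAtᶜ = lincombᶜ ▹ mapᶜ {h = λ x → proj₂ (proj₂ (proj₂ (proj₂ x))) , scaleAt (proj₁ x) (proj₁ (proj₂ x)) (proj₁ (proj₂ (proj₂ (proj₂ x))))}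
        (pairᶜ (p₂ ▹ p₂ ▹ p₂ ▹ p₂) (scaleAtᶜ ▹ pairᶜ p₁ (pairᶜ (p₁ ▹ p₂) (p₁ ▹ p₂ ▹ p₂ ▹ p₂))))

    pointᶜ : PT {list digitTy} {pointTy} point
    pointᶜ = mapᶜ {𝟙} {h = λ x → proj₁ (proj₂ x) , headᵈ ([] , []) (proj₂ (proj₂ (proj₂ x)))}
        (pairᶜ (p₁ ▹ p₂) (headᶜ ▹ pairᶜ (pairᶜ nilᶜ nilᶜ) (p₂ ▹ p₂ ▹ p₂)))
      ▹ pairᶜ unitᶜ idᶜ

    advanceᶜ : PT {list digitTy} {bit ⊗ list digitTy} advance
    advanceᶜ = mapAccLᶜ {𝟙} {digitTy} {bit} {digitTy} {h = λ x → advanceDigit (proj₂ (proj₂ x)) (proj₁ (proj₂ x))}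
        (pairᶜ (condᶜ (p₂ ▹ p₂) (nullᶜ ▹ rest) (constᶜ false))
          (pairᶜ (p₁ ▹ p₁ ▹ p₂) (pairᶜ (p₁ ▹ p₂ ▹ p₁ ▹ p₂)
            (condᶜ (p₂ ▹ p₂) (condᶜ (nullᶜ ▹ rest) (p₁ ▹ p₂ ▹ p₁ ▹ p₂) rest) (p₂ ▹ p₂ ▹ p₁ ▹ p₂)))))
        (con 0) (λ _ _ _ → ≤-refl)
      ▹ pairᶜ unitᶜ (pairᶜ idᶜ (constᶜ true))
      where
      rest : PT {𝟙 ⊗ digitTy ⊗ bit} {list optionTy} (λ x → drop 1 (proj₂ (proj₂ (proj₁ (proj₂ x)))))
      rest = tailᶜ ▹ p₂ ▹ p₂ ▹ p₁ ▹ p₂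

  advance-idle : ∀ ds → mapAccL advanceDigit false ds ≡ (false , ds)
  advance-idle []       = refl
  advance-idle (d ∷ ds) rewrite advance-idle ds = refl

  trace-head : ∀ ds → trace ds ≡ ds ∷ drop 1 (trace ds)
  trace-head []                                = refl
  trace-head ((u , full , []) ∷ ds)            = refl
  trace-head ((u , full , (o ∷ [])) ∷ ds)      = refl
  trace-head ((u , full , (o ∷ p ∷ os)) ∷ ds)  = refl

  -- The enumeration as a nested product coincides with iterating `advance` until the carry leaves
  -- the last digit. The former suits summation, the latter is what the loop executes.
  trace-advance : ∀ ds → trace ds ≡ ds ∷ (if proj₁ (advance ds) then [] else trace (proj₂ (advance ds)))
  trace-advance [] = refl
  trace-advance ((u , full , (o ∷ p ∷ os)) ∷ ds) rewrite advance-idle ds = refl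
  trace-advance ((u , full , []) ∷ ds) with advance ds | trace ds | trace-advance ds
  ... | true  , es | _ | refl = refl
  ... | false , es | _ | refl rewrite trace-head es = refl
  trace-advance ((u , full , (o ∷ [])) ∷ ds) with advance ds | trace ds | trace-advance ds
  ... | true  , es | _ | refl = refl
  ... | false , es | _ | refl rewrite trace-head es = refl

  -- The full list is bounded along with the current suffix because a carry restores it.
  DigitBound : ℕ → Digit → Set
  DigitBound n (u , full , cur) = size num u ≤ n × size (list optionTy) full ≤ n × size (list optionTy) cur ≤ n

  advance-bound : ∀ {n} c ds → All (DigitBound n) ds → All (DigitBound n) (proj₂ (mapAccL advanceDigit c ds))
  advance-bound c [] [] = []
  advance-bound false (d ∷ ds) (p ∷ ps) = p ∷ advance-bound false ds ps
  advance-bound true ((u , full , cur) ∷ ds) ((p , q , r) ∷ ps) with null (drop 1 cur)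
  ... | true  = (p , q , q) ∷ advance-bound true ds ps
  ... | false = (p , q , ≤-trans (size-tail optionTy cur) r) ∷ advance-bound false ds ps

  digitsBound : Poly 1
  digitsBound = con 1 :+ (X :* (con 1 :+ (con 1 :+ (X :+ (con 1 :+ (X :+ X))))))

  size-digits : ∀ {n} ds → length ds ≤ n → All (DigitBound n) ds → size (list digitTy) ds ≤ ⟪ digitsBound ⟫ n
  size-digits ds le ps = ≤-trans (size-list≤ digitTy ds (All.map (λ (p , q , r) → s≤s (+-mono-≤ p (s≤s (+-mono-≤ q r)))) ps))
                           (s≤s (*-monoˡ-≤ _ le))

  -- A maximum instead of a sum of sizes. It keeps the running total over superpolynomially many
  -- grid points as small as the bound for a single term.
  size-⊻-⊔ : ∀ {B} a b → size num a ≤ B → size num b ≤ B → size num (a ⊻ b) ≤ B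
  size-⊻-⊔ []      b       p q = q
  size-⊻-⊔ (x ∷ a) []      p q = p
  size-⊻-⊔ (x ∷ a) (y ∷ b) (s≤s (s≤s p)) (s≤s (s≤s q)) = s≤s (s≤s (size-⊻-⊔ a b p q))

  module _ where
    private
      sweep : List (List Choice) × (List Digit × Pol) → Pol
      sweep x = foldl (λ s ds → s ⊻ term (proj₁ x) (point ds)) (proj₂ (proj₂ x)) (trace (proj₁ (proj₂ x)))

      acc′ : List (List Choice) × (List Digit × Pol) → Pol
      acc′ x = proj₂ (proj₂ x) ⊻ term (proj₁ x) (point (proj₁ (proj₂ x)))

      next : List (List Choice) × (List Digit × Pol) → (List Digit × Pol) ⊎ Pol
      next x = if proj₁ (advance (proj₁ (proj₂ x))) then inj₂ (acc′ x) else inj₁ (proj₂ (advance (proj₁ (proj₂ x))) , acc′ x)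

      termAtᶜ : PT {rowsTy ⊗ list digitTy} {num} (λ x → term (proj₁ x) (point (proj₂ x)))
      termAtᶜ = termᶜ ▹ pairᶜ p₁ (pointᶜ ▹ p₂)

      nextᶜ : PT {rowsTy ⊗ list digitTy ⊗ num} {(list digitTy ⊗ num) ⊕ num} next
      nextᶜ = condᶜ (p₁ ▹ advanceᶜ ▹ p₁ ▹ p₂) (inrᶜ acc) (inlᶜ (pairᶜ (p₂ ▹ advanceᶜ ▹ p₁ ▹ p₂) acc))
        where
        acc : PT {rowsTy ⊗ list digitTy ⊗ num} {num} acc′
        acc = ⊻ᶜ ▹ pairᶜ (p₂ ▹ p₂) (termAtᶜ ▹ pairᶜ p₁ (p₁ ▹ p₂))

      sumBound states : Poly 1
      sumBound = X :+ termAtᶜ .out ⊙ (con 1 :+ (X :+ digitsBound))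
      states = con 1 :+ (digitsBound :+ sumBound)

      -- The recursion is on the list of states still to be visited; the state of the odometer
      -- itself does not get structurally smaller.
      iterates : ∀ rows {n} tr ds s → size rowsTy rows ≤ n → trace ds ≡ tr → length ds ≤ n → All (DigitBound n) ds →
                 size num s ≤ ⟪ sumBound ⟫ n →
                 Iterates rowsTy {list digitTy ⊗ num} {num} next rows (⟪ states ⟫ n) (ds , s) (foldl (λ s ds → s ⊻ term rows (point ds)) s tr) (length tr)
      iterates rows [] ds s le eq len ps sm with () ← ≡.trans (≡.sym eq) (trace-advance ds)
      iterates rows {n} (es ∷ tr) ds s le eq len ps sm
        with proj₁ (advance ds) in carry | ∷-injective (≡.trans (≡.sym eq) (trace-advance ds))
      ... | true  | refl , refl = stop (s≤s (+-mono-≤ (size-digits ds len ps) sm))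
            (cong (λ b → if b then inj₂ (acc′ (rows , ds , s)) else inj₁ (proj₂ (advance ds) , acc′ (rows , ds , s))) carry)
      ... | false | refl , eq′  = continue (s≤s (+-mono-≤ (size-digits ds len ps) sm))
            (cong (λ b → if b then inj₂ (acc′ (rows , ds , s)) else inj₁ (proj₂ (advance ds) , acc′ (rows , ds , s))) carry)
            (iterates rows tr (proj₂ (advance ds)) (acc′ (rows , ds , s)) le (≡.sym eq′)
              (≤-trans (≤-reflexive (length-mapAccL advanceDigit true ds)) len) (advance-bound true ds ps)
              (size-⊻-⊔ s (term rows (point ds)) sm
                (≤-trans (termAtᶜ .small (rows , ds)) (≤-trans
                  (≤-⊙ (termAtᶜ .out) (con 1 :+ (X :+ digitsBound)) _ (s≤s (+-mono-≤ le (size-digits ds len ps)))) (m≤n+m _ n)))))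

      1≤trace : ∀ ds → 1 ≤ length (trace ds)
      1≤trace ds = ≤-trans (s≤s z≤n) (≤-reflexive (≡.sym (cong length (trace-advance ds))))

      -- The source of the superpolynomial running time: one round per grid point, with polynomial
      -- cost in each round.
      sweepᶜ : Comp {rowsTy ⊗ list digitTy ⊗ num} {num} (λ x → length (trace (proj₁ (proj₂ x)))) sweep
      sweepᶜ = loopᶜ {rowsTy} {list digitTy ⊗ num} {num} nextᶜ states (con 1) (λ x → length (trace (proj₁ (proj₂ x))))
          (λ (rows , ds , s) → let a = size rowsTy rows ; b = size (list digitTy) ds ; c = size num s in
            iterates rows (trace ds) ds s (fit₁ a b c) refl (≤-trans (n≤1+n _) (≤-trans (length≤size digitTy ds) (fit₂ a b c)))
              (All.map (λ {d} le → digit-bound d (≤-trans le (fit₂ a b c))) (elements-size≤ digitTy ds))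
              (≤-trans (fit₃ a b c) (m≤m+n _ _)))
          (λ x → 1≤trace (proj₁ (proj₂ x))) (λ _ → ≤-refl)
        where
        fit₁ : ∀ a b c → a ≤ suc (a + suc (b + c))
        fit₁ a b c = ≤-trans (m≤m+n a _) (n≤1+n _)
        fit₂ : ∀ a b c → b ≤ suc (a + suc (b + c))
        fit₂ a b c = ≤-trans (m≤m+n b c) (≤-trans (n≤1+n _) (≤-trans (m≤n+m _ a) (n≤1+n _)))
        fit₃ : ∀ a b c → c ≤ suc (a + suc (b + c))
        fit₃ a b c = ≤-trans (m≤n+m c b) (≤-trans (n≤1+n _) (≤-trans (m≤n+m _ a) (n≤1+n _)))
        digit-bound : ∀ {n} d → size digitTy d ≤ n → DigitBound n d
        digit-bound (u , full , cur) le =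
          let a = size num u ; b = size (list optionTy) full ; c = size (list optionTy) cur
          in ≤-trans (fit₁ a b c) le , ≤-trans (fit₂ a b c) le , ≤-trans (fit₃ a b c) le

      startᶜ : PT {gridTy} {list digitTy} start
      startᶜ = mapᶜ {𝟙} {h = λ x → proj₁ (proj₂ x) , (proj₂ (proj₂ x) , proj₂ (proj₂ x))}
          (pairᶜ (p₁ ▹ p₂) (pairᶜ (p₂ ▹ p₂) (p₂ ▹ p₂)))
        ▹ pairᶜ unitᶜ idᶜ

    1≤gridSize : ∀ fs → 1 ≤ gridSize fs
    1≤gridSize fs = 1≤trace (start fs)

    abstract
      gridSumᶜ : Comp {gridTy ⊗ rowsTy} {num} (λ x → gridSize (proj₁ x)) (λ x → gridSum (proj₁ x) (proj₂ x))
      gridSumᶜ = after (λ _ → ≤-refl) sweepᶜ (weigh (λ x → 1≤gridSize (proj₁ x)) (pairᶜ p₂ (pairᶜ (startᶜ ▹ p₁) nilᶜ)))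

  size-pick : ∀ fs rest row → size (list choiceTy) (pick fs rest row) ≤ size (list choiceTy) row
  size-pick fs rest []        = ≤-refl
  size-pick fs rest (c ∷ row) with isZero (gridSum fs ((c ∷ []) ∷ rest))
  ... | true  = ≤-trans (size-pick fs rest row) (≤-trans (m≤n+m _ (size choiceTy c)) (n≤1+n _))
  ... | false = s≤s (+-monoʳ-≤ (size choiceTy c) (1≤size (list choiceTy) row))

  -- The surplus 2 pays for the empty row that is appended when there are no rows at all.
  size-rotate : ∀ fs rows → size rowsTy (rotate fs rows) ≤ size rowsTy rows + 2
  size-rotate fs []           = ≤-refl
  size-rotate fs (row ∷ rows) = ≤-trans (n≤1+n _) (≤-trans
    (≤-reflexive (size-++ (list choiceTy) rows (pick fs rows row ∷ [])))
    (≤-trans (+-monoʳ-≤ (size rowsTy rows) (s≤s (+-monoˡ-≤ 1 (size-pick fs rows row)))) (≤-trans (≤-reflexive (lem (size rowsTy rows) (size (list choiceTy) row))) (n≤1+n _))))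
    where
    lem : ∀ a b → a + suc (b + 1) ≡ b + a + 2
    lem = solve-∀

  size-extract : ∀ a ps → size (list (num ⊗ num)) (proj₂ (extract a ps)) ≤ size (list (num ⊗ num)) ps
  size-extract a []       = ≤-refl
  size-extract a (p ∷ ps) with null (proj₁ (extract a ps)) ∧ equal a (proj₁ p)
  ... | true  = ≤-trans (size-extract a ps) (≤-trans (m≤n+m _ (size (num ⊗ num) p)) (n≤1+n _))
  ... | false = s≤s (+-monoʳ-≤ (size (num ⊗ num) p) (size-extract a ps))

  abstract
    refineᶜ : Comp {gridTy ⊗ rowsTy} {rowsTy} (λ x → gridSize (proj₁ x)) (λ x → refine (proj₁ x) (proj₂ x))
    refineᶜ = after (λ _ → ≤-refl)
        (foldlᶜ {gridTy} {list choiceTy} {rowsTy} {h = λ x → rotate (proj₁ x) (proj₂ (proj₂ x))} 1≤gridSize rotateᶜ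
          (additive (con 2) λ fs _ rows → size-rotate fs rows))
        (weigh (λ x → 1≤gridSize (proj₁ x)) (pairᶜ p₁ (pairᶜ p₂ p₂)))
      where
      μ : ∀ {A : Set} → List (Pol × List Option) × A → ℕ
      μ x = gridSize (proj₁ x)
      pos : ∀ {A : Set} (x : List (Pol × List Option) × A) → 1 ≤ μ x
      pos x = 1≤gridSize (proj₁ x)
      pickᶜ : Comp {gridTy ⊗ rowsTy ⊗ list choiceTy} {list choiceTy} μ (λ x → pick (proj₁ x) (proj₁ (proj₂ x)) (proj₂ (proj₂ x)))
      pickᶜ = after (λ _ → ≤-refl)
          (foldrᶜ {gridTy ⊗ rowsTy} {choiceTy} {list choiceTy}
            {h = λ x → if isZero (gridSum (proj₁ (proj₁ x)) ((proj₁ (proj₂ x) ∷ []) ∷ proj₂ (proj₁ x))) then proj₂ (proj₂ x) else proj₁ (proj₂ x) ∷ []}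
            {μ = μ} pos
            (condᶜ (after pos′ isZeroᶜ (after (λ _ → ≤-refl) gridSumᶜ (weigh pos′ (pairᶜ (p₁ ▹ p₁) (consᶜ (consᶜ (p₁ ▹ p₂) nilᶜ) (p₂ ▹ p₁))))))
              (weigh pos′ (p₂ ▹ p₂)) (weigh pos′ (consᶜ (p₁ ▹ p₂) nilᶜ)))
            (additive (con 1 :+ X) λ c x s → grow (isZero (gridSum (proj₁ c) ((x ∷ []) ∷ proj₂ c))) c x s))
          (weigh pos (pairᶜ (pairᶜ p₁ (p₁ ▹ p₂)) (pairᶜ (p₂ ▹ p₂) nilᶜ)))
        where
        pos′ : ∀ {A B : Set} (x : (List (Pol × List Option) × A) × B) → 1 ≤ μ (proj₁ x)
        pos′ x = pos (proj₁ x)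
        grow : ∀ b (c : ⟦ gridTy ⊗ rowsTy ⟧) (x : ⟦ choiceTy ⟧) s →
               size (list choiceTy) (if b then s else x ∷ []) ≤ size (list choiceTy) s + (1 + (size (gridTy ⊗ rowsTy) c + size choiceTy x))
        grow true  c x s = m≤m+n _ _
        grow false c x s = ≤-trans (s≤s (≤-reflexive (+-comm (size choiceTy x) 1)))
          (≤-trans (+-mono-≤ (1≤size (list choiceTy) s) (s≤s (m≤n+m _ (size (gridTy ⊗ rowsTy) c)))) ≤-refl)
      rotateᶜ : Comp {gridTy ⊗ list choiceTy ⊗ rowsTy} {rowsTy} μ (λ x → rotate (proj₁ x) (proj₂ (proj₂ x)))
      rotateᶜ = after pos appendᶜ (pairᶜ (weigh pos (tailᶜ ▹ p₂ ▹ p₂))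
        (consᶜ (after (λ _ → ≤-refl) pickᶜ (weigh pos (pairᶜ p₁ (pairᶜ (tailᶜ ▹ p₂ ▹ p₂) (headᶜ ▹ pairᶜ nilᶜ (p₂ ▹ p₂))))))
          (weigh pos nilᶜ)))

    alignᶜ : PT {vec ⊗ list (num ⊗ num)} {vec} (λ x → align (proj₁ x) (proj₂ x))
    alignᶜ = p₂ ▹ mapAccLᶜ {𝟙} {num} {list (num ⊗ num)} {num}
        {h = λ x → proj₂ (extract (proj₁ (proj₂ x)) (proj₂ (proj₂ x))) , headᵈ [] (proj₁ (extract (proj₁ (proj₂ x)) (proj₂ (proj₂ x))))}
        (pairᶜ (p₂ ▹ extractᶜ ▹ p₂) (headᶜ ▹ pairᶜ nilᶜ (p₁ ▹ extractᶜ ▹ p₂)))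
        (con 0) (λ _ a ps → ≤-trans (size-extract a ps) (m≤m+n _ 0))
      ▹ pairᶜ unitᶜ idᶜ
      where
      extractᶜ : PT {num ⊗ list (num ⊗ num)} {vec ⊗ list (num ⊗ num)} (λ x → extract (proj₁ x) (proj₂ x))
      extractᶜ = foldrᶜ {num} {num ⊗ num} {vec ⊗ list (num ⊗ num)} {h = λ x → extractStep (proj₁ x) (proj₁ (proj₂ x)) (proj₂ (proj₂ x))} (λ _ → ≤-refl)
          (condᶜ (andᶜ ▹ pairᶜ (nullᶜ ▹ p₁ ▹ p₂ ▹ p₂) (equalᶜ ▹ pairᶜ p₁ (p₁ ▹ p₁ ▹ p₂)))
            (pairᶜ (consᶜ (p₂ ▹ p₁ ▹ p₂) nilᶜ) (p₂ ▹ p₂ ▹ p₂))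
            (pairᶜ (p₁ ▹ p₂ ▹ p₂) (consᶜ (p₁ ▹ p₂) (p₂ ▹ p₂ ▹ p₂))))
          (additive (con 1 :+ X) λ a p s → grow (null (proj₁ s) ∧ equal a (proj₁ p)) a p s)
        ▹ pairᶜ p₁ (pairᶜ p₂ (pairᶜ nilᶜ nilᶜ))
        where
        grow : ∀ b (a : Pol) (p : Pol × Pol) (s : List Pol × List (Pol × Pol)) →
               size (vec ⊗ list (num ⊗ num)) (if b then (proj₂ p ∷ [] , proj₂ s) else (proj₁ s , p ∷ proj₂ s))
                 ≤ size (vec ⊗ list (num ⊗ num)) s + (1 + (size num a + size (num ⊗ num) p))
        grow true  a (v , b) (f , r) = s≤s (≤-trans (≤-reflexive (lem (size num b) (size (list (num ⊗ num)) r)))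
          (+-mono-≤ (m≤n+m (size (list (num ⊗ num)) r) (size vec f)) (s≤s (≤-trans (s≤s (m≤n+m (size num b) (size num v))) (m≤n+m _ (size num a))))))
          where
          lem : ∀ b r → suc (b + 1) + r ≡ r + suc (suc b)
          lem = solve-∀
        grow false a p (f , r) = s≤s (≤-trans (≤-reflexive (lem (size vec f) (size (num ⊗ num) p) (size (list (num ⊗ num)) r)))
          (+-monoʳ-≤ (size vec f + size (list (num ⊗ num)) r) (s≤s (m≤n+m _ (size num a)))))
          where
          lem : ∀ f p r → f + suc (p + r) ≡ (f + r) + suc p
          lem = solve-∀

    solveᶜ : Comp {InputTy ⊗ num} {OutputTy} (λ x → gridSize (grids (proj₁ (proj₂ (proj₂ (proj₁ x)))))) (λ x → solve (proj₁ x) (proj₂ x))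
    solveᶜ = condᶜ (after pos isZeroᶜ (after (λ _ → ≤-refl) gridSumᶜ input)) (weigh pos (inlᶜ unitᶜ))
        (inrᶜ (after pos alignᶜ (pairᶜ (weigh pos A) (after pos (mapᶜ {𝟙} {h = λ x → chosen (proj₂ x)} (chosenᶜ ▹ p₂) ▹ pairᶜ unitᶜ idᶜ)
          (after (λ _ → ≤-refl) refineᶜ input)))))
      where
      μ : ⟦ InputTy ⊗ num ⟧ → ℕ
      μ x = gridSize (grids (proj₁ (proj₂ (proj₂ (proj₁ x)))))
      pos : ∀ x → 1 ≤ μ x
      pos x = 1≤gridSize (grids (proj₁ (proj₂ (proj₂ (proj₁ x)))))
      A : PT {InputTy ⊗ num} {vec} (λ x → proj₁ (proj₂ (proj₂ (proj₁ x))))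
      A = p₁ ▹ p₂ ▹ p₂ ▹ p₁
      input : Comp {InputTy ⊗ num} {gridTy ⊗ rowsTy} μ
                (λ x → grids (proj₁ (proj₂ (proj₂ (proj₁ x)))) ,
                       mkRows (proj₁ (proj₁ x)) (proj₁ (proj₂ (proj₂ (proj₁ x)))) (proj₂ (proj₂ (proj₂ (proj₁ x)))) (proj₂ x))
      input = weigh pos (pairᶜ (gridsᶜ ▹ A) (mkRowsᶜ ▹ pairᶜ (p₁ ▹ p₁) (pairᶜ A (pairᶜ (p₂ ▹ p₂ ▹ p₂ ▹ p₁) p₂))))
      chosenᶜ : PT {list choiceTy} {num ⊗ num} chosen
      chosenᶜ = pairᶜ (p₁ ▹ head) (p₁ ▹ p₂ ▹ head)
        where
        head : PT {list choiceTy} {choiceTy} (headᵈ ([] , ([] , ([] , []))))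
        head = headᶜ ▹ pairᶜ (pairᶜ nilᶜ (pairᶜ nilᶜ (pairᶜ nilᶜ nilᶜ))) idᶜ

-- The weighted sum of determinants over the grid

module GridSum where

  open Folds
  open Polynomials
  open Determinant
  open Algorithm
  open AlgorithmCost using (trace-head)
  open Permanent polynomials ⊻-self
  open import Algebra.Bundles using (CommutativeRing)
  open import Data.Bool using (Bool; true; false; if_then_else_)
  open import Data.List using (List; []; _∷_; length; foldl; map; drop; concatMap; upTo; applyUpTo; downFrom)
  open import Data.List.Properties using (reverse-upTo; length-++; length-map; map-id)
  open import Data.List.Relation.Binary.Permutation.Propositional using (_↭_; ↭-sym)
  open import Data.List.Relation.Binary.Permutation.Propositional.Properties using (↭-reverse; ∈-resp-↭)
  open import Data.List.Relation.Unary.Any using (here; there)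
  open import Data.List.Membership.Propositional using (_∈_)
  open import Data.List.Membership.Propositional.Properties using (∈-upTo⁻)
  open import Data.List.Relation.Unary.All as All using (All; []; _∷_)
  open import Data.Nat using (ℕ; zero; suc; z≤n; s≤s; _<_) renaming (_+_ to _ℕ+_; _*_ to _ℕ*_)
  open import Data.Product using (_×_; _,_; proj₁; proj₂)
  open import Function using (_∘_; id)
  open import Relation.Binary.PropositionalEquality as ≡ using (_≡_; refl; cong; cong₂; subst)

  open CommutativeRing polynomials using (setoid; +-congˡ; +-congʳ; *-congˡ; *-identityʳ)
    renaming (+-identityˡ to ⊻-identityˡ)
  open import Relation.Binary.Reasoning.Setoid setoid hiding (start)
  open import Algebra.Properties.CommutativeSemigroup (CommutativeRing.*-commutativeSemigroup polynomials)
    using (interchange; x∙yz≈y∙xz)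

  nth : ∀ {A : Set} → A → List A → ℕ → A
  nth d []       i       = d
  nth d (x ∷ xs) zero    = x
  nth d (x ∷ xs) (suc i) = nth d xs i

  map-nth : ∀ {A B : Set} (d : A) xs (f : A → B) (h : ℕ → B) → (∀ i → h i ≡ f (nth d xs i)) →
            applyUpTo h (length xs) ≡ map f xs
  map-nth d []       f h eq = refl
  map-nth d (x ∷ xs) f h eq = cong₂ _∷_ (eq 0) (map-nth d xs f (h ∘ suc) (eq ∘ suc))

  map-applyUpTo : ∀ {A B : Set} (f : A → B) h n → map f (applyUpTo h n) ≡ applyUpTo (f ∘ h) n
  map-applyUpTo f h zero    = refl
  map-applyUpTo f h (suc n) = cong (f (h 0) ∷_) (map-applyUpTo f (h ∘ suc) n)

  -- The first coordinate is summed innermost because the first digit of the odometer turns fastest.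
  gridTotal : List (Pol × List Option) → (Point → Pol) → Pol
  gridTotal []                F = F []
  gridTotal ((u , full) ∷ fs) F = gridTotal fs (λ g → ∑ full (λ o → F ((u , o) ∷ g)))

  gridTotal-cong : ∀ fs {F G : Point → Pol} → (∀ g → F g ≈ G g) → gridTotal fs F ≈ gridTotal fs G
  gridTotal-cong []                eq = eq []
  gridTotal-cong ((u , full) ∷ fs) eq = gridTotal-cong fs (λ g → ∑-cong full (λ o → eq ((u , o) ∷ g)))

  gridTotal-+ : ∀ fs (F G : Point → Pol) → gridTotal fs (λ g → F g ⊻ G g) ≈ gridTotal fs F ⊻ gridTotal fs G
  gridTotal-+ []                F G = ≈-refl
  gridTotal-+ ((u , full) ∷ fs) F G = ≈-trans (gridTotal-cong fs (λ g → ∑-+ full _ _)) (gridTotal-+ fs _ _)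

  gridTotal-0 : ∀ fs → gridTotal fs (λ _ → []) ≈ []
  gridTotal-0 []                = ≈-refl
  gridTotal-0 ((u , full) ∷ fs) = ≈-trans (gridTotal-cong fs (λ g → ∑-zero full)) (gridTotal-0 fs)

  gridTotal-* : ∀ c fs (F : Point → Pol) → gridTotal fs (λ g → c ⊛ F g) ≈ c ⊛ gridTotal fs F
  gridTotal-* c []                F = ≈-refl
  gridTotal-* c ((u , full) ∷ fs) F = ≈-trans (gridTotal-cong fs (λ g → ∑-* c full _)) (gridTotal-* c fs _)

  -- A sum over an empty list of options is zero, but the odometer passes such a digit once, with a
  -- default option. Excluding this case makes both agree.
  NonEmpty : Pol × List Option → Set
  NonEmpty f = 0 < length (proj₂ f)

  length-positions : ∀ os → 0 < length os → length (positions os) ≡ length os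
  length-positions (o ∷ [])     _ = refl
  length-positions (o ∷ p ∷ os) _ = cong suc (length-positions (p ∷ os) (s≤s z≤n))

  ∑-positions : ∀ os → 0 < length os → ∀ d (F : Option → Pol) → ∑ (positions os) (λ c → F (headᵈ d c)) ≈ ∑ os F
  ∑-positions (o ∷ [])     _ d F = ≈-refl
  ∑-positions (o ∷ p ∷ os) _ d F = +-congˡ (∑-positions (p ∷ os) (s≤s z≤n) d F)

  ∑-concatMap : ∀ {A B : Set} (h : A → List B) xs (f : B → Pol) → ∑ (concatMap h xs) f ≈ ∑ xs (λ x → ∑ (h x) f)
  ∑-concatMap h []       f = ≈-refl
  ∑-concatMap h (x ∷ xs) f = ≈-trans (∑-++ (h x) _ f) (+-congˡ (∑-concatMap h xs f))

  ∑-trace : ∀ fs → All NonEmpty fs → (F : Point → Pol) → ∑ (trace (start fs)) (F ∘ point) ≈ gridTotal fs F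
  ∑-trace []                []       F = ⊻-identityʳ (F [])
  ∑-trace ((u , full) ∷ fs) (p ∷ ps) F = begin
    ∑ (trace (start ((u , full) ∷ fs))) (F ∘ point)
      ≈⟨ ∑-++ (map (λ c → (u , (full , c)) ∷ start fs) (positions full)) _ _ ⟩
    ∑ (map (λ c → (u , (full , c)) ∷ start fs) (positions full)) (F ∘ point) ⊻ ∑ (concatMap turn (drop 1 (trace (start fs)))) (F ∘ point)
      ≈⟨ +-congˡ (∑-concatMap turn (drop 1 (trace (start fs))) _) ⟩
    ∑ (start fs ∷ drop 1 (trace (start fs))) (λ es → ∑ (turn es) (F ∘ point))
      ≡⟨ cong (λ tr → ∑ tr (λ es → ∑ (turn es) (F ∘ point))) (trace-head (start fs)) ⟨
    ∑ (trace (start fs)) (λ es → ∑ (turn es) (F ∘ point))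
      ≈⟨ ∑-cong (trace (start fs)) (λ es → ≈-trans (∑-map _ (positions full) _) (∑-positions full p ([] , []) (λ o → F ((u , o) ∷ point es)))) ⟩
    ∑ (trace (start fs)) ((λ g → ∑ full (λ o → F ((u , o) ∷ g))) ∘ point)
      ≈⟨ ∑-trace fs ps _ ⟩
    gridTotal ((u , full) ∷ fs) F ∎
    where
    turn : List Digit → List (List Digit)
    turn es = map (λ c → (u , (full , c)) ∷ es) (positions full)

  gridSize-∷ : ∀ u full fs → 0 < length full → gridSize ((u , full) ∷ fs) ≡ gridSize fs ℕ* length full
  gridSize-∷ u full fs p = by-turns
    where
    turn : List Digit → List (List Digit)
    turn es = map (λ c → (u , (full , c)) ∷ es) (positions full)
    length-turn : ∀ es → length (turn es) ≡ length full
    length-turn es = ≡.trans (length-map _ (positions full)) (length-positions full p)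
    length-turns : ∀ ess → length (concatMap turn ess) ≡ length ess ℕ* length full
    length-turns []         = refl
    length-turns (es ∷ ess) = ≡.trans (length-++ (turn es)) (cong₂ _ℕ+_ (length-turn es) (length-turns ess))
    by-turns : gridSize ((u , full) ∷ fs) ≡ gridSize fs ℕ* length full
    by-turns = ≡.trans (length-turns (start fs ∷ drop 1 (trace (start fs)))) (cong (λ tr → length tr ℕ* length full) (≡.sym (trace-head (start fs))))

  foldl-∑ : ∀ {A : Set} (f : A → Pol) s xs → foldl (λ s x → s ⊻ f x) s xs ≈ s ⊻ ∑ xs f
  foldl-∑ f s []       = ≈-sym (⊻-identityʳ s)
  foldl-∑ f s (x ∷ xs) = ≈-trans (foldl-∑ f (s ⊻ f x) xs) (⊻-assoc s (f x) (∑ xs f))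

  nodeAt : Choice → ℕ → Pol
  nodeAt c = nth [] (proj₂ (proj₂ (proj₂ c)))

  entry : Point → List Choice → ℕ → Pol
  entry g row j = ∑ row (λ c → scaleAt g (proj₁ c) (proj₁ (proj₂ (proj₂ c))) ⊛ nodeAt c j)

  Row-nth : ∀ r n (h : ℕ → ℕ) (f : ℕ → Pol) → (∀ i → nth [] r i ≈ f (h i)) → Row f r (applyUpTo h n)
  Row-nth r       zero    h f eq = []
  Row-nth []      (suc n) h f eq = eq 0 ∷ Row-nth [] n (h ∘ suc) f (eq ∘ suc)
  Row-nth (x ∷ r) (suc n) h f eq = eq 0 ∷ Row-nth r n (h ∘ suc) f (eq ∘ suc)

  rowAt-entry : ∀ g row n → Row (entry g row) (rowAt g row) (upTo n)
  rowAt-entry g []        n = Row-zero (upTo n)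
  rowAt-entry g (c ∷ row) n =
    Row-⊞ (map (scaleAt g (proj₁ c) (proj₁ (proj₂ (proj₂ c))) ⊛_) (proj₂ (proj₂ (proj₂ c)))) (rowAt g row)
      (Row-⊛ (scaleAt g (proj₁ c) (proj₁ (proj₂ (proj₂ c)))) (proj₂ (proj₂ (proj₂ c))) (Row-nth (proj₂ (proj₂ (proj₂ c))) n id (nodeAt c) (λ _ → ≈-refl)))
      (rowAt-entry g row n)

  det-rows : ∀ g row rows → let n = suc (length rows) in
             det (map (rowAt g) (row ∷ rows)) ≈ perm (entry g) (row ∷ rows) (upTo n)
  det-rows g row rows = begin
    det (map (rowAt g) (row ∷ rows))
      -- Bird's algorithm expects rows and columns with the same index set, so the rows are numbered
      -- here and the numbering is undone afterwards.
      ≈⟨ det-correct a (map (rowAt g) (row ∷ rows)) 0 (applyUpTo suc (length rows))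
           (matrix (row ∷ rows) id (λ _ → refl)) ⟩
    perm a (upTo n) (upTo n)
      ≈⟨ perm-map-rows (entry g) (nth [] (row ∷ rows)) (upTo n) (upTo n) ⟩
    perm (entry g) (map (nth [] (row ∷ rows)) (upTo n)) (upTo n)
      ≡⟨ cong (λ z → perm (entry g) z (upTo n)) (≡.trans (map-applyUpTo _ id n) (≡.trans (map-nth [] (row ∷ rows) id _ (λ _ → refl)) (map-id _))) ⟩
    perm (entry g) (row ∷ rows) (upTo n) ∎
    where
    n : ℕ
    n = suc (length rows)
    a : ℕ → ℕ → Pol
    a i j = entry g (nth [] (row ∷ rows) i) j
    matrix : ∀ rs (h : ℕ → ℕ) → (∀ i → nth [] (row ∷ rows) (h i) ≡ nth [] rs i) →
             Matrix a (map (rowAt g) rs) (applyUpTo h (length rs)) (upTo n)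
    matrix []       h eq = _
    matrix (r ∷ rs) h eq = subst (λ z → Row (entry g z) (rowAt g r) (upTo n)) (≡.sym (eq 0)) (rowAt-entry g r n) ,
                           matrix rs (h ∘ suc) (eq ∘ suc)

  module _ (fs : List (Pol × List Option)) (k : ℕ) where

    -- What `gridSum` computes, with the determinant in closed form. It is defined for any list of
    -- rows, so rows can be permuted and split without conditions on their number.
    total : List (List Choice) → Pol
    total rows = gridTotal fs (λ g → weight g ⊛ perm (entry g) rows (upTo k))

    gridSum-total : All NonEmpty fs → ∀ rows → 0 < k → length rows ≡ k → gridSum fs rows ≈ total rows
    gridSum-total ne (row ∷ rows) _ refl = ≈-trans (foldl-∑ _ [] (trace (start fs)))
      (≈-trans (⊻-identityˡ _) (≈-trans (∑-trace fs ne (term (row ∷ rows)))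
        (gridTotal-cong fs (λ g → *-congˡ {weight g} (det-rows g row rows)))))

    total-↭ : ∀ {rows rows′} → rows ↭ rows′ → total rows ≈ total rows′
    total-↭ p = gridTotal-cong fs (λ g → *-congˡ {weight g} (perm-rows-↭ (entry g) (upTo k) p))

    total-row : ∀ row rows → total (row ∷ rows) ≈ ∑ row (λ c → total ((c ∷ []) ∷ rows))
    total-row []        rows = ≈-trans (gridTotal-cong fs (λ g → ≈-trans (*-congˡ {weight g} (perm-row-0 (entry g) {[]} rows (upTo k) (λ _ → ≈-refl))) (⊛-zeroʳ (weight g))))
                                 (gridTotal-0 fs)
    total-row (c ∷ row) rows = begin
      total ((c ∷ row) ∷ rows)
        ≈⟨ gridTotal-cong fs (λ g → ≈-trans
             (*-congˡ {weight g} (perm-row-+ (entry g) {c ∷ row} {c ∷ []} {row} rows (upTo k)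
               (λ {j} _ → +-congʳ {entry g row j} (≈-sym (⊻-identityʳ _)))))
             (⊛-distribˡ (weight g) _ _)) ⟩
      gridTotal fs (λ g → weight g ⊛ perm (entry g) ((c ∷ []) ∷ rows) (upTo k) ⊻ weight g ⊛ perm (entry g) (row ∷ rows) (upTo k))
        ≈⟨ gridTotal-+ fs _ _ ⟩
      total ((c ∷ []) ∷ rows) ⊻ total (row ∷ rows)
        ≈⟨ +-congˡ {total ((c ∷ []) ∷ rows)} (total-row row rows) ⟩
      ∑ (c ∷ row) (λ c → total ((c ∷ []) ∷ rows)) ∎

  monomial : Point → Pol → Pol
  monomial g v = scaleAt g v (true ∷ [])

  scaleAt-* : ∀ g v x → scaleAt g v x ≈ x ⊛ monomial g v
  scaleAt-* []                v x = ≈-sym (*-identityʳ x)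
  scaleAt-* ((u , q , w) ∷ g) v x with equal u v
  ... | true  = ≈-trans (⊛-congˡ q (scaleAt-* g v x)) (x∙yz≈y∙xz q x (monomial g v))
  ... | false = scaleAt-* g v x

  count : Pol → List Pol → ℕ
  count u []       = 0
  count u (v ∷ vs) = if equal u v then suc (count u vs) else count u vs

  -- The factor that y^c acquires when y runs through the options of one colour and the values are
  -- added with their weights.
  weigh-up : ℕ → List Option → Pol
  weigh-up c full = ∑ full (λ o → proj₂ o ⊛ proj₁ o ^ c)

  ∏-monomial : ∀ u q w g vs → ∏ vs (monomial ((u , q , w) ∷ g)) ≈ q ^ count u vs ⊛ ∏ vs (monomial g)
  ∏-monomial u q w g []       = ≈-sym (⊛-identityˡ _)
  ∏-monomial u q w g (v ∷ vs) with equal u v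
  ... | true  = ≈-trans (*-congˡ {q ⊛ monomial g v} (∏-monomial u q w g vs)) (interchange q (monomial g v) (q ^ count u vs) _)
  ... | false = ≈-trans (*-congˡ {monomial g v} (∏-monomial u q w g vs)) (x∙yz≈y∙xz (monomial g v) (q ^ count u vs) _)

  -- The summand is a product over the coordinates, so by distributivity the sum over the grid is a
  -- product of sums in one variable each.
  gridTotal-monomials : ∀ fs vs → gridTotal fs (λ g → weight g ⊛ ∏ vs (monomial g)) ≈ ∏ fs (λ f → weigh-up (count (proj₁ f) vs) (proj₂ f))
  gridTotal-monomials [] vs = ≈-trans (⊛-identityˡ _) (∏-one vs)
    where
    ∏-one : ∀ vs → ∏ vs (monomial []) ≈ true ∷ []
    ∏-one []       = ≈-refl
    ∏-one (v ∷ vs) = ≈-trans (⊛-identityˡ _) (∏-one vs)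
  gridTotal-monomials ((u , full) ∷ fs) vs = begin
    gridTotal fs (λ g → ∑ full (λ o → proj₂ o ⊛ weight g ⊛ ∏ vs (monomial ((u , o) ∷ g))))
      ≈⟨ gridTotal-cong fs (λ g → ∑-cong full (λ o → ≈-trans (*-congˡ {proj₂ o ⊛ weight g} (∏-monomial u (proj₁ o) (proj₂ o) g vs))
           (≈-trans (interchange (proj₂ o) (weight g) (proj₁ o ^ count u vs) (∏ vs (monomial g))) (⊛-comm (proj₂ o ⊛ proj₁ o ^ count u vs) _)))) ⟩
    gridTotal fs (λ g → ∑ full (λ o → weight g ⊛ ∏ vs (monomial g) ⊛ (proj₂ o ⊛ proj₁ o ^ count u vs)))
      ≈⟨ gridTotal-cong fs (λ g → ≈-trans (∑-* (weight g ⊛ ∏ vs (monomial g)) full _) (⊛-comm (weight g ⊛ ∏ vs (monomial g)) _)) ⟩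
    gridTotal fs (λ g → weigh-up (count u vs) full ⊛ (weight g ⊛ ∏ vs (monomial g)))
      ≈⟨ gridTotal-* (weigh-up (count u vs) full) fs _ ⟩
    weigh-up (count u vs) full ⊛ gridTotal fs (λ g → weight g ⊛ ∏ vs (monomial g))
      ≈⟨ ⊛-congˡ (weigh-up (count u vs) full) (gridTotal-monomials fs vs) ⟩
    ∏ ((u , full) ∷ fs) (λ f → weigh-up (count (proj₁ f) vs) (proj₂ f)) ∎

  ∏-map : ∀ {A B : Set} (h : A → B) xs (f : B → Pol) → ∏ xs (f ∘ h) ≈ ∏ (map h xs) f
  ∏-map h []       f = ≈-refl
  ∏-map h (x ∷ xs) f = ⊛-congˡ (f (h x)) (∏-map h xs f)

  perm-cong-rows : ∀ {X Y : Set} {a b : X → Y → Pol} xs ys → All (λ x → ∀ {y} → y ∈ ys → a x y ≈ b x y) xs → perm a xs ys ≈ perm b xs ys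
  perm-cong-rows         []       []       ps       = ≈-refl
  perm-cong-rows         []       (y ∷ ys) ps       = ≈-refl
  perm-cong-rows {a = a} {b} (x ∷ xs) ys   (p ∷ ps) = ≈-trans (perm-row a x xs ys)
    (≈-trans (∑⟨⟩-cong ys (λ y ys′ q → ⊛-cong (p (∈-resp-↭ (↭-sym q) (here refl)))
        (perm-cong-rows xs ys′ (All.map (λ h {z} y∈ → h (∈-resp-↭ (↭-sym q) (there y∈))) ps))))
      (≈-sym (perm-row b x xs ys)))

  module _ (node : Choice → Pol) (fs : List (Pol × List Option)) where

    private
      scalar : Choice → Pol
      scalar c = proj₁ (proj₂ (proj₂ c))

    -- Each factor vanishes precisely when one of the conditions on a solution fails.
    total-singles : ∀ cs → All (λ c → ∀ j → j < length cs → nodeAt c j ≈ node c ^ j) cs →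
                    total fs (length cs) (map (_∷ []) cs) ≈
                    ∏ cs scalar ⊛ (vandermonde (map node cs) ⊛ ∏ fs (λ f → weigh-up (count (proj₁ f) (map proj₁ cs)) (proj₂ f)))
    total-singles cs wf = begin
      total fs k (map (_∷ []) cs)
        ≈⟨ gridTotal-cong fs (λ g → ⊛-congˡ (weight g) (≈-trans (≈-sym (perm-map-rows (entry g) (_∷ []) cs (upTo k))) (at-point g))) ⟩
      gridTotal fs (λ g → weight g ⊛ (∏ cs scalar ⊛ ∏ vs (monomial g) ⊛ V))
        ≈⟨ gridTotal-cong fs (λ g → rearrange (weight g) (∏ cs scalar) (∏ vs (monomial g)) V) ⟩
      gridTotal fs (λ g → ∏ cs scalar ⊛ V ⊛ (weight g ⊛ ∏ vs (monomial g)))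
        ≈⟨ gridTotal-* (∏ cs scalar ⊛ V) fs _ ⟩
      ∏ cs scalar ⊛ V ⊛ gridTotal fs (λ g → weight g ⊛ ∏ vs (monomial g))
        ≈⟨ ≈-trans (⊛-congˡ (∏ cs scalar ⊛ V) (gridTotal-monomials fs vs)) (⊛-assoc (∏ cs scalar) V _) ⟩
      ∏ cs scalar ⊛ (V ⊛ ∏ fs (λ f → weigh-up (count (proj₁ f) vs) (proj₂ f))) ∎
      where
      k : ℕ
      k = length cs
      vs : List Pol
      vs = map proj₁ cs
      V : Pol
      V = vandermonde (map node cs)
      rearrange : ∀ w x m v → w ⊛ (x ⊛ m ⊛ v) ≈ x ⊛ v ⊛ (w ⊛ m)
      rearrange w x m v = begin
        w ⊛ (x ⊛ m ⊛ v)   ≈⟨ ⊛-congˡ w (≈-trans (⊛-assoc x m v) (≈-trans (⊛-congˡ x (⊛-comm m v)) (≈-sym (⊛-assoc x v m)))) ⟩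
        w ⊛ (x ⊛ v ⊛ m)   ≈⟨ x∙yz≈y∙xz w (x ⊛ v) m ⟩
        x ⊛ v ⊛ (w ⊛ m)   ∎
      node-entry : ∀ g → All (λ c → ∀ {j} → j ∈ upTo k → entry g (c ∷ []) j ≈ scalar c ⊛ monomial g (proj₁ c) ⊛ node c ^ j) cs
      node-entry g = All.map (λ {c} eq {j} j∈ → ≈-trans (⊻-identityʳ _)
        (⊛-cong (scaleAt-* g (proj₁ c) (scalar c)) (eq j (∈-upTo⁻ j∈)))) wf
      at-point : ∀ g → perm (λ c → entry g (c ∷ [])) cs (upTo k) ≈ ∏ cs scalar ⊛ ∏ vs (monomial g) ⊛ V
      at-point g = begin
        perm (λ c → entry g (c ∷ [])) cs (upTo k)
          ≈⟨ perm-cong-rows cs (upTo k) (node-entry g) ⟩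
        perm (λ c j → scalar c ⊛ monomial g (proj₁ c) ⊛ node c ^ j) cs (upTo k)
          ≈⟨ perm-scale (λ c j → node c ^ j) (λ c → scalar c ⊛ monomial g (proj₁ c)) cs (upTo k) ⟩
        ∏ cs (λ c → scalar c ⊛ monomial g (proj₁ c)) ⊛ perm (λ c j → node c ^ j) cs (upTo k)
          ≈⟨ ⊛-cong (≈-trans (∏-* cs scalar _) (⊛-congˡ (∏ cs scalar) (∏-map proj₁ cs (monomial g)))) (perm-map-rows _^_ node cs (upTo k)) ⟩
        ∏ cs scalar ⊛ ∏ vs (monomial g) ⊛ perm _^_ (map node cs) (upTo k)
          -- The matrix has ascending powers and `vandermonde` descending ones; reordering columns
          -- produces no sign here.
          ≈⟨ ⊛-congˡ (∏ cs scalar ⊛ ∏ vs (monomial g)) (perm-cols-↭ _^_ (map node cs)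
               (subst (upTo k ↭_) (≡.trans (reverse-upTo k) (cong downFrom (≡.sym (length-map node cs)))) (↭-sym (↭-reverse (upTo k))))) ⟩
        ∏ cs scalar ⊛ ∏ vs (monomial g) ⊛ V ∎

-- Interpolation weights that isolate one multiplicity

module Interpolation where

  open Folds
  open Polynomials
  open Determinant using (_⊞_)
  open Algorithm
  open GridSum
  open Permanent polynomials ⊻-self
  open import Algebra.Bundles using (CommutativeRing)
  open import Data.Bool using (Bool; true; false)
  open import Data.List using (List; []; _∷_; length; map)
  open import Data.List.Properties using (length-map)
  open import Data.List.Membership.Propositional using (_∈_)
  open import Data.List.Relation.Unary.All as All using (All; []; _∷_)
  open import Data.List.Relation.Unary.Any using (here; there)
  open import Data.Nat using (ℕ; zero; suc; z≤n; s≤s; _≤_; _<_; _+_)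
  open import Data.Nat.Properties
  open import Data.Product using (∃-syntax; _×_; _,_; proj₂)
  open import Data.Sum using (_⊎_; inj₁; inj₂)
  open import Data.Empty using (⊥-elim)
  open import Relation.Binary using (tri<; tri≈; tri>)
  open import Relation.Binary.PropositionalEquality as ≡ using (_≡_; _≢_; refl; cong; subst)

  open CommutativeRing polynomials using (setoid; +-congˡ)
  open import Relation.Binary.Reasoning.Setoid setoid
  open import Algebra.Properties.CommutativeSemigroup (CommutativeRing.*-commutativeSemigroup polynomials)
    using (x∙yz≈y∙xz)
  open import Algebra.Properties.CommutativeSemigroup (CommutativeRing.+-commutativeSemigroup polynomials)
    using () renaming (interchange to ⊻-interchange)

  monic : ℕ → Pol
  monic zero    = true ∷ []
  monic (suc e) = false ∷ monic e

  monic-injective : ∀ d e → monic d ≈ monic e → d ≡ e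
  monic-injective zero    zero    eq = refl
  monic-injective zero    (suc e) eq with () ← at eq 0
  monic-injective (suc d) zero    eq with () ← at eq 0
  monic-injective (suc d) (suc e) eq = cong suc (monic-injective d e (mk≈ λ n → at eq (suc n)))

  zPower-monic : ∀ A u → zPower A u ≡ monic (count u A)
  zPower-monic []      u = refl
  zPower-monic (a ∷ A) u with equal u a
  ... | true  = cong (false ∷_) (zPower-monic A u)
  ... | false = zPower-monic A u

  powersFrom : List Pol → Pol → ℕ → ℕ → List Pol
  powersFrom A u i j = proj₂ (mapAccL (splitPowers u) (monic i , monic j) A)

  -- The lower run ends where the entries equal to `u` do, and the upper one starts at j. With i = 0
  -- and j = n + 1, for the multiplicity n, the exponent n is skipped.
  powersFrom-sound : ∀ A u i j → All (λ f → ∃[ e ] f ≡ monic e × (e < i + count u A ⊎ j ≤ e)) (powersFrom A u i j)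
  powersFrom-sound []      u i j = []
  powersFrom-sound (a ∷ A) u i j with equal u a
  ... | true  = (i , refl , inj₁ (m<m+n i (s≤s z≤n))) ∷
                subst (λ z → All (λ f → ∃[ e ] f ≡ monic e × (e < z ⊎ j ≤ e)) (powersFrom A u (suc i) j)) (≡.sym (+-suc i _)) (powersFrom-sound A u (suc i) j)
  ... | false = (j , refl , inj₂ ≤-refl) ∷ All.map (λ { (e , eq , inj₁ p) → e , eq , inj₁ p
                                                      ; (e , eq , inj₂ p) → e , eq , inj₂ (≤-trans (n≤1+n j) p) })
                                             (powersFrom-sound A u i (suc j))

  powersFrom-low : ∀ A u i j e → i ≤ e → e < i + count u A → monic e ∈ powersFrom A u i j
  powersFrom-low []      u i j e le lt = ⊥-elim (<⇒≱ lt (≤-trans (≤-reflexive (+-identityʳ i)) le))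
  powersFrom-low (a ∷ A) u i j e le lt with equal u a
  ... | false = there (powersFrom-low A u i (suc j) e le lt)
  ... | true with m≤n⇒m<n∨m≡n le
  ...   | inj₁ lt′  = there (powersFrom-low A u (suc i) j e lt′ (subst (e <_) (+-suc i _) lt))
  ...   | inj₂ refl = here refl

  -- The upper run has one power for each entry of A different from `u`. For j = n + 1, with n the
  -- multiplicity, the second condition amounts to e ≤ length A.
  powersFrom-high : ∀ A u i j e → j ≤ e → e + count u A < j + length A → monic e ∈ powersFrom A u i j
  powersFrom-high []      u i j e le lt = ⊥-elim (<⇒≱ lt (+-monoˡ-≤ 0 le))
  powersFrom-high (a ∷ A) u i j e le lt with equal u a
  ... | true  = there (powersFrom-high A u (suc i) j e le (≤-pred (≤-trans (≤-reflexive (cong suc (≡.sym (+-suc e _)))) (≤-trans lt (≤-reflexive (+-suc j _))))))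
  ... | false with m≤n⇒m<n∨m≡n le
  ...   | inj₁ lt′  = there (powersFrom-high A u i (suc j) e lt′ (≤-trans lt (≤-reflexive (+-suc j _))))
  ...   | inj₂ refl = here refl

  otherPowers-from : ∀ A u → otherPowers A u ≡ powersFrom A u 0 (suc (count u A))
  otherPowers-from A u = cong (λ z → proj₂ (mapAccL (splitPowers u) (true ∷ [] , false ∷ z) A)) (zPower-monic A u)

  evaluate : Pol → List Pol → Pol
  evaluate t []      = []
  evaluate t (w ∷ W) = w ⊻ t ⊛ evaluate t W

  evaluate-⊞ : ∀ t U W → evaluate t (U ⊞ W) ≈ evaluate t U ⊻ evaluate t W
  evaluate-⊞ t []      W       = ≈-refl
  evaluate-⊞ t (u ∷ U) []      = ≈-sym (⊻-identityʳ _)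
  evaluate-⊞ t (u ∷ U) (w ∷ W) = ≈-trans (+-congˡ {u ⊻ w} (≈-trans (⊛-congˡ t (evaluate-⊞ t U W)) (⊛-distribˡ t _ _)))
                                   (⊻-interchange u w (t ⊛ evaluate t U) (t ⊛ evaluate t W))

  evaluate-* : ∀ t c W → evaluate t (map (c ⊛_) W) ≈ c ⊛ evaluate t W
  evaluate-* t c []      = ≈-sym (⊛-zeroʳ c)
  evaluate-* t c (w ∷ W) = ≈-trans (+-congˡ {c ⊛ w} (≈-trans (⊛-congˡ t (evaluate-* t c W)) (x∙yz≈y∙xz t c (evaluate t W))))
                             (≈-sym (⊛-distribˡ c w (t ⊛ evaluate t W)))

  evaluate-coefficients : ∀ t fs → evaluate t (coefficients fs) ≈ ∏ fs (_⊻ t)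
  evaluate-coefficients t []       = ≈-trans (+-congˡ {true ∷ []} (⊛-zeroʳ t)) (⊻-identityʳ _)
  evaluate-coefficients t (f ∷ fs) = begin
    evaluate t (map (f ⊛_) C ⊞ ([] ∷ C))              ≈⟨ evaluate-⊞ t (map (f ⊛_) C) ([] ∷ C) ⟩
    evaluate t (map (f ⊛_) C) ⊻ t ⊛ evaluate t C      ≈⟨ ⊻-cong (evaluate-* t f C) (≈-refl {t ⊛ evaluate t C}) ⟩
    f ⊛ evaluate t C ⊻ t ⊛ evaluate t C               ≈⟨ ⊛-distribʳ (evaluate t C) f t ⟨
    (f ⊻ t) ⊛ evaluate t C                            ≈⟨ ⊛-congˡ (f ⊻ t) (evaluate-coefficients t fs) ⟩
    ∏ (f ∷ fs) (_⊻ t)                                 ∎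
    where
    C : List Pol
    C = coefficients fs

  shift-^ : ∀ q c → (false ∷ q) ^ c ≈ monic c ⊛ q ^ c
  shift-^ q zero    = ≈-sym (⊛-identityˡ _)
  shift-^ q (suc c) = ∷-cong false (≈-trans (⊛-congˡ q (shift-^ q c)) (x∙yz≈y∙xz q (monic c) (q ^ c)))

  1-^ : ∀ c → (true ∷ []) ^ c ≈ true ∷ []
  1-^ zero    = ≈-refl
  1-^ (suc c) = ≈-trans (⊛-identityˡ _) (1-^ c)

  -- The j-th option has the value q z^j, and w_j (q z^j)^c = q^c w_j (z^c)^j. So the weighted sum
  -- is q^c times Horner's scheme at the point z^c.
  weigh-up-from : ∀ c q W → weigh-up c (proj₂ (mapAccL (λ q w → false ∷ q , (q , w)) q W)) ≈ q ^ c ⊛ evaluate (monic c) W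
  weigh-up-from c q []      = ≈-sym (⊛-zeroʳ (q ^ c))
  weigh-up-from c q (w ∷ W) = begin
    w ⊛ q ^ c ⊻ weigh-up c (proj₂ (mapAccL (λ q w → false ∷ q , (q , w)) (false ∷ q) W))
      ≈⟨ ⊻-cong (⊛-comm w (q ^ c)) (≈-trans (weigh-up-from c (false ∷ q) W) (≈-trans (⊛-cong (shift-^ q c) (≈-refl {E})) (lem (monic c) (q ^ c) E))) ⟩
    q ^ c ⊛ w ⊻ q ^ c ⊛ (monic c ⊛ E)
      ≈⟨ ⊛-distribˡ (q ^ c) w (monic c ⊛ E) ⟨
    q ^ c ⊛ (w ⊻ monic c ⊛ E) ∎
    where
    E : Pol
    E = evaluate (monic c) W
    lem : ∀ a b e → a ⊛ b ⊛ e ≈ b ⊛ (a ⊛ e)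
    lem a b e = ≈-trans (⊛-assoc a b e) (x∙yz≈y∙xz a b e)

  weigh-up-options : ∀ A u c → weigh-up c (options A u) ≈ ∏ (powersFrom A u 0 (suc (count u A))) (_⊻ monic c)
  weigh-up-options A u c = begin
    weigh-up c (options A u)
      ≈⟨ weigh-up-from c (true ∷ []) (coefficients (otherPowers A u)) ⟩
    (true ∷ []) ^ c ⊛ evaluate (monic c) (coefficients (otherPowers A u))
      ≈⟨ ⊛-cong (1-^ c) (evaluate-coefficients (monic c) (otherPowers A u)) ⟩
    (true ∷ []) ⊛ ∏ (otherPowers A u) (_⊻ monic c)
      ≈⟨ ⊛-identityˡ _ ⟩
    ∏ (otherPowers A u) (_⊻ monic c)
      ≡⟨ cong (λ z → ∏ z (_⊻ monic c)) (otherPowers-from A u) ⟩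
    ∏ (powersFrom A u 0 (suc (count u A))) (_⊻ monic c) ∎

  weigh-up-vanishes : ∀ A u c → c ≤ length A → c ≢ count u A → weigh-up c (options A u) ≈ []
  weigh-up-vanishes A u c le ne = ≈-trans (weigh-up-options A u c) (∏-zero factor (⊻-self (monic c)))
    where
    factor : monic c ∈ powersFrom A u 0 (suc (count u A))
    factor with <-cmp c (count u A)

    ... | tri< lt _ _ = powersFrom-low A u 0 (suc (count u A)) c z≤n lt

    ... | tri≈ _ eq _ = ⊥-elim (ne eq)
    ... | tri> _ _ gt = powersFrom-high A u 0 (suc (count u A)) c gt (s≤s (≤-trans (+-monoˡ-≤ (count u A) le) (≤-reflexive (+-comm (length A) (count u A)))))

  ∏-nonzero : ∀ {X : Set} (f : X → Pol) {xs} → All (λ x → f x ≉ []) xs → ∏ xs f ≉ []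
  ∏-nonzero f []       = 1≉0
  ∏-nonzero f (p ∷ ps) = integral _ _ p (∏-nonzero f ps)

  weigh-up-nonzero : ∀ A u → weigh-up (count u A) (options A u) ≉ []
  weigh-up-nonzero A u eq = ∏-nonzero (_⊻ monic n) (All.map factor (powersFrom-sound A u 0 (suc n))) (≈-trans (≈-sym (weigh-up-options A u n)) eq)
    where
    n : ℕ
    n = count u A
    factor : ∀ {f} → ∃[ e ] f ≡ monic e × (e < n ⊎ suc n ≤ e) → f ⊻ monic n ≉ []
    factor (e , refl , lt) z with monic-injective e n (⊻≈0⇒≈ (monic e) (monic n) z)
    factor (e , refl , inj₁ lt) z | refl = <-irrefl refl lt
    factor (e , refl , inj₂ lt) z | refl = <-irrefl refl lt

  -- All exponents up to the length k of A but one give k linear factors, hence k + 1 coefficients.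
  -- This is the base k + 1 of the running time.
  length-options : ∀ A u → length (options A u) ≡ suc (length A)
  length-options A u = ≡.trans (length-mapAccL (λ q w → false ∷ q , (q , w)) (true ∷ []) (coefficients (otherPowers A u)))
    (≡.trans (length-coefficients (otherPowers A u)) (cong suc (length-mapAccL (splitPowers u) (true ∷ [] , false ∷ zPower A u) A)))
    where
    length-⊞-∷ : ∀ f U → length (map (f ⊛_) U ⊞ ([] ∷ U)) ≡ suc (length U)
    length-⊞-∷ f []      = refl
    length-⊞-∷ f (u ∷ U) = cong suc (lem (map (f ⊛_) U) U u (length-map (f ⊛_) U))
      where
      lem : ∀ V U u → length V ≡ length U → length (V ⊞ (u ∷ U)) ≡ suc (length U)
      lem []      []      u eq = refl
      lem (v ∷ V) (w ∷ U) u eq = cong suc (lem V U w (suc-injective eq))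
    length-coefficients : ∀ fs → length (coefficients fs) ≡ suc (length fs)
    length-coefficients []       = refl
    length-coefficients (f ∷ fs) = ≡.trans (length-⊞-∷ f (coefficients fs)) (cong suc (length-coefficients fs))

-- Fixing the colours one by one, and aligning B with A

module Selection where

  open Polynomials
  open Algorithm
  open GridSum
  open Permanent polynomials ⊻-self using (∑)
  open import Data.Bool using (Bool; true; false)
  open import Data.Empty using (⊥-elim)
  open import Data.List using (List; []; _∷_; length; foldl; map; _++_; zip)
  open import Data.List.Properties using (map-++; ++-assoc; length-++; length-map)
  open import Data.List.Membership.Propositional using (_∈_)
  open import Data.List.Relation.Binary.Permutation.Propositional
  open import Data.List.Relation.Binary.Permutation.Propositional.Properties using (map⁺; ++-comm)
  open import Data.List.Relation.Binary.Pointwise using (Pointwise; []; _∷_)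
  open import Data.List.Relation.Unary.All as All using (All; []; _∷_)
  open import Data.List.Relation.Unary.Any using (here; there)
  open import Data.Nat using (ℕ; suc; _<_) renaming (_+_ to _ℕ+_)
  open import Data.Nat.Properties using (suc-injective; +-comm; +-identityʳ)
  open import Data.Product using (∃-syntax; _×_; _,_; proj₁; proj₂)
  open import Data.Sum using (_⊎_; inj₁; inj₂)
  open import Relation.Binary.PropositionalEquality as ≡ using (_≡_; refl; cong; subst)
  open import Relation.Nullary using (¬_)

  isZero-false : ∀ a → isZero a ≡ false → a ≉ []
  isZero-false a eq e with () ← ≡.trans (≡.sym (isZero-complete a e)) eq

  module _ (fs : List (Pol × List Option)) (k : ℕ) (ne : All NonEmpty fs) (0<k : 0 < k) where

    pick-correct : ∀ row rest → suc (length rest) ≡ k → total fs k (row ∷ rest) ≉ [] →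
                   ∃[ c ] c ∈ row × pick fs rest row ≡ c ∷ [] × total fs k ((c ∷ []) ∷ rest) ≉ []
    pick-correct row rest eq nz = search row (λ e → nz (≈-trans (total-row fs k row rest) e))
      where
      search : ∀ row → ∑ row (λ c → total fs k ((c ∷ []) ∷ rest)) ≉ [] →
               ∃[ c ] c ∈ row × pick fs rest row ≡ c ∷ [] × total fs k ((c ∷ []) ∷ rest) ≉ []
      search []        nz = ⊥-elim (nz ≈-refl)
      search (c ∷ row) nz with isZero (gridSum fs ((c ∷ []) ∷ rest)) in z
      ... | false = c , here refl , refl ,
                    λ e → isZero-false _ z (≈-trans (gridSum-total fs k ne ((c ∷ []) ∷ rest) 0<k eq) e)
      -- A choice with total zero may be dropped from the sum, which therefore stays nonzero.
      ... | true with search row (λ e → nz (⊻-cong (≈-trans (≈-sym (gridSum-total fs k ne ((c ∷ []) ∷ rest) 0<k eq)) (isZero-sound _ z)) e))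
      ...   | d , d∈ , eq′ , nz′ = d , there d∈ , eq′ , nz′

    -- Invariant: the undecided rows stand in front and the decided ones, single choices, behind
    -- them. `U` serves only to count the remaining rotations.
    refine-loop : ∀ (U : List (List Choice)) rows cs → length U ≡ length rows → length rows ℕ+ length cs ≡ k →
                  total fs k (rows ++ map (_∷ []) cs) ≉ [] →
                  ∃[ ds ] foldl (λ s _ → rotate fs s) (rows ++ map (_∷ []) cs) U ≡ map (_∷ []) (cs ++ ds) ×
                    Pointwise _∈_ ds rows × total fs k (map (_∷ []) (cs ++ ds)) ≉ []
    refine-loop []      []           cs eq eqk nz = [] , cong (map (_∷ [])) (≡.sym (++-identityʳ cs)) , [] ,
                                                    subst (λ z → total fs k (map (_∷ []) z) ≉ []) (≡.sym (++-identityʳ cs)) nz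
      where open import Data.List.Properties using (++-identityʳ)
    refine-loop (_ ∷ U) (row ∷ rows) cs eq eqk nz
      with pick-correct row (rows ++ map (_∷ []) cs)
             (≡.trans (cong suc (≡.trans (length-++ rows) (cong (length rows ℕ+_) (length-map (_∷ []) cs)))) eqk) nz
    ... | c , c∈ , eq′ , nz′
      with refine-loop U rows (cs ++ c ∷ []) (suc-injective eq)
             (≡.trans (cong (length rows ℕ+_) (≡.trans (length-++ cs) (+-comm (length cs) 1))) (≡.trans (+-suc (length rows) _) eqk))
             (λ e → nz′ (≈-trans (total-↭ fs k (moved c)) e))
      where
      open import Data.Nat.Properties using (+-suc)
      moved : ∀ c → (c ∷ []) ∷ (rows ++ map (_∷ []) cs) ↭ rows ++ map (_∷ []) (cs ++ c ∷ [])
      moved c = subst ((c ∷ []) ∷ (rows ++ map (_∷ []) cs) ↭_)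
        (≡.trans (++-assoc rows (map (_∷ []) cs) _) (cong (rows ++_) (≡.sym (map-++ (_∷ []) cs (c ∷ [])))))
        (++-comm ((c ∷ []) ∷ []) (rows ++ map (_∷ []) cs))
    ...   | ds , eq″ , ds∈ , nz″ = c ∷ ds ,
            ≡.trans (cong (λ z → foldl (λ s _ → rotate fs s) z U) rotated) (≡.trans eq″ (cong (map (_∷ [])) (++-assoc cs (c ∷ []) ds))) ,
            c∈ ∷ ds∈ , subst (λ z → total fs k (map (_∷ []) z) ≉ []) (++-assoc cs (c ∷ []) ds) nz″
      where
      rotated : (rows ++ map (_∷ []) cs) ++ pick fs (rows ++ map (_∷ []) cs) row ∷ [] ≡ rows ++ map (_∷ []) (cs ++ c ∷ [])
      rotated = ≡.trans (cong (λ z → (rows ++ map (_∷ []) cs) ++ z ∷ []) eq′)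
        (≡.trans (++-assoc rows (map (_∷ []) cs) _) (cong (rows ++_) (≡.sym (map-++ (_∷ []) cs (c ∷ [])))))

    refine-correct : ∀ rows → length rows ≡ k → total fs k rows ≉ [] →
                     ∃[ cs ] refine fs rows ≡ map (_∷ []) cs × Pointwise _∈_ cs rows × total fs k (map (_∷ []) cs) ≉ []
    refine-correct rows eq nz =
      let cs , eq′ , cs∈ , nz′ = refine-loop rows rows [] refl (≡.trans (+-identityʳ _) eq)
                                   (subst (λ z → total fs k z ≉ []) (≡.sym (++-identityʳ rows)) nz)
      in cs , ≡.trans (cong (λ z → foldl (λ s _ → rotate fs s) z rows) (≡.sym (++-identityʳ rows))) eq′ , cs∈ , nz′
      where open import Data.List.Properties using (++-identityʳ)

  count-↭ : ∀ u {vs ws} → vs ↭ ws → count u vs ≡ count u ws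
  count-↭ u refl = refl
  count-↭ u (prep v p) with equal u v
  ... | true  = cong suc (count-↭ u p)
  ... | false = count-↭ u p
  count-↭ u (swap v w p) with equal u v | equal u w
  ... | true  | true  = cong (λ n → suc (suc n)) (count-↭ u p)
  ... | true  | false = cong suc (count-↭ u p)
  ... | false | true  = cong suc (count-↭ u p)
  ... | false | false = count-↭ u p
  count-↭ u (trans p q) = ≡.trans (count-↭ u p) (count-↭ u q)

  module _ (w : ℕ) where

    Width : Pol → Set
    Width a = length a ≡ w

    extract-correct : ∀ a ps → Width a → All Width (map proj₁ ps) →
                      (extract a ps ≡ ([] , ps) × count a (map proj₁ ps) ≡ 0) ⊎
                      (∃[ b ] ∃[ qs ] extract a ps ≡ (b ∷ [] , qs) × ps ↭ (a , b) ∷ qs)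
    extract-correct a []       wa []       = inj₁ (refl , refl)
    extract-correct a (p ∷ ps) wa (wp ∷ wps) with extract a ps | extract-correct a ps wa wps
    ... | _ | inj₂ (b , qs , refl , π) = inj₂ (b , p ∷ qs , refl , trans (prep p π) (swap p (a , b) refl))
    ... | _ | inj₁ (refl , z) with equal a (proj₁ p) in eq
    ...   | false = inj₁ (refl , z)
    ...   | true rewrite equal⇒≡ a (proj₁ p) (≡.trans wa (≡.sym wp)) eq = inj₂ (proj₂ p , ps , refl , refl)

    -- Equal colour counts guarantee that an element of the wanted colour is always left and that
    -- none remains at the end. Taking one out lowers both counts alike.
    align-correct : ∀ A ps → All Width A → All Width (map proj₁ ps) →
                    (∀ u → Width u → count u A ≡ count u (map proj₁ ps)) → zip A (align A ps) ↭ ps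
    align-correct []      []       wA wps eq = refl
    align-correct []      (p ∷ ps) wA (wp ∷ _) eq with eq (proj₁ p) wp
    ... | eq′ rewrite equal-refl (proj₁ p) with () ← eq′
    align-correct (a ∷ A) ps (wa ∷ wA) wps eq with extract a ps | extract-correct a ps wa wps
    ... | _ | inj₁ (refl , z) = ⊥-elim (impossible (≡.trans (eq a wa) z))
      where
      impossible : ¬ count a (a ∷ A) ≡ 0
      impossible e rewrite equal-refl a with () ← e
    ... | _ | inj₂ (b , qs , refl , π) =
        trans (prep (a , b) (align-correct A qs wA wqs λ u wu → cancel u (≡.trans (eq u wu) (count-↭ u (map⁺ proj₁ π))))) (↭-sym π)
      where
      open import Data.List.Relation.Binary.Permutation.Propositional.Properties using (All-resp-↭)
      wqs : All Width (map proj₁ qs)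
      wqs with _ ∷ ws ← All-resp-↭ (map⁺ proj₁ π) wps = ws
      cancel : ∀ u → count u (a ∷ A) ≡ count u (a ∷ map proj₁ qs) → count u A ≡ count u (map proj₁ qs)
      cancel u e with equal u a
      ... | true  = suc-injective e
      ... | false = e

-- Schwartz-Zippel, and affinity in each random scalar

module SchwartzZippel where

  open Folds
  open Polynomials
  open Algorithm
  open GridSum
  open Permanent polynomials ⊻-self
  open import Algebra.Bundles using (CommutativeRing)
  open import Data.Bool using (Bool; true; false; if_then_else_)
  open import Data.Empty using (⊥-elim)
  open import Data.List using (List; []; _∷_; length; map; drop; _++_; upTo)
  open import Data.List.Properties using (++-assoc; ++-identityʳ; length-++)
  open import Data.List.Membership.Propositional using (_∈_)
  open import Data.List.Relation.Binary.Permutation.Propositional using (_↭_; ↭-sym)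
  open import Data.List.Relation.Binary.Permutation.Propositional.Properties using (shift)
  open import Data.List.Relation.Binary.Pointwise using (Pointwise; []; _∷_)
  open import Data.List.Relation.Unary.Any using (here; there)
  open import Data.Nat using (ℕ; zero; suc; z≤n; _≤_; _+_; _*_) renaming (_^_ to _ℕ^_)
  open import Data.Nat.Properties
  open import Data.Nat.Tactic.RingSolver using (solve-∀)
  open import Data.Product using (∃-syntax; _×_; _,_; proj₁; proj₂)
  open import Data.Sum using (_⊎_; inj₁; inj₂)
  open import Data.Unit using (⊤; tt)
  open import Relation.Binary.PropositionalEquality as ≡ using (_≡_; refl; cong; cong₂; subst)
  open import Relation.Nullary using (¬_)

  open CommutativeRing polynomials using (setoid)
  open import Relation.Binary.Reasoning.Setoid setoid hiding (start)
  open import Algebra.Properties.CommutativeSemigroup (CommutativeRing.*-commutativeSemigroup polynomials)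
    using (x∙yz≈y∙xz)
  open import Algebra.Properties.CommutativeSemigroup (CommutativeRing.+-commutativeSemigroup polynomials)
    using () renaming (x∙yz≈y∙xz to x+yz≈y+xz; xy∙z≈xz∙y to xy+z≈xz+y)

  Affine : (Pol → Pol) → Set
  Affine h = ∃[ α ] ∃[ β ] (∀ y → h y ≈ α ⊻ β ⊛ y)

  -- A property of functions, not a syntax for polynomials: the counting argument only needs control
  -- of the zeros in one variable while the others are fixed.
  MultiAffine : ℕ → (List Pol → Pol) → Set
  MultiAffine zero    f = ⊤
  MultiAffine (suc n) f = (∀ ys → Affine (λ y → f (y ∷ ys))) × (∀ y → MultiAffine n (λ ys → f (y ∷ ys)))

  MultiAffine-resp : ∀ n {f g} → (∀ ys → f ys ≈ g ys) → MultiAffine n f → MultiAffine n g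
  MultiAffine-resp zero    eq _       = tt
  MultiAffine-resp (suc n) eq (a , m) =
    (λ ys → let α , β , e = a ys in α , β , λ y → ≈-trans (≈-sym (eq (y ∷ ys))) (e y)) ,
    (λ y → MultiAffine-resp n (λ ys → eq (y ∷ ys)) (m y))

  nonzero? : ∀ a → a ≈ [] ⊎ a ≉ []
  nonzero? a with isZero a in eq
  ... | true  = inj₁ (isZero-sound a eq)
  ... | false = inj₂ λ e → case≢ (≡.trans (≡.sym eq) (isZero-complete a e))
    where
    case≢ : ¬ false ≡ true
    case≢ ()

  -- The slope times the difference of the roots is zero. In an integral domain the slope must
  -- vanish, and the constant term with it.
  two-roots : ∀ {h} → Affine h → ∀ {x y} p → h x ≈ [] → h y ≈ [] → x ≉ y → h p ≈ []
  two-roots {h} (α , β , e) {x} {y} p hx hy x≉y = begin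
    h p         ≈⟨ e p ⟩
    α ⊻ β ⊛ p   ≈⟨ ⊻-cong α≈0 (⊛-cong β≈0 (≈-refl {p})) ⟩
    []          ∎
    where
    β*≈0 : β ⊛ (x ⊻ y) ≈ []
    β*≈0 = begin
      β ⊛ (x ⊻ y)                     ≈⟨ ⊛-distribˡ β x y ⟩
      β ⊛ x ⊻ β ⊛ y                   ≈⟨ ⊻-cong (⊕⇒ (β ⊛ x) (≈-trans (≈-sym (e x)) hx)) (⊕⇒ (β ⊛ y) (≈-trans (≈-sym (e y)) hy)) ⟩
      α ⊻ α                           ≈⟨ ⊻-self α ⟩
      []                              ∎
      where
      ⊕⇒ : ∀ b → α ⊻ b ≈ [] → b ≈ α
      ⊕⇒ b z = ≈-sym (⊻≈0⇒≈ α b z)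
    β≈0 : β ≈ []
    β≈0 with nonzero? β
    ... | inj₁ z = z
    ... | inj₂ nz = ⊥-elim (integral β (x ⊻ y) nz (λ z → x≉y (⊻≈0⇒≈ x y z)) β*≈0)
    α≈0 : α ≈ []
    α≈0 = ≈-trans (≈-sym (⊻-identityʳ α)) (≈-trans (⊻-cong (≈-refl {α}) (⊛-cong (≈-sym β≈0) (≈-refl {x}))) (≈-trans (≈-sym (e x)) hx))

  sumOver : ℕ → (List Bool → ℕ) → ℕ
  sumOver zero    g = g []
  sumOver (suc n) g = sumOver n (λ r → g (false ∷ r)) + sumOver n (λ r → g (true ∷ r))

  indicator : Bool → ℕ
  indicator b = if b then 1 else 0

  sumOver-cong : ∀ n {g h} → (∀ r → length r ≡ n → g r ≡ h r) → sumOver n g ≡ sumOver n h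
  sumOver-cong zero    eq = eq [] refl
  sumOver-cong (suc n) eq = cong₂ _+_ (sumOver-cong n λ r l → eq (false ∷ r) (cong suc l)) (sumOver-cong n λ r l → eq (true ∷ r) (cong suc l))

  sumOver-mono : ∀ n {g h} → (∀ r → g r ≤ h r) → sumOver n g ≤ sumOver n h
  sumOver-mono zero    le = le []
  sumOver-mono (suc n) le = +-mono-≤ (sumOver-mono n λ r → le (false ∷ r)) (sumOver-mono n λ r → le (true ∷ r))

  sumOver-+ : ∀ n (g h : List Bool → ℕ) → sumOver n (λ r → g r + h r) ≡ sumOver n g + sumOver n h
  sumOver-+ zero    g h = refl
  sumOver-+ (suc n) g h = ≡.trans (cong₂ _+_ (sumOver-+ n _ _) (sumOver-+ n _ _)) (lem (sumOver n λ r → g (false ∷ r)) _ (sumOver n λ r → g (true ∷ r)) _)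
    where
    lem : ∀ a b c d → a + b + (c + d) ≡ a + c + (b + d)
    lem = solve-∀

  sumOver-* : ∀ c n (g : List Bool → ℕ) → sumOver n (λ r → c * g r) ≡ c * sumOver n g
  sumOver-* c zero    g = refl
  sumOver-* c (suc n) g = ≡.trans (cong₂ _+_ (sumOver-* c n _) (sumOver-* c n _)) (≡.sym (*-distribˡ-+ c _ _))

  sumOver-const : ∀ c n → sumOver n (λ _ → c) ≡ c * 2 ℕ^ n
  sumOver-const c zero    = ≡.sym (*-identityʳ c)
  sumOver-const c (suc n) = ≡.trans (cong₂ _+_ (sumOver-const c n) (sumOver-const c n)) (lem c (2 ℕ^ n))
    where
    lem : ∀ c p → c * p + c * p ≡ c * (p + (p + 0))
    lem = solve-∀

  sumOver-++ : ∀ a b g → sumOver (a + b) g ≡ sumOver a (λ u → sumOver b (λ r → g (u ++ r)))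
  sumOver-++ zero    b g = refl
  sumOver-++ (suc a) b g = cong₂ _+_ (sumOver-++ a b _) (sumOver-++ a b _)

  sumOver-swap : ∀ a b (g : List Bool → List Bool → ℕ) → sumOver a (λ u → sumOver b (g u)) ≡ sumOver b (λ r → sumOver a (λ u → g u r))
  sumOver-swap zero    b g = refl
  sumOver-swap (suc a) b g = ≡.trans (cong₂ _+_ (sumOver-swap a b _) (sumOver-swap a b _)) (≡.sym (sumOver-+ b _ _))

  sumOver-none : ∀ n (P : List Bool → Bool) → sumOver n (λ r → indicator (P r)) ≡ 0 ⊎ (∃[ r ] length r ≡ n × P r ≡ true)
  sumOver-none zero P with P [] in eq
  ... | true  = inj₂ ([] , refl , eq)
  ... | false = inj₁ refl
  sumOver-none (suc n) P with sumOver-none n (λ r → P (false ∷ r)) | sumOver-none n (λ r → P (true ∷ r))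
  ... | inj₁ e             | inj₁ e′            = inj₁ (cong₂ _+_ e e′)
  ... | inj₂ (r , l , eq)  | _                  = inj₂ (false ∷ r , cong suc l , eq)
  ... | inj₁ _             | inj₂ (r , l , eq)  = inj₂ (true ∷ r , cong suc l , eq)

  sumOver-unique : ∀ n (P : List Bool → Bool) → (∀ r s → length r ≡ n → length s ≡ n → P r ≡ true → P s ≡ true → r ≡ s) →
                   sumOver n (λ r → indicator (P r)) ≤ 1
  sumOver-unique zero P u with P []
  ... | true  = ≤-refl
  ... | false = z≤n
  sumOver-unique (suc n) P u with sumOver-none n (λ r → P (false ∷ r)) | sumOver-none n (λ r → P (true ∷ r))
  ... | inj₁ e | _ rewrite e = sumOver-unique n _ (λ r s l l′ p q → ∷-inj (u (true ∷ r) (true ∷ s) (cong suc l) (cong suc l′) p q))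
    where
    ∷-inj : ∀ {x} {r s : List Bool} → x ∷ r ≡ x ∷ s → r ≡ s
    ∷-inj refl = refl
  ... | inj₂ _ | inj₁ e rewrite e | +-identityʳ (sumOver n (λ r → indicator (P (false ∷ r)))) =
    sumOver-unique n _ (λ r s l l′ p q → ∷-inj (u (false ∷ r) (false ∷ s) (cong suc l) (cong suc l′) p q))
    where
    ∷-inj : ∀ {x} {r s : List Bool} → x ∷ r ≡ x ∷ s → r ≡ s
    ∷-inj refl = refl
  ... | inj₂ (r , l , p) | inj₂ (s , l′ , q) with () ← u (false ∷ r) (true ∷ s) (cong suc l) (cong suc l′) p q

  indicator≤1 : ∀ b → indicator b ≤ 1
  indicator≤1 true  = ≤-refl
  indicator≤1 false = z≤n

  chunks : List Pol → ℕ → List Bool → List Pol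
  chunks us zero    r = []
  chunks us (suc n) r = proj₂ (takeBits us r) ∷ chunks us n (proj₁ (takeBits us r))

  takeBits-++ : ∀ us u r → length u ≡ length us → takeBits us (u ++ r) ≡ (r , u)
  takeBits-++ []       []      r eq = refl
  takeBits-++ (_ ∷ us) (x ∷ u) r eq rewrite takeBits-++ us u r (suc-injective eq) = refl

  zeros : List Pol → ℕ → (List Pol → Pol) → ℕ
  zeros us n f = sumOver (n * length us) (λ r → indicator (isZero (f (chunks us n r))))

  -- Schwartz–Zippel for scalars drawn from the 2 ^ t polynomials of degree
  -- less than t = length us.
  zeros-bound : ∀ us n f p → MultiAffine n f → length p ≡ n → f p ≉ [] →
                2 ℕ^ length us * zeros us n f ≤ n * 2 ℕ^ (n * length us)
  zeros-bound us zero    f []      m       eq nz with isZero (f []) in z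
  ... | true  = ⊥-elim (nz (isZero-sound _ z))
  ... | false = ≤-reflexive (*-zeroʳ (2 ℕ^ length us))
  zeros-bound us (suc n) f (p ∷ ps) (a , m) eq nz = ≤-trans (*-monoʳ-≤ T (≤-trans (≤-reflexive split) (≤-trans (sumOver-mono N fibre) (≤-reflexive sum))))
      (≤-trans (≤-reflexive (*-distribˡ-+ T (T * Z) (2 ℕ^ N))) (≤-trans (+-monoˡ-≤ (T * 2 ℕ^ N) (*-monoʳ-≤ T (zeros-bound us n (λ ys → f (p ∷ ys)) ps (m p) (suc-injective eq) nz)))
        (≤-reflexive (≡.trans (lem n T (2 ℕ^ N)) (cong (suc n *_) (≡.sym (^-distribˡ-+-* 2 t N)))))))
    where
    t N T Z : ℕ
    t = length us
    N = n * t
    T = 2 ℕ^ t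
    Z = zeros us n (λ ys → f (p ∷ ys))
    bad : List Bool → List Bool → ℕ
    bad u r = indicator (isZero (f (u ∷ chunks us n r)))
    -- The first scalar is summed innermost, so that it varies while the remaining ones are fixed.
    split : zeros us (suc n) f ≡ sumOver N (λ r → sumOver t (λ u → bad u r))
    split = ≡.trans (sumOver-++ t N _) (≡.trans (sumOver-cong t λ u l → sumOver-cong N λ r _ →
              cong (λ z → indicator (isZero (f (proj₂ z ∷ chunks us n (proj₁ z))))) (takeBits-++ us u r l)) (sumOver-swap t N bad))
    -- Here `p` is the first coordinate of the point where f is nonzero. If f vanishes at `p`
    -- followed by the scalars from r, all T values may be zeros, but such r are counted by
    -- induction. Otherwise `two-roots` leaves at most one zero.
    fibre : ∀ r → sumOver t (λ u → bad u r) ≤ T * bad p r + 1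
    fibre r with isZero (f (p ∷ chunks us n r)) in z
    ... | true  = ≤-trans (sumOver-mono t (λ u → indicator≤1 (isZero (f (u ∷ chunks us n r)))))
                    (≤-trans (≤-reflexive (≡.trans (sumOver-const 1 t) (*-comm 1 T))) (m≤m+n _ 1))
    ... | false = ≤-trans (sumOver-unique t _ unique) (m≤n+m 1 _)
      where
      unique : ∀ u v → length u ≡ t → length v ≡ t → isZero (f (u ∷ chunks us n r)) ≡ true → isZero (f (v ∷ chunks us n r)) ≡ true → u ≡ v
      unique u v l l′ zu zv with nonzero? (u ⊻ v)
      ... | inj₁ e = ≈⇒≡ u v (≡.trans l (≡.sym l′)) (⊻≈0⇒≈ u v e)
      ... | inj₂ ne with () ← ≡.trans (≡.sym z) (isZero-complete _ (two-roots (a (chunks us n r)) p (isZero-sound _ zu) (isZero-sound _ zv)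
                                (λ e → ne (≈-trans (⊻-cong e (≈-refl {v})) (⊻-self v)))))
    sum : sumOver N (λ r → T * bad p r + 1) ≡ T * Z + 2 ℕ^ N
    sum = ≡.trans (sumOver-+ N _ _) (cong₂ _+_ (sumOver-* T N _) (≡.trans (sumOver-const 1 N) (*-identityˡ _)))
    lem : ∀ n T N → T * (n * N) + T * N ≡ (1 + n) * (T * N)
    lem = solve-∀

  module _ (fs : List (Pol × List Option)) (k : ℕ) (V : List Pol) (powersOf : Pol → Pol → List Pol) where

    choice : Pol → Pol → Pol → Choice
    choice b v y = v , (b , (y , powersOf b v))

    -- The rows with scalars taken from a given list instead of from coins. This presents the total
    -- as a function of the scalars.
    fillRow : Pol → List Pol → List Pol → List Pol × List Choice
    fillRow b = mapAccL (λ ys v → drop 1 ys , choice b v (headᵈ [] ys))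

    fillRows : List Pol → List Pol → List Pol × List (List Choice)
    fillRows = mapAccL (λ ys b → fillRow b ys V)

    total-choice : ∀ b v y rows → total fs k ((choice b v y ∷ []) ∷ rows) ≈ y ⊛ total fs k ((choice b v (true ∷ []) ∷ []) ∷ rows)
    total-choice b v y rows = ≈-trans (gridTotal-cong fs (λ g → ≈-trans
        (⊛-congˡ (weight g) (perm-row-* (entry g) {choice b v y ∷ []} {choice b v (true ∷ []) ∷ []} y rows (upTo k) (λ {j} _ → scaled g j)))
        (x∙yz≈y∙xz (weight g) y _)))
      (gridTotal-* y fs _)
      where
      scaled : ∀ g j → entry g (choice b v y ∷ []) j ≈ y ⊛ entry g (choice b v (true ∷ []) ∷ []) j
      scaled g j = begin
        scaleAt g v y ⊛ n ⊻ []                    ≈⟨ ⊻-identityʳ _ ⟩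
        scaleAt g v y ⊛ n                         ≈⟨ ⊛-cong (scaleAt-* g v y) (≈-refl {n}) ⟩
        y ⊛ monomial g v ⊛ n                      ≈⟨ ⊛-assoc y (monomial g v) n ⟩
        y ⊛ (monomial g v ⊛ n)                    ≈⟨ ⊛-congˡ y (⊻-identityʳ _) ⟨
        y ⊛ (monomial g v ⊛ n ⊻ [])               ∎
        where
        n : Pol
        n = nodeAt (choice b v y) j

    -- A scalar occurs in a single choice of a single row. Additivity in the row separates this
    -- choice from the others, and by homogeneity its contribution is proportional to the scalar.
    total-affine : ∀ b v ds row rows → Affine (λ y → total fs k ((ds ++ choice b v y ∷ row) ∷ rows))
    total-affine b v ds row rows = ∑ ds S ⊻ ∑ row S , S (choice b v (true ∷ [])) , λ y → begin
      total fs k ((ds ++ choice b v y ∷ row) ∷ rows)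
        ≈⟨ total-row fs k (ds ++ choice b v y ∷ row) rows ⟩
      ∑ (ds ++ choice b v y ∷ row) S
        ≈⟨ ∑-++ ds _ S ⟩
      ∑ ds S ⊻ (S (choice b v y) ⊻ ∑ row S)
        ≈⟨ ⊻-cong (≈-refl {∑ ds S}) (≈-trans (⊻-comm (S (choice b v y)) _) (⊻-cong (≈-refl {∑ row S}) (≈-trans (total-choice b v y rows) (⊛-comm y _)))) ⟩
      ∑ ds S ⊻ (∑ row S ⊻ S (choice b v (true ∷ [])) ⊛ y)
        ≈⟨ ⊻-assoc (∑ ds S) (∑ row S) _ ⟨
      ∑ ds S ⊻ ∑ row S ⊻ S (choice b v (true ∷ [])) ⊛ y ∎
      where
      S : Choice → Pol
      S c = total fs k ((c ∷ []) ∷ rows)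

    -- The situation midway through the scalars: finished rows in `done`, the finished part `ds` of
    -- the current row in front, and the colours `vs` and elements `bs` yet to be supplied. The
    -- current row leads because additivity is available for the first row.
    partial : List (List Choice) → List Choice → Pol → List Pol → List Pol → List Pol → Pol
    partial done ds b vs bs ys = let r = fillRow b ys vs in
      total fs k ((ds ++ proj₂ r) ∷ (proj₂ (fillRows (proj₁ r) bs) ++ done))

    partial-multiaffine : ∀ done ds b vs bs → MultiAffine (length vs + length bs * length V) (partial done ds b vs bs)
    partial-multiaffine done ds b []       []        = tt
    partial-multiaffine done ds b []       (b′ ∷ bs) =
      MultiAffine-resp (length V + length bs * length V) (λ ys → let r = fillRow b′ ys V in
          total-↭ fs k (subst (λ z → proj₂ r ∷ (proj₂ (fillRows (proj₁ r) bs) ++ ds ∷ done) ↭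
                                     z ∷ (proj₂ r ∷ proj₂ (fillRows (proj₁ r) bs)) ++ done)
                              (≡.sym (++-identityʳ ds)) (shift ds (proj₂ r ∷ proj₂ (fillRows (proj₁ r) bs)) done)))
        (partial-multiaffine (ds ∷ done) [] b′ V bs)
    partial-multiaffine done ds b (v ∷ vs) bs        =
      (λ ys → total-affine b v ds (proj₂ (fillRow b ys vs)) (proj₂ (fillRows (proj₁ (fillRow b ys vs)) bs) ++ done)) ,
      (λ y → MultiAffine-resp (length vs + length bs * length V)
               (λ ys → let r = fillRow b ys vs in CommutativeRing.reflexive polynomials
                 (cong (λ z → total fs k (z ∷ (proj₂ (fillRows (proj₁ r) bs) ++ done))) (++-assoc ds (choice b v y ∷ []) (proj₂ r))))
               (partial-multiaffine done (ds ++ choice b v y ∷ []) b vs bs))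

    total-multiaffine : ∀ b bs → MultiAffine (length (b ∷ bs) * length V) (λ ys → total fs k (proj₂ (fillRows ys (b ∷ bs))))
    total-multiaffine b bs = MultiAffine-resp (length (b ∷ bs) * length V)
      (λ ys → let r = fillRow b ys V in CommutativeRing.reflexive polynomials
        (cong (λ z → total fs k (proj₂ r ∷ z)) (++-identityʳ (proj₂ (fillRows (proj₁ r) bs)))))
      (partial-multiaffine [] [] b V bs)

    Colouring : List Pol → List Pol → Set
    Colouring = Pointwise (λ _ v → v ∈ V)

    -- The indicator vector of one colour. With such scalars the matrix of a sum over all colourings
    -- collapses to a single colouring, which yields the point required by Schwartz-Zippel.
    selector : ∀ {v : Pol} {vs} → v ∈ vs → List Pol
    selector {vs = _ ∷ vs} (here _)  = (true ∷ []) ∷ map (λ _ → []) vs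
    selector               (there p) = [] ∷ selector p

    selectors : ∀ {vs bs} → Colouring bs vs → List Pol
    selectors []       = []
    selectors (p ∷ ps) = selector p ++ selectors ps

    length-selectors : ∀ {vs bs} (ps : Colouring bs vs) → length (selectors ps) ≡ length bs * length V
    length-selectors []       = refl
    length-selectors (p ∷ ps) = ≡.trans (length-++ (selector p)) (cong₂ _+_ (length-selector p) (length-selectors ps))
      where
      open import Data.List.Properties using (length-map)
      length-selector : ∀ {v : Pol} {vs} (p : v ∈ vs) → length (selector p) ≡ length vs
      length-selector {vs = _ ∷ vs} (here _)  = cong suc (length-map (λ _ → []) vs)
      length-selector               (there p) = cong suc (length-selector p)

    total-zeros : ∀ b vs ys rows → let r = fillRow b (map (λ _ → []) vs ++ ys) vs in
                  proj₁ r ≡ ys × ∑ (proj₂ r) (λ c → total fs k ((c ∷ []) ∷ rows)) ≈ []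
    total-zeros b []       ys rows = refl , ≈-refl
    total-zeros b (v ∷ vs) ys rows =
      let e , z = total-zeros b vs ys rows in e , ⊻-cong (total-choice b v [] rows) z

    total-selector : ∀ b {v : Pol} {vs} (p : v ∈ vs) ys rows → let r = fillRow b (selector p ++ ys) vs in
                     proj₁ r ≡ ys × ∑ (proj₂ r) (λ c → total fs k ((c ∷ []) ∷ rows)) ≈ total fs k ((choice b v (true ∷ []) ∷ []) ∷ rows)
    total-selector b {v} {_ ∷ vs} (here refl) ys rows =
      let e , z = total-zeros b vs ys rows in e , ≈-trans (⊻-cong (≈-refl {total fs k ((choice b v (true ∷ []) ∷ []) ∷ rows)}) z) (⊻-identityʳ _)
    total-selector b {v} {u ∷ vs} (there p) ys rows =
      let e , z = total-selector b p ys rows in e , ⊻-cong (total-choice b u [] rows) z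

    selected : ∀ {vs bs} → Colouring bs vs → List Choice
    selected                         []       = []
    selected {vs = v ∷ _} {bs = b ∷ _} (p ∷ ps) = choice b v (true ∷ []) ∷ selected ps

    -- One row after another is collapsed to its selected choice. Each moves to `done` so that the
    -- next one becomes the first row.
    total-selected : ∀ {vs bs} (ps : Colouring bs vs) done →
                     total fs k (proj₂ (fillRows (selectors ps) bs) ++ done) ≈ total fs k (map (_∷ []) (selected ps) ++ done)
    total-selected [] done = ≈-refl
    total-selected {v ∷ vs} {b ∷ bs} (p ∷ ps) done = begin
      total fs k (proj₂ r ∷ (proj₂ (fillRows (proj₁ r) bs) ++ done))
        ≡⟨ cong (λ z → total fs k (proj₂ r ∷ (proj₂ (fillRows z bs) ++ done))) (proj₁ (total-selector b p (selectors ps) [])) ⟩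
      total fs k (proj₂ r ∷ rows)
        ≈⟨ total-row fs k (proj₂ r) rows ⟩
      ∑ (proj₂ r) (λ c → total fs k ((c ∷ []) ∷ rows))
        ≈⟨ proj₂ (total-selector b p (selectors ps) rows) ⟩
      total fs k (c ∷ rows)
        ≈⟨ total-↭ fs k (↭-sym (shift c (proj₂ (fillRows (selectors ps) bs)) done)) ⟩
      total fs k (proj₂ (fillRows (selectors ps) bs) ++ c ∷ done)
        ≈⟨ total-selected ps (c ∷ done) ⟩
      total fs k (map (_∷ []) (selected ps) ++ c ∷ done)
        ≈⟨ total-↭ fs k (shift c (map (_∷ []) (selected ps)) done) ⟩
      total fs k (c ∷ (map (_∷ []) (selected ps) ++ done)) ∎
      where
      r : List Pol × List Choice
      r = fillRow b (selector p ++ selectors ps) V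
      rows : List (List Choice)
      rows = proj₂ (fillRows (selectors ps) bs) ++ done
      c : List Choice
      c = choice b v (true ∷ []) ∷ []

    module _ (us : List Pol) where

      drawRow : Pol → Pol → List Pol → Pol × List Choice
      drawRow b = mapAccL (λ r v → proj₁ (takeBits us r) , choice b v (proj₂ (takeBits us r)))

      drawRow-chunks : ∀ b vs n r → let p = drawRow b r vs ; q = fillRow b (chunks us (length vs + n) r) vs in
                       proj₁ q ≡ chunks us n (proj₁ p) × proj₂ q ≡ proj₂ p
      drawRow-chunks b []       n r = refl , refl
      drawRow-chunks b (v ∷ vs) n r =
        let e , e′ = drawRow-chunks b vs n (proj₁ (takeBits us r)) in e , cong (_ ∷_) e′

      -- Drawing scalars on the fly equals cutting the coin string into scalars in advance. This
      -- links the program to the count in `zeros`.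
      drawRows-chunks : ∀ bs r → proj₂ (mapAccL (λ r b → drawRow b r V) r bs) ≡ proj₂ (fillRows (chunks us (length bs * length V) r) bs)
      drawRows-chunks []       r = refl
      drawRows-chunks (b ∷ bs) r =
        let e , e′ = drawRow-chunks b V (length bs * length V) r
        in cong₂ _∷_ (≡.sym e′) (≡.trans (drawRows-chunks bs (proj₁ (drawRow b r V))) (cong (λ z → proj₂ (fillRows z bs)) (≡.sym e)))

-- Modular addition on binary numerals

module BinaryArithmetic where

  open import Defs using (toBits)
  open Folds
  open Polynomials using (Pol)
  open Algorithm
  open import Data.Bool using (Bool; true; false; if_then_else_)
  open import Data.Empty using (⊥-elim)
  open import Data.List using (List; []; _∷_; length; drop)
  open import Data.Nat using (ℕ; zero; suc; z≤n; s≤s; _≤_; _<_; _+_; _*_; _^_; _≡ᵇ_; _%_; _/_; NonZero; >-nonZero)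
  open import Data.Nat.DivMod using (m≡m%n+[m/n]*n; [m+kn]%n≡m%n; [m+n]%n≡m%n; m<n⇒m%n≡m; m%n<n; m*n/n≡m; +-distrib-/-∣ʳ; m<n*o⇒m/o<n)
  open import Data.Nat.Divisibility using (divides-refl)
  open import Data.Nat.Logarithm using (⌊log₂_⌋; ⌊log₂⌋-mono-≤; ⌊log₂[2^n]⌋≡n)
  open import Data.Nat.Properties
  open import Data.Nat.Tactic.RingSolver using (solve-∀)
  open import Data.Product using (_×_; _,_; proj₁; proj₂)
  open import Relation.Binary.PropositionalEquality using (_≡_; refl; sym; trans; cong; cong₂; subst; module ≡-Reasoning)

  bitValue : Bool → ℕ
  bitValue b = if b then 1 else 0

  value : List Bool → ℕ
  value []      = 0
  value (x ∷ a) = bitValue x + value a * 2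

  length-toBits : ∀ w n → length (toBits w n) ≡ w
  length-toBits zero    n = refl
  length-toBits (suc w) n = cong suc (length-toBits w (n / 2))

  value<2^length : ∀ a → value a < 2 ^ length a
  value<2^length []      = s≤s z≤n
  value<2^length (x ∷ a) = ≤-trans (s≤s (+-monoˡ-≤ (value a * 2) (bit≤1 x)))
    (≤-trans (*-monoˡ-≤ 2 (value<2^length a)) (≤-reflexive (*-comm (2 ^ length a) 2)))
    where
    bit≤1 : ∀ x → bitValue x ≤ 1
    bit≤1 true  = ≤-refl
    bit≤1 false = z≤n

  value-toBits : ∀ w n → n < 2 ^ w → value (toBits w n) ≡ n
  value-toBits zero    zero    lt = refl
  value-toBits zero    (suc n) (s≤s ())
  value-toBits (suc w) n       lt = begin
    bitValue (n % 2 ≡ᵇ 1) + value (toBits w (n / 2)) * 2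
      ≡⟨ cong₂ (λ a b → a + b * 2) (parity (n % 2) (m%n<n n 2))
           (value-toBits w (n / 2) (m<n*o⇒m/o<n (subst (n <_) (*-comm 2 (2 ^ w)) lt))) ⟩
    n % 2 + n / 2 * 2
      ≡⟨ m≡m%n+[m/n]*n n 2 ⟨
    n ∎
    where
    open ≡-Reasoning
    parity : ∀ r → r < 2 → bitValue (r ≡ᵇ 1) ≡ r
    parity zero          _ = refl
    parity (suc zero)    _ = refl
    parity (suc (suc r)) (s≤s (s≤s ()))

  toBits-value : ∀ a → toBits (length a) (value a) ≡ a
  toBits-value []      = refl
  toBits-value (x ∷ a) = cong₂ _∷_ (trans (cong (_≡ᵇ 1) ([m+kn]%n≡m%n (bitValue x) (value a) 2)) (parity x))
    (trans (cong (toBits (length a)) half) (toBits-value a))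
    where
    parity : ∀ x → (bitValue x % 2 ≡ᵇ 1) ≡ x
    parity true  = refl
    parity false = refl
    half : (bitValue x + value a * 2) / 2 ≡ value a
    half = trans (+-distrib-/-∣ʳ (bitValue x) (divides-refl (value a))) (trans (cong (_+ value a * 2 / 2) (zero-half x)) (m*n/n≡m (value a) 2))
      where
      zero-half : ∀ x → bitValue x / 2 ≡ 0
      zero-half true  = refl
      zero-half false = refl

  value-injective : ∀ a b → length a ≡ length b → value a ≡ value b → a ≡ b
  value-injective a b l eq = trans (sym (toBits-value a)) (trans (cong₂ toBits l eq) (toBits-value b))

  toBits-injective : ∀ w {a b} → a < 2 ^ w → b < 2 ^ w → toBits w a ≡ toBits w b → a ≡ b
  toBits-injective w {a} {b} lt lt′ eq = trans (sym (value-toBits w a lt)) (trans (cong value eq) (value-toBits w b lt′))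

  <2^width : ∀ m → m < 2 ^ suc ⌊log₂ m ⌋
  <2^width m = ≰⇒> λ le → <-irrefl refl (subst (_≤ ⌊log₂ m ⌋) (⌊log₂[2^n]⌋≡n (suc ⌊log₂ m ⌋)) (⌊log₂⌋-mono-≤ le))

  subtract : Bool → Pol → Pol → Bool × Pol
  subtract c x y = mapAccL subDigit c (zipᵈ false x y)

  length-sub : ∀ c x y → length (proj₂ (subtract c x y)) ≡ length x
  length-sub c x y = trans (length-mapAccL subDigit c (zipᵈ false x y)) (length-zipᵈ x y)
    where
    length-zipᵈ : ∀ (x y : Pol) → length (zipᵈ false x y) ≡ length x
    length-zipᵈ []      y = refl
    length-zipᵈ (_ ∷ x) y = cong suc (length-zipᵈ x (drop 1 y))

  subDigit-correct : ∀ c x y → bitValue x + 2 * bitValue (proj₁ (subDigit c (x , y))) ≡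
                               bitValue y + bitValue c + bitValue (proj₂ (subDigit c (x , y)))
  subDigit-correct true  true  true  = refl
  subDigit-correct true  true  false = refl
  subDigit-correct true  false true  = refl
  subDigit-correct true  false false = refl
  subDigit-correct false true  true  = refl
  subDigit-correct false true  false = refl
  subDigit-correct false false true  = refl
  subDigit-correct false false false = refl

  -- Stated additively because subtraction of natural numbers truncates. The outgoing borrow has the
  -- weight of the digit after the last one.
  subtract-correct : ∀ c x y → length x ≡ length y → let r = subtract c x y in
                     value x + 2 ^ length x * bitValue (proj₁ r) ≡ value y + bitValue c + value (proj₂ r)
  subtract-correct c []      []      eq = trans (+-identityʳ _) (sym (+-identityʳ (bitValue c)))
  subtract-correct c (x ∷ a) (y ∷ b) eq = begin
    (bitValue x + value a * 2) + 2 * 2 ^ length a * bitValue e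
      ≡⟨ lem₁ (bitValue x) (value a) (2 ^ length a) (bitValue e) ⟩
    bitValue x + (value a + 2 ^ length a * bitValue e) * 2
      ≡⟨ cong (λ z → bitValue x + z * 2) (subtract-correct c′ a b (suc-injective eq)) ⟩
    bitValue x + (value b + bitValue c′ + value ds) * 2
      ≡⟨ lem₂ (bitValue x) (value b) (bitValue c′) (value ds) ⟩
    (bitValue x + 2 * bitValue c′) + (value b + value ds) * 2
      ≡⟨ cong (_+ (value b + value ds) * 2) (subDigit-correct c x y) ⟩
    (bitValue y + bitValue c + bitValue d) + (value b + value ds) * 2
      ≡⟨ lem₃ (bitValue y) (bitValue c) (bitValue d) (value b) (value ds) ⟩
    (bitValue y + value b * 2) + bitValue c + (bitValue d + value ds * 2) ∎
    where
    open ≡-Reasoning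
    c′ d e : Bool
    c′ = proj₁ (subDigit c (x , y))
    d = proj₂ (subDigit c (x , y))
    e = proj₁ (subtract c′ a b)
    ds : Pol
    ds = proj₂ (subtract c′ a b)
    lem₁ : ∀ x a p e → (x + a * 2) + 2 * p * e ≡ x + (a + p * e) * 2
    lem₁ = solve-∀
    lem₂ : ∀ x b c d → x + (b + c + d) * 2 ≡ (x + 2 * c) + (b + d) * 2
    lem₂ = solve-∀
    lem₃ : ∀ y c d b ds → (y + c + d) + (b + ds) * 2 ≡ (y + b * 2) + c + (d + ds * 2)
    lem₃ = solve-∀

  sub-no-borrow : ∀ x y → length x ≡ length y → proj₁ (sub x y) ≡ false → value (proj₂ (sub x y)) + value y ≡ value x
  sub-no-borrow x y l eq = begin
    value (proj₂ (sub x y)) + value y                      ≡⟨ +-comm (value (proj₂ (sub x y))) (value y) ⟩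
    value y + value (proj₂ (sub x y))                      ≡⟨ cong (_+ value (proj₂ (sub x y))) (+-identityʳ (value y)) ⟨
    value y + 0 + value (proj₂ (sub x y))                  ≡⟨ subtract-correct false x y l ⟨
    value x + 2 ^ length x * bitValue (proj₁ (sub x y))    ≡⟨ cong (λ z → value x + 2 ^ length x * bitValue z) eq ⟩
    value x + 2 ^ length x * 0                             ≡⟨ trans (cong (value x +_) (*-zeroʳ (2 ^ length x))) (+-identityʳ _) ⟩
    value x                                                ∎
    where open ≡-Reasoning

  sub-borrow : ∀ x y → length x ≡ length y → proj₁ (sub x y) ≡ true → value x < value y
  sub-borrow x y l eq = +-cancelʳ-< (2 ^ length x) (value x) (value y) (begin-strict
    value x + 2 ^ length x
      ≡⟨ cong (value x +_) (*-identityʳ (2 ^ length x)) ⟨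
    value x + 2 ^ length x * 1
      ≡⟨ cong (λ z → value x + 2 ^ length x * bitValue z) eq ⟨
    value x + 2 ^ length x * bitValue (proj₁ (sub x y))
      ≡⟨ subtract-correct false x y l ⟩
    value y + 0 + value (proj₂ (sub x y))
      ≡⟨ cong (_+ value (proj₂ (sub x y))) (+-identityʳ (value y)) ⟩
    value y + value (proj₂ (sub x y))
      <⟨ +-monoʳ-< (value y) (subst (λ z → value (proj₂ (sub x y)) < 2 ^ z) (length-sub false x y) (value<2^length (proj₂ (sub x y)))) ⟩
    value y + 2 ^ length x ∎)
    where open ≤-Reasoning

  sub-exact : ∀ x y → length x ≡ length y → value y ≤ value x → value (proj₂ (sub x y)) + value y ≡ value x
  sub-exact x y l le with proj₁ (sub x y) in eq
  ... | false = sub-no-borrow x y l eq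
  ... | true  = ⊥-elim (<⇒≱ (sub-borrow x y l eq) le)

  addMod-value : ∀ m a b .{{_ : NonZero (value m)}} → length a ≡ length m → length b ≡ length m → value a < value m → value b < value m →
                 value (addMod m a b) ≡ (value a + value b) % value m
  addMod-value m a b la lb a<m b<m with sub-exact m b (sym lb) (<⇒≤ b<m) | proj₁ (sub a (proj₂ (sub m b))) in borrow
  ... | d+b≡m | true  = trans f≡a+b (sym (m<n⇒m%n≡m a+b<m))
    where
    d : Pol
    d = proj₂ (sub m b)
    ld : length d ≡ length m
    ld = length-sub false m b
    a<d : value a < value d
    a<d = sub-borrow a d (trans la (sym ld)) borrow
    e f : Pol
    e = proj₂ (sub d a)
    f = proj₂ (sub m e)
    e+a≡d : value e + value a ≡ value d
    e+a≡d = sub-exact d a (trans ld (sym la)) (<⇒≤ a<d)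
    le : length e ≡ length m
    le = trans (length-sub false d a) ld
    e≤m : value e ≤ value m
    e≤m = ≤-trans (m≤m+n _ (value a)) (≤-trans (≤-reflexive e+a≡d) (≤-trans (m≤m+n _ (value b)) (≤-reflexive d+b≡m)))
    f+e≡m : value f + value e ≡ value m
    f+e≡m = sub-exact m e (sym le) e≤m
    f≡a+b : value f ≡ value a + value b
    f≡a+b = +-cancelʳ-≡ (value e) (value f) (value a + value b) (trans f+e≡m (trans (sym d+b≡m) (trans (cong (_+ value b) (sym e+a≡d))
              (lem (value e) (value a) (value b)))))
      where
      lem : ∀ e a b → (e + a) + b ≡ (a + b) + e
      lem = solve-∀
    a+b<m : value a + value b < value m
    a+b<m = ≤-trans (+-monoˡ-< (value b) a<d) (≤-reflexive d+b≡m)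
  ... | d+b≡m | false = sym (trans (cong (_% value m) a+b≡r+m) (trans ([m+n]%n≡m%n (value r) (value m)) (m<n⇒m%n≡m r<m)))
    where
    d r : Pol
    d = proj₂ (sub m b)
    r = proj₂ (sub a d)
    r+d≡a : value r + value d ≡ value a
    r+d≡a = sub-no-borrow a d (trans la (sym (length-sub false m b))) borrow
    a+b≡r+m : value a + value b ≡ value r + value m
    a+b≡r+m = trans (cong (_+ value b) (sym r+d≡a)) (trans (+-assoc (value r) (value d) (value b)) (cong (value r +_) d+b≡m))
    r<m : value r < value m
    r<m = ≤-trans (s≤s (≤-trans (m≤m+n _ (value d)) (≤-reflexive r+d≡a))) a<m

  length-addMod : ∀ m a b → length a ≡ length m → length b ≡ length m → length (addMod m a b) ≡ length m
  length-addMod m a b la lb with proj₁ (sub a (proj₂ (sub m b)))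
  ... | true  = length-sub false m _
  ... | false = trans (length-sub false a _) la

  addMod-toBits : ∀ w m a b .{{_ : NonZero m}} → m < 2 ^ w → a < m → b < m →
                  addMod (toBits w m) (toBits w a) (toBits w b) ≡ toBits w ((a + b) % m)
  addMod-toBits w m a b m< a<m b<m = value-injective _ _
      (trans (length-addMod M A B (trans (length-toBits w a) (sym (length-toBits w m))) (trans (length-toBits w b) (sym (length-toBits w m))))
        (trans (length-toBits w m) (sym (length-toBits w _))))
      (begin
        value (addMod M A B)
          ≡⟨ reduced ⟩
        (a + b) % m
          ≡⟨ value-toBits w _ (<-trans (m%n<n (a + b) m) m<) ⟨
        value (toBits w ((a + b) % m)) ∎)
    where
    open ≡-Reasoning
    M A B : Pol
    M = toBits w m
    A = toBits w a
    B = toBits w b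
    vA : value A ≡ a
    vA = value-toBits w a (<-trans a<m m<)
    vB : value B ≡ b
    vB = value-toBits w b (<-trans b<m m<)
    vM : value M ≡ m
    vM = value-toBits w m m<
    mod-cong : ∀ {a a′ b b′ n n′} .{{_ : NonZero n}} .{{_ : NonZero n′}} → a ≡ a′ → b ≡ b′ → n ≡ n′ → (a + b) % n ≡ (a′ + b′) % n′
    mod-cong refl refl refl = refl
    M≢0 : NonZero (value M)
    M≢0 = >-nonZero (≤-trans (≤-<-trans z≤n a<m) (≤-reflexive (sym vM)))
    reduced : value (addMod M A B) ≡ (a + b) % m
    reduced = trans (addMod-value M A B {{M≢0}} (trans (length-toBits w a) (sym (length-toBits w m)))
                      (trans (length-toBits w b) (sym (length-toBits w m)))
                      (≤-trans (s≤s (≤-reflexive vA)) (≤-trans a<m (≤-reflexive (sym vM))))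
                      (≤-trans (s≤s (≤-reflexive vB)) (≤-trans b<m (≤-reflexive (sym vM)))))
                (mod-cong {{M≢0}} vA vB vM)

-- From colourings back to solutions

module Correctness where

  open Folds
  open Polynomials
  open Algorithm
  open GridSum
  open Interpolation
  open Selection
  open SchwartzZippel
  open BinaryArithmetic
  open Permanent polynomials ⊻-self renaming (_^_ to _ⁿ_)
  open import Algebra.Bundles using (CommutativeRing)
  import Data.Bool as Bool
  open import Data.Bool using (Bool; true; false; if_then_else_; not)
  open import Data.Empty using (⊥-elim)
  open import Data.Fin using (Fin; zero; suc; toℕ; _≟_)
  open import Data.Fin.Properties using (toℕ<n; toℕ-injective; toℕ-fromℕ<)
  open import Data.Fin.Subset using (Subset; ∣_∣; inside; outside)
  open import Data.Fin.Subset.Properties using (_∈?_)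
  open import Data.List using (List; []; _∷_; length; map; drop; filter; filterᵇ; deduplicate; zip; allFin; tabulate; zipWith)
  open import Data.Nat.ListAction using (sum)
  open import Data.List.Properties using (length-map; map-∘; map-tabulate; map-injective; ≡-dec)
  open import Data.List.Membership.Propositional using (_∈_)
  open import Data.List.Membership.Propositional.Properties using (∈-map⁺; ∈-map⁻; ∈-deduplicate⁺)
  open import Data.List.Relation.Binary.Permutation.Propositional using (_↭_; ↭-sym; ↭⇒↭ₛ)
  open import Data.List.Relation.Binary.Permutation.Propositional.Properties using (map⁺; ↭-map-inv)
  open import Data.List.Relation.Binary.Pointwise as Pw using (Pointwise; []; _∷_)
  open import Data.List.Relation.Unary.All as All using (All; []; _∷_)
  open import Data.List.Relation.Unary.AllPairs as AllPairs using (AllPairs; []; _∷_)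
  open import Data.List.Relation.Unary.Any using (here; there)
  open import Data.List.Relation.Unary.Unique.Propositional using (Unique)
  open import Data.Nat using (ℕ; zero; suc; z≤n; s≤s; _≤_; _<_; _+_; _*_; _∸_; _^_; _%_; >-nonZero⁻¹)
  open import Data.List.Membership.DecPropositional (≡-dec Bool._≟_) using () renaming (_∈?_ to _∈ᴸ?_)
  open import Data.Nat.DivMod using (m%n<n)
  import Data.Nat.Properties as ℕ
  open import Data.Product using (∃-syntax; _×_; _,_; proj₁; proj₂)
  open import Data.Vec as Vec using (Vec; []; _∷_; toList)
  import Data.Vec.Properties as Vec
  open import Relation.Binary.PropositionalEquality as ≡ using (_≡_; _≢_; refl; cong; cong₂; subst)
  open import Relation.Nullary using (¬_; yes; no; does; ¬?)

  vandermonde-nonzero : ∀ {ts} → AllPairs _≉_ ts → vandermonde ts ≉ []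
  vandermonde-nonzero []       = 1≉0
  vandermonde-nonzero {t ∷ ts} (p ∷ ps) e =
    integral _ _ (∏-nonzero (t ⊻_) (All.map (λ t≉u z → t≉u (⊻≈0⇒≈ t _ z)) p)) (vandermonde-nonzero ps)
      (≈-trans (≈-sym (vandermonde-∷ t ts)) e)

  vandermonde-distinct : ∀ ts → vandermonde ts ≉ [] → Unique ts
  vandermonde-distinct []       nz = []
  vandermonde-distinct (t ∷ ts) nz =
    All.tabulate (λ { {u} u∈ refl → nz (≈-trans (vandermonde-∷ t ts) (⊛-cong (∏-zero {f = t ⊻_} u∈ (⊻-self t)) (≈-refl {vandermonde ts}))) }) ∷
    vandermonde-distinct ts (λ z → nz (≈-trans (vandermonde-∷ t ts) (≈-trans (⊛-congˡ (∏ ts (t ⊻_)) z) (⊛-zeroʳ (∏ ts (t ⊻_))))))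

  factors-nonzero : ∀ {X : Set} (f : X → Pol) xs → ∏ xs f ≉ [] → All (λ x → f x ≉ []) xs
  factors-nonzero f xs nz = All.tabulate (λ x∈ z → nz (∏-zero x∈ z))

  factorˡ : ∀ a b → a ⊛ b ≉ [] → a ≉ []
  factorˡ a b nz z = nz (⊛-cong z (≈-refl {b}))

  factorʳ : ∀ a b → a ⊛ b ≉ [] → b ≉ []
  factorʳ a b nz z = nz (≈-trans (⊛-congˡ a z) (⊛-zeroʳ a))

  count≤length : ∀ u vs → count u vs ≤ length vs
  count≤length u []       = z≤n
  count≤length u (v ∷ vs) with equal u v
  ... | true  = s≤s (count≤length u vs)
  ... | false = ℕ.m≤n⇒m≤1+n (count≤length u vs)

  module _ (w : ℕ) where

    equal-false : ∀ {u v} → Width w u → Width w v → u ≢ v → equal u v ≡ false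
    equal-false {u} {v} wu wv u≢v with equal u v in eq
    ... | true  = ⊥-elim (u≢v (equal⇒≡ u v (≡.trans wu (≡.sym wv)) eq))
    ... | false = refl

    hits : Pol → List Pol → ℕ
    hits v []      = 0
    hits v (u ∷ S) = if equal u v then suc (hits v S) else hits v S

    no-hits : ∀ {v S} → Width w v → All (Width w) S → All (λ u → v ≢ u) S → hits v S ≡ 0
    no-hits wv []       []       = refl
    no-hits {v} wv (wu ∷ wS) (v≢u ∷ ps) rewrite equal-false wu wv (λ e → v≢u (≡.sym e)) = no-hits wv wS ps

    one-hit : ∀ {v S} → Unique S → All (Width w) S → v ∈ S → hits v S ≡ 1
    one-hit {v} (p ∷ ps) (wu ∷ wS) (here refl) rewrite equal-refl v = cong suc (no-hits wu wS p)
    one-hit {v} (p ∷ ps) (wu ∷ wS) (there v∈) rewrite equal-false wu (All.lookup wS v∈) (All.lookup p v∈) = one-hit ps wS v∈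

    -- Double counting: each entry of `L` equals exactly one member of `S`, as `S` has no
    -- repetitions, so it is counted in exactly one multiplicity.
    sum-count : ∀ {S} → Unique S → All (Width w) S → ∀ L → All (_∈ S) L → sum (map (λ u → count u L) S) ≡ length L
    sum-count {S} uS wS []      []       = zeros-sum S
      where
      zeros-sum : ∀ S → sum (map (λ u → count u []) S) ≡ 0
      zeros-sum []      = refl
      zeros-sum (_ ∷ S) = zeros-sum S
    sum-count {S} uS wS (v ∷ L) (p ∷ ps) = ≡.trans (split S) (cong₂ _+_ (one-hit uS wS p) (sum-count uS wS L ps))
      where
      split : ∀ S → sum (map (λ u → count u (v ∷ L)) S) ≡ hits v S + sum (map (λ u → count u L) S)
      split []      = refl
      split (u ∷ S) with equal u v
      ... | true  = cong suc (≡.trans (cong (count u L +_) (split S)) (x+yz≡y+xz (count u L) (hits v S) _))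
        where
        x+yz≡y+xz : ∀ x y z → x + (y + z) ≡ y + (x + z)
        x+yz≡y+xz x y z = ≡.trans (≡.sym (ℕ.+-assoc x y z)) (≡.trans (cong (_+ z) (ℕ.+-comm x y)) (ℕ.+-assoc y x z))
      ... | false = ≡.trans (cong (count u L +_) (split S)) (x+yz≡y+xz (count u L) (hits v S) _)
        where
        x+yz≡y+xz : ∀ x y z → x + (y + z) ≡ y + (x + z)
        x+yz≡y+xz x y z = ≡.trans (≡.sym (ℕ.+-assoc x y z)) (≡.trans (cong (_+ z) (ℕ.+-comm x y)) (ℕ.+-assoc y x z))

    count-absent : ∀ {u S} → Width w u → All (Width w) S → ¬ u ∈ S → ∀ {L} → All (_∈ S) L → count u L ≡ 0
    count-absent wu wS u∉S []       = refl
    count-absent {u} {S} wu wS u∉S {v ∷ L} (p ∷ ps)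
      rewrite equal-false {u} {v} wu (All.lookup wS p) (λ u≡v → u∉S (subst (_∈ S) (≡.sym u≡v) p)) = count-absent wu wS u∉S ps

    -- The multiplicity of the colour without a variable is determined by the others.
    counts-agree : ∀ {S} → Unique S → All (Width w) S → ∀ L M → All (_∈ S) L → All (_∈ S) M → length L ≡ length M →
                   All (λ u → count u L ≡ count u M) (drop 1 S) → ∀ u → Width w u → count u L ≡ count u M
    counts-agree {S} uS wS L M pL pM len eqs u wu with u ∈ᴸ? S
    ... | no u∉S = ≡.trans (count-absent wu wS u∉S pL) (≡.sym (count-absent wu wS u∉S pM))
    counts-agree {S = _ ∷ S} uS wS L M pL pM len eqs u wu | yes (there u∈) = All.lookup eqs u∈
    counts-agree {S = u ∷ S} uS wS L M pL pM len eqs u wu | yes (here refl) =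
      ℕ.+-cancelʳ-≡ (sum (map (λ v → count v L) S)) (count u L) (count u M)
        (≡.trans (sum-count uS wS L pL) (≡.trans len (≡.trans (≡.sym (sum-count uS wS M pM))
          (cong (λ z → count u M + z) (≡.sym (sums-agree eqs))))))
      where
      sums-agree : ∀ {S} → All (λ u → count u L ≡ count u M) S → sum (map (λ v → count v L) S) ≡ sum (map (λ v → count v M) S)
      sums-agree []       = refl
      sums-agree (p ∷ ps) = cong₂ _+_ p (sums-agree ps)

  nodePowers-nth : ∀ (A : List Pol) t q j → j < length A → nth [] (proj₂ (mapAccL (λ q _ → t ⊛ q , q) q A)) j ≈ q ⊛ t ⁿ j
  nodePowers-nth (_ ∷ A) t q zero    lt       = ≈-sym (CommutativeRing.*-identityʳ polynomials q)
  nodePowers-nth (_ ∷ A) t q (suc j) (s≤s lt) =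
    ≈-trans (nodePowers-nth A t (t ⊛ q) j lt) (≈-trans (⊛-cong (⊛-comm t q) (≈-refl {t ⁿ j})) (⊛-assoc q t (t ⁿ j)))

  length-filter-∈ : ∀ {m} (B : Subset m) → length (elements B) ≡ ∣ B ∣
  length-filter-∈ {zero}  []      = refl
  length-filter-∈ {suc m} (x ∷ B) = lem x refl
    where
    shifted : ∀ xs → length (filter (_∈? (x ∷ B)) (map suc xs)) ≡ length (filter (_∈? B) xs)
    shifted []       = refl
    shifted (i ∷ xs) with does (i ∈? B)
    ... | true  = cong suc (shifted xs)
    ... | false = shifted xs
    rest : length (filter (_∈? (x ∷ B)) (tabulate suc)) ≡ ∣ B ∣
    rest = ≡.trans (cong (λ z → length (filter (_∈? (x ∷ B)) z)) (≡.sym (map-tabulate (λ i → i) suc)))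
             (≡.trans (shifted (allFin m)) (length-filter-∈ B))
    lem : ∀ y → x ≡ y → length (filter (_∈? (x ∷ B)) (allFin (suc m))) ≡ ∣ x ∷ B ∣
    lem inside  refl = cong suc rest
    lem outside refl = rest

  module _ (I : Instance) where
    open Instance I

    w : ℕ
    w = width I

    encodeElement : Fin m → Pol
    encodeElement a = toBits w (toℕ a)

    private
      enc : Fin m → Pol
      enc = encodeElement

      As Bs palette : List (Fin m)
      As = toList A
      Bs = elements B
      palette = supp I

      M : Pol
      M = toBits w m

    below : ∀ (a : Fin m) → toℕ a < 2 ^ w
    below a = ℕ.<-trans (toℕ<n a) (<2^width m)

    enc-injective : ∀ {a b} → enc a ≡ enc b → a ≡ b
    enc-injective {a} {b} eq = toℕ-injective (toBits-injective w (below a) (below b) eq)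

    width-enc : ∀ a → Width w (enc a)
    width-enc a = length-toBits w (toℕ a)

    widths : ∀ as → All (Width w) (map enc as)
    widths []       = []
    widths (a ∷ as) = width-enc a ∷ widths as

    equal-enc : ∀ a b → equal (enc a) (enc b) ≡ does (a ≟ b)
    equal-enc a b with a ≟ b
    ... | yes refl = equal-refl (enc a)
    ... | no a≢b   = equal-false w (width-enc a) (width-enc b) (λ e → a≢b (enc-injective e))

    support-enc : ∀ as → support (map enc as) ≡ map enc (deduplicate _≟_ as)
    support-enc []       = refl
    support-enc (a ∷ as) = cong (enc a ∷_) (≡.trans (cong (filterᵇ (λ b → not (equal (enc a) b))) (support-enc as)) (filtered (deduplicate _≟_ as)))
      where
      filtered : ∀ bs → filterᵇ (λ b → not (equal (enc a) b)) (map enc bs) ≡ map enc (filter (λ b → ¬? (a ≟ b)) bs)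
      filtered []       = refl
      filtered (b ∷ bs) rewrite equal-enc a b with does (a ≟ b)
      ... | true  = filtered bs
      ... | false = cong (enc b ∷_) (filtered bs)

    private
      Al Bl S : List Pol
      Al = map enc As
      Bl = map enc Bs
      S = support Al

    S≡ : S ≡ map enc palette
    S≡ = support-enc As

    unique-S : Unique S
    unique-S = subst Unique (≡.sym S≡) (Unique.map⁺ enc-injective (deduplicate-! As))
      where
      import Data.List.Relation.Unary.Unique.Propositional.Properties as Unique
      open import Data.List.Relation.Unary.Unique.DecPropositional.Properties _≟_ using (deduplicate-!)

    widths-S : All (Width w) S
    widths-S = subst (All (Width w)) (≡.sym S≡) (widths palette)

    enc∈S : ∀ {a} → a ∈ As → enc a ∈ S
    enc∈S {a} a∈ = subst (enc a ∈_) (≡.sym S≡) (∈-map⁺ enc (∈-deduplicate⁺ _≟_ a∈))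

    Al⊆S : All (_∈ S) Al
    Al⊆S = All.tabulate λ u∈ → let a , a∈ , eq = ∈-map⁻ enc u∈ in subst (_∈ S) (≡.sym eq) (enc∈S a∈)

    length-Al : length Al ≡ k
    length-Al = ≡.trans (length-map enc As) (Vec.length-toList A)

    length-Bl : length Bl ≡ k
    length-Bl = ≡.trans (length-map enc Bs) (≡.trans (length-filter-∈ B) ∣B∣≡k)

    0<k : 0 < k
    0<k = >-nonZero⁻¹ k

    private
      fs : List (Pol × List Option)
      fs = grids Al

      powersOf : Pol → Pol → List Pol
      powersOf b v = nodePowers Al (addMod M b v)

      node : Choice → Pol
      node c = addMod M (proj₁ (proj₂ c)) (proj₁ c)

      tot : List (List Choice) → Pol
      tot = total fs k

    nonEmpty : ∀ us → All NonEmpty (map (λ u → u , options Al u) us)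
    nonEmpty []       = []
    nonEmpty (u ∷ us) = ℕ.≤-trans (s≤s z≤n) (ℕ.≤-reflexive (≡.sym (length-options Al u))) ∷ nonEmpty us

    gridSize-grids : gridSize fs ≡ suc k ^ (supportSize I ∸ 1)
    gridSize-grids = ≡.trans (go (drop 1 S)) (cong (suc k ^_) (≡.trans (length-drop 1 S) (cong (_∸ 1) (≡.trans (cong length S≡) (length-map enc palette)))))
      where
      open import Data.List.Properties using (length-drop)
      go : ∀ us → gridSize (map (λ u → u , options Al u) us) ≡ suc k ^ length us
      go []       = refl
      go (u ∷ us) = ≡.trans (gridSize-∷ u (options Al u) _ (All.head (nonEmpty (u ∷ []))))
        (≡.trans (cong₂ _*_ (go us) (≡.trans (length-options Al u) (cong suc length-Al))) (ℕ.*-comm (suc k ^ length us) (suc k)))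

    -- The scalar is left open: it is random in a run of the algorithm and 1 in the witness for
    -- completeness.
    Encodes : Fin m × Fin m → Choice → Set
    Encodes p c = ∃[ y ] c ≡ choice fs k S powersOf (enc (proj₂ p)) (enc (proj₁ p)) y

    node-enc : ∀ {p c} → Encodes p c → node c ≡ enc (proj₁ p +ₘ proj₂ p)
    node-enc {a , b} (_ , refl) = ≡.trans (addMod-toBits w m (toℕ b) (toℕ a) (<2^width m) (toℕ<n b) (toℕ<n a))
      (cong (toBits w) (≡.trans (cong (λ z → z % m) (ℕ.+-comm (toℕ b) (toℕ a))) (≡.sym (toℕ-fromℕ< (m%n<n (toℕ a + toℕ b) m)))))

    scalars product : List Choice → Pol
    scalars cs = ∏ cs (λ c → proj₁ (proj₂ (proj₂ c)))
    product cs = ∏ fs (λ f → weigh-up (count (proj₁ f) (map proj₁ cs)) (proj₂ f))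

    value-singles : ∀ {ps cs} → Pointwise Encodes ps cs → length cs ≡ k →
                    tot (map (_∷ []) cs) ≈ scalars cs ⊛ (vandermonde (map node cs) ⊛ product cs)
    value-singles {ps} {cs} es len = subst (λ n → total fs n (map (_∷ []) cs) ≈ scalars cs ⊛ (vandermonde (map node cs) ⊛ product cs))
        len (total-singles node fs cs (wf es))
      where
      wf : ∀ {ps ds} → Pointwise Encodes ps ds → All (λ c → ∀ j → j < length cs → nodeAt c j ≈ node c ⁿ j) ds
      wf []                = []
      wf ((_ , refl) ∷ es) = (λ j lt → ≈-trans (nodePowers-nth Al _ (true ∷ []) j (ℕ.≤-trans lt (ℕ.≤-reflexive (≡.trans len (≡.sym length-Al)))))
                               (⊛-identityˡ _)) ∷ wf es

    nodes-enc : ∀ {ps cs} → Pointwise Encodes ps cs → map node cs ≡ map enc (map (λ p → proj₁ p +ₘ proj₂ p) ps)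
    nodes-enc []                       = refl
    nodes-enc {p ∷ _} {c ∷ _} (e ∷ es) = cong₂ _∷_ (node-enc {p} {c} e) (nodes-enc es)

    colours-enc : ∀ {ps cs} → Pointwise Encodes ps cs → map proj₁ cs ≡ map enc (map proj₁ ps)
    colours-enc []                = refl
    colours-enc ((_ , refl) ∷ es) = cong (_ ∷_) (colours-enc es)

    chosen-enc : ∀ {ps cs} → Pointwise Encodes ps cs → map chosen (map (_∷ []) cs) ≡ map (λ p → enc (proj₁ p) , enc (proj₂ p)) ps
    chosen-enc []                = refl
    chosen-enc ((_ , refl) ∷ es) = cong (_ ∷_) (chosen-enc es)

    sums : List (Fin m × Fin m) → List (Fin m)
    sums = map (λ p → proj₁ p +ₘ proj₂ p)

    -- A nonzero total makes every factor in `value-singles` nonzero. The Vandermonde factor gives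
    -- distinct sums, the product the multiplicities of all colours but the first.
    module Sound {ps : List (Fin m × Fin m)} {cs : List Choice} (es : Pointwise Encodes ps cs) (len : length cs ≡ k) (colours : All (_∈ As) (map proj₁ ps))
                 (nz : tot (map (_∷ []) cs) ≉ []) where

      private
        nz′ : vandermonde (map node cs) ⊛ product cs ≉ []
        nz′ = factorʳ (scalars cs) _ (λ z → nz (≈-trans (value-singles es len) z))
        vs : List Pol
        vs = map proj₁ cs

      distinct : Unique (sums ps)
      distinct = Unique.map⁻ (subst Unique (nodes-enc es) (vandermonde-distinct _ (factorˡ _ (product cs) nz′)))
        where import Data.List.Relation.Unary.Unique.Propositional.Properties as Unique

      length-vs : length vs ≡ length Al
      length-vs = ≡.trans (length-map proj₁ cs) (≡.trans len (≡.sym length-Al))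

      counts : All (λ u → count u Al ≡ count u vs) (drop 1 S)
      counts = go (drop 1 S) (factors-nonzero _ fs (factorʳ (vandermonde (map node cs)) (product cs) nz′))
        where
        go : ∀ us → All (λ f → weigh-up (count (proj₁ f) vs) (proj₂ f) ≉ []) (map (λ u → u , options Al u) us) →
             All (λ u → count u Al ≡ count u vs) us
        go []       []       = []
        go (u ∷ us) (p ∷ ps) with count u vs ℕ.≟ count u Al
        ... | yes eq = ≡.sym eq ∷ go us ps
        ... | no ne  = ⊥-elim (p (weigh-up-vanishes Al u (count u vs) (ℕ.≤-trans (count≤length u vs) (ℕ.≤-reflexive length-vs)) ne))

      vs⊆S : All (_∈ S) vs
      vs⊆S = subst (All (_∈ S)) (≡.sym (colours-enc es)) (mapped colours)
        where
        mapped : ∀ {as} → All (_∈ As) as → All (_∈ S) (map enc as)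
        mapped []       = []
        mapped (p ∷ ps) = enc∈S p ∷ mapped ps

      encodePair : Fin m × Fin m → Pol × Pol
      encodePair p = enc (proj₁ p) , enc (proj₂ p)

      aligned : zip Al (align Al (map encodePair ps)) ↭ map encodePair ps
      aligned = align-correct w Al _ (widths As) (subst (All (Width w)) (map-∘ ps) (subst (All (Width w)) (≡.sym (map-∘ ps)) (widths (map proj₁ ps))))
        (λ u wu → ≡.trans (counts-agree w unique-S widths-S Al vs Al⊆S vs⊆S (≡.sym length-vs) counts u wu)
          (cong (count u) (≡.trans (colours-enc es) (≡.trans (≡.sym (map-∘ ps)) (map-∘ ps)))))

      -- The aligned list is a permutation of encoded pairs, hence itself the encoding of a permuted
      -- list of pairs. By injectivity of the encoding, the first components of these are A, and the
      -- second ones are the ordering sought.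
      ordering : ∃[ bs ] align Al (map encodePair ps) ≡ map enc bs × bs ↭ map proj₂ ps × Unique (zipWith _+ₘ_ As bs)
      ordering with ↭-map-inv encodePair (↭-sym aligned)
      ... | qs , eq , ps↭qs = map proj₂ qs , L≡ , map⁺ proj₂ (↭-sym ps↭qs) ,
            subst Unique (≡.sym sums≡) (Unique-resp-↭ (↭⇒↭ₛ (map⁺ (λ p → proj₁ p +ₘ proj₂ p) ps↭qs)) distinct)
        where
        open import Data.List.Relation.Binary.Permutation.Setoid.Properties (≡.setoid (Fin m)) using (Unique-resp-↭)
        L : List Pol
        L = align Al (map encodePair ps)
        unzip : ∀ (xs ys : List Pol) → length xs ≡ length ys → map proj₁ (zip xs ys) ≡ xs × map proj₂ (zip xs ys) ≡ ys
        unzip []       []       _ = refl , refl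
        unzip (x ∷ xs) (y ∷ ys) l = let e , e′ = unzip xs ys (ℕ.suc-injective l) in cong (x ∷_) e , cong (y ∷_) e′
        unzipped : map proj₁ (zip Al L) ≡ Al × map proj₂ (zip Al L) ≡ L
        unzipped = unzip Al L (≡.sym (length-mapAccL _ (map encodePair ps) Al))
        L≡ : L ≡ map enc (map proj₂ qs)
        L≡ = ≡.trans (≡.sym (proj₂ unzipped)) (≡.trans (cong (map proj₂) eq) (≡.trans (≡.sym (map-∘ qs)) (map-∘ qs)))
        As≡ : As ≡ map proj₁ qs
        As≡ = map-injective enc-injective (≡.trans (≡.sym (proj₁ unzipped)) (≡.trans (cong (map proj₁) eq) (≡.trans (≡.sym (map-∘ qs)) (map-∘ qs))))
        sums≡ : zipWith _+ₘ_ As (map proj₂ qs) ≡ sums qs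
        sums≡ = ≡.trans (cong (λ z → zipWith _+ₘ_ z (map proj₂ qs)) As≡) (go qs)
          where
          go : ∀ qs → zipWith _+ₘ_ (map proj₁ qs) (map proj₂ qs) ≡ sums qs
          go []       = refl
          go (q ∷ qs) = cong (_ ∷_) (go qs)

-- Completeness and failure probability

module Probability where

  open Folds
  open Polynomials
  open Algorithm
  open GridSum
  open Interpolation
  open Selection
  open SchwartzZippel
  open BinaryArithmetic
  open Correctness
  open Permanent polynomials ⊻-self using (vandermonde)
  open import Data.Bool using (Bool; true; false; if_then_else_; not)
  open import Data.Empty using (⊥-elim)
  open import Data.Fin using (Fin; _≟_)
  open import Data.List using (List; []; _∷_; length; map; drop; _++_; zip; zipWith)
  open import Data.List.Properties using (length-map; length-++; ++-identityʳ)
  open import Data.List.Membership.Propositional using (_∈_)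
  open import Data.List.Membership.Propositional.Properties using (∈-map⁻; ∈-deduplicate⁻)
  open import Data.List.Relation.Binary.Permutation.Propositional using (_↭_; ↭-sym; ↭⇒↭ₛ)
  open import Data.List.Relation.Binary.Permutation.Propositional.Properties using (map⁺; ↭-map-inv; ↭-length; All-resp-↭)
  open import Data.List.Relation.Binary.Pointwise as Pw using (Pointwise; []; _∷_)
  open import Data.List.Relation.Unary.All as All using (All; []; _∷_)
  open import Data.List.Relation.Unary.AllPairs as AllPairs using (AllPairs; []; _∷_)
  open import Data.List.Relation.Unary.Unique.Propositional using (Unique)
  open import Data.Nat using (ℕ; zero; suc; z≤n; s≤s; _≤_; _+_; _*_; _^_)
  open import Data.Nat.Properties hiding (_≟_)
  open import Data.Nat.Tactic.RingSolver using (solve-∀)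
  open import Data.Product using (∃-syntax; _×_; _,_; proj₁; proj₂)
  open import Data.Sum using (inj₁; inj₂)
  open import Data.Unit using (tt)
  open import Data.Vec as Vec using (Vec; []; _∷_; toList)
  import Data.Vec.Properties as Vec
  import Data.Vec.Relation.Unary.All as VecAll
  import Data.Vec.Relation.Unary.AllPairs as VecAllPairs
  import Data.Vec.Relation.Unary.Unique.Propositional as Vec
  open import Relation.Binary.PropositionalEquality as ≡ using (_≡_; _≢_; refl; cong; subst)

  toList-unique : ∀ {A : Set} {n} (v : Vec A n) → Unique (toList v) → Vec.Unique v
  toList-unique []      []       = VecAllPairs.[]
  toList-unique (x ∷ v) (p ∷ ps) = all v p VecAllPairs.∷ toList-unique v ps
    where
    all : ∀ {n} (v : Vec _ n) → All (x ≢_) (toList v) → VecAll.All (x ≢_) v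
    all []      []       = VecAll.[]
    all (y ∷ v) (q ∷ qs) = q VecAll.∷ all v qs

  unique-toList : ∀ {A : Set} {n} (v : Vec A n) → Vec.Unique v → Unique (toList v)
  unique-toList []      VecAllPairs.[]         = []
  unique-toList (x ∷ v) (p VecAllPairs.∷ ps) = all v p ∷ unique-toList v ps
    where
    all : ∀ {n} (v : Vec _ n) → VecAll.All (x ≢_) v → All (x ≢_) (toList v)
    all []      VecAll.[]         = []
    all (y ∷ v) (q VecAll.∷ qs) = q ∷ all v qs

  toList-zipWith : ∀ {A B C : Set} (f : A → B → C) {n} (u : Vec A n) v → toList (Vec.zipWith f u v) ≡ zipWith f (toList u) (toList v)
  toList-zipWith f []      []      = refl
  toList-zipWith f (x ∷ u) (y ∷ v) = cong (f x y ∷_) (toList-zipWith f u v)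

  module _ (I : Instance) where
    open Instance I

    private
      As Bs : List (Fin m)
      As = toList A
      Bs = elements B
      enc : Fin m → Pol
      enc = encodeElement I
      Al Bl S us : List Pol
      Al = map enc As
      Bl = map enc Bs
      S = support Al
      us = unary Al
      M : Pol
      M = toBits (width I) m
      fs : List (Pol × List Option)
      fs = grids Al
      powersOf : Pol → Pol → List Pol
      powersOf b v = nodePowers Al (addMod M b v)
      ne : All NonEmpty fs
      ne = nonEmpty I (drop 1 S)
      rows : Pol → List (List Choice)
      rows = mkRows M Al Bl
      n : ℕ
      n = length Bl * length S

    rows-chunks : ∀ r → rows r ≡ proj₂ (fillRows fs k S powersOf (chunks us n r) Bl)
    rows-chunks r = drawRows-chunks fs k S powersOf us Bl r

    length-rows : ∀ r → length (rows r) ≡ k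
    length-rows r = ≡.trans (length-mapAccL (mkRow M Al) r Bl) (length-Bl I)

    ChoiceFor : Pol → Choice → Set
    ChoiceFor b c = ∃[ v ] ∃[ y ] v ∈ S × c ≡ choice fs k S powersOf b v y

    choices-in-row : ∀ b ys vs → All (_∈ S) vs → All (ChoiceFor b) (proj₂ (fillRow fs k S powersOf b ys vs))
    choices-in-row b ys []       []       = []
    choices-in-row b ys (v ∷ vs) (p ∷ ps) = (v , _ , p , refl) ∷ choices-in-row b (drop 1 ys) vs ps

    choices : ∀ ys bs → Pointwise (λ b row → All (ChoiceFor b) row) bs (proj₂ (fillRows fs k S powersOf ys bs))
    choices ys []       = []
    choices ys (b ∷ bs) = choices-in-row b ys S (All.tabulate (λ p → p)) ∷ choices _ bs

    decode : ∀ bs {rs cs} → Pointwise (λ b row → All (ChoiceFor b) row) (map enc bs) rs → Pointwise _∈_ cs rs →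
             ∃[ ps ] Pointwise (Encodes I) ps cs × map proj₂ ps ≡ bs × All (_∈ As) (map proj₁ ps)
    decode []       []       []       = [] , [] , refl , []
    decode (b ∷ bs) (q ∷ qs) (c∈ ∷ cs∈) with All.lookup q c∈ | decode bs qs cs∈
    ... | v , y , v∈ , refl | ps , es , eq , as with ∈-map⁻ enc (subst (v ∈_) (S≡ I) v∈)
    ...   | a , a∈ , refl = (a , b) ∷ ps , (y , refl) ∷ es , cong (b ∷_) eq , ∈-deduplicate⁻ _≟_ As a∈ ∷ as

    gridSum-total′ : ∀ r → gridSum fs (rows r) ≈ total fs k (rows r)
    gridSum-total′ r = gridSum-total fs k ne (rows r) (0<k I) (length-rows r)

    solution : ∀ bs → bs ↭ Bs → Unique (zipWith _+ₘ_ As bs) → ∃[ b ] IsSolution I b × toList b ≡ bs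
    solution bs p u = b , record { ordersB = subst (_↭ Bs) (≡.sym eq) p
                                 ; distinctSums = toList-unique _ (subst Unique (≡.sym (≡.trans (toList-zipWith _+ₘ_ A b) (cong (zipWith _+ₘ_ As) eq))) u) } , eq
      where
      len : length bs ≡ k
      len = ≡.trans (↭-length p) (≡.trans (length-filter-∈ B) ∣B∣≡k)
      b : Vec (Fin m) k
      b = Vec.cast len (Vec.fromList bs)
      eq : toList b ≡ bs
      eq = ≡.trans (Vec.toList-cast len (Vec.fromList bs)) (Vec.toList∘fromList bs)

    found : ∀ {cs ps} → Pointwise (Encodes I) ps cs → length cs ≡ k → All (_∈ As) (map proj₁ ps) → map proj₂ ps ≡ Bs →
            total fs k (map (_∷ []) cs) ≉ [] →
            ∃[ b ] IsSolution I b × align Al (map chosen (map (_∷ []) cs)) ≡ map enc (toList b)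
    found es len as bs≡ nz =
      let bs , aligned , p , u = Sound.ordering I es len as nz
          b , sol , eq = solution bs (subst (bs ↭_) bs≡ p) u
      in b , sol , ≡.trans (cong (align Al) (chosen-enc I es)) (≡.trans aligned (cong (map enc) (≡.sym eq)))

    refine-found : ∀ rs → length rs ≡ k → Pointwise (λ b row → All (ChoiceFor b) row) Bl rs → total fs k rs ≉ [] →
                   ∃[ b ] IsSolution I b × align Al (map chosen (refine fs rs)) ≡ map enc (toList b)
    refine-found rs len shape nz =
      let cs , refined , cs∈ , nz′ = refine-correct fs k ne (0<k I) rs len nz
          ps , es , bs≡ , as = decode Bs shape cs∈
          b , sol , eq = found es (≡.trans (Pw.Pointwise-length cs∈) len) as bs≡ nz′
      in b , sol , ≡.trans (cong (λ z → align Al (map chosen z)) refined) eq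

    outcome : ∀ z out → (z ≡ false → ∃[ b ] IsSolution I b × out ≡ map enc (toList b)) →
              FailureOrSolution I (if z then inj₁ tt else inj₂ out)
    outcome true  out sol = inj₁ refl
    outcome false out sol = let b , s , eq = sol refl in inj₂ (b , s , cong inj₂ eq)

    -- Chance decides only whether the total is nonzero. Once it is, the choices that `refine` makes
    -- keep it so and lead to a solution, whatever the coins were.
    solve-correct : ∀ r → FailureOrSolution I (solve (encode I) r)
    solve-correct r = outcome (isZero (gridSum fs (rows r))) (align Al (map chosen (refine fs (rows r)))) λ z →
      refine-found (rows r) (length-rows r) (subst (Pointwise _ Bl) (≡.sym (rows-chunks r)) (choices (chunks us n r) Bl))
        (λ e → isZero-false _ z (≈-trans (gridSum-total′ r) e))

    succeeds-if : ∀ z (out : List Pol) → succeeds (if z then inj₁ tt else inj₂ out) ≡ not z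
    succeeds-if true  out = refl
    succeeds-if false out = refl

    isZero-cong : ∀ a b → a ≈ b → isZero a ≡ isZero b
    isZero-cong a b e with isZero a in z | isZero b in z′
    ... | true  | true  = refl
    ... | false | false = refl
    ... | true  | false = ⊥-elim (isZero-false b z′ (≈-trans (≈-sym e) (isZero-sound a z)))
    ... | false | true  = ⊥-elim (isZero-false a z (≈-trans e (isZero-sound b z′)))

    succeeds-solve : ∀ r → succeeds (solve (encode I) r) ≡ not (isZero (total fs k (rows r)))
    succeeds-solve r = ≡.trans (succeeds-if (isZero (gridSum fs (rows r))) (align Al (map chosen (refine fs (rows r)))))
      (cong not (isZero-cong _ _ (gridSum-total′ r)))

    randomTotal : List Pol → Pol
    randomTotal ys = total fs k (proj₂ (fillRows fs k S powersOf ys Bl))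

    randomTotal-multiaffine : MultiAffine n randomTotal
    randomTotal-multiaffine = go Bl
      where
      go : ∀ bs → MultiAffine (length bs * length S) (λ ys → total fs k (proj₂ (fillRows fs k S powersOf ys bs)))
      go []       = tt
      go (b ∷ bs) = total-multiaffine fs k S powersOf b bs

    module Complete {b : Vec (Fin m) k} (sol : IsSolution I b) where
      open IsSolution sol

      private
        qs : List (Fin m × Fin m)
        qs = zip As (toList b)

        unzipped : ∀ {n} (u v : Vec (Fin m) n) → map proj₁ (zip (toList u) (toList v)) ≡ toList u × map proj₂ (zip (toList u) (toList v)) ≡ toList v
        unzipped []      []      = refl , refl
        unzipped (x ∷ u) (y ∷ v) = let e , e′ = unzipped u v in cong (x ∷_) e , cong (y ∷_) e′

        -- A solution is listed in the order of A, but the rows follow `elements B`; the pairs are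
        -- rearranged accordingly.
        reordered : ∃[ ps ] Bs ≡ map proj₂ ps × qs ↭ ps
        reordered = ↭-map-inv proj₂ (subst (_↭ Bs) (≡.sym (proj₂ (unzipped A b))) ordersB)

        ps : List (Fin m × Fin m)
        ps = proj₁ reordered

        ps↭ : map proj₁ ps ↭ As
        ps↭ = subst (map proj₁ ps ↭_) (proj₁ (unzipped A b)) (map⁺ proj₁ (↭-sym (proj₂ (proj₂ reordered))))

        coloured : ∀ {ps} → All (_∈ As) (map proj₁ ps) → Colouring fs k S powersOf (map enc (map proj₂ ps)) (map enc (map proj₁ ps))
        coloured {[]}     []       = []
        coloured {p ∷ ps} (q ∷ qs) = enc∈S I q ∷ coloured qs

        colouring : Colouring fs k S powersOf (map enc (map proj₂ ps)) (map enc (map proj₁ ps))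
        colouring = coloured (All-resp-↭ (↭-sym ps↭) (All.tabulate (λ p → p)))

        encodes : ∀ {ps} (cs : Colouring fs k S powersOf (map enc (map proj₂ ps)) (map enc (map proj₁ ps))) →
                  Pointwise (Encodes I) ps (selected fs k S powersOf cs)
        encodes {[]}     []       = []
        encodes {p ∷ ps} (_ ∷ cs) = (_ , refl) ∷ encodes cs

        cs : List Choice
        cs = selected fs k S powersOf colouring

        es : Pointwise (Encodes I) ps cs
        es = encodes colouring

        length-cs : length cs ≡ k
        length-cs = ≡.trans (≡.sym (Pw.Pointwise-length es)) (≡.trans (≡.sym (length-map proj₁ ps)) (≡.trans (↭-length ps↭) (Vec.length-toList A)))

        unit-scalars : ∀ {bs vs} (ds : Colouring fs k S powersOf bs vs) → scalars I (selected fs k S powersOf ds) ≉ []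
        unit-scalars []       = 1≉0
        unit-scalars (_ ∷ ds) = integral (true ∷ []) _ 1≉0 (unit-scalars ds)

        distinct-nodes : AllPairs _≉_ (map enc (sums I ps))
        distinct-nodes = go (Unique-resp-↭ (↭⇒↭ₛ (map⁺ _ (proj₂ (proj₂ reordered)))) (subst Unique zipped (unique-toList _ distinctSums)))
          where
          open import Data.List.Relation.Binary.Permutation.Setoid.Properties (≡.setoid (Fin m)) using (Unique-resp-↭)
          zipped : toList (Vec.zipWith _+ₘ_ A b) ≡ sums I qs
          zipped = ≡.trans (toList-zipWith _+ₘ_ A b) (zipWith-sums As (toList b))
            where
            zipWith-sums : ∀ xs ys → zipWith _+ₘ_ xs ys ≡ sums I (zip xs ys)
            zipWith-sums []       ys       = refl
            zipWith-sums (x ∷ xs) []       = refl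
            zipWith-sums (x ∷ xs) (y ∷ ys) = cong (_ ∷_) (zipWith-sums xs ys)
          different : ∀ {a c} → a ≢ c → enc a ≉ enc c
          different {a} {c} a≢c e = a≢c (enc-injective I (≈⇒≡ _ _ (≡.trans (width-enc I a) (≡.sym (width-enc I c))) e))
          go : ∀ {xs} → Unique xs → AllPairs _≉_ (map enc xs)
          go []       = []
          go (p ∷ ps) = all p ∷ go ps
            where
            all : ∀ {x xs} → All (x ≢_) xs → All (enc x ≉_) (map enc xs)
            all []       = []
            all (q ∷ qs) = different q ∷ all qs

        colour-counts : ∀ u → count u (map proj₁ cs) ≡ count u Al
        colour-counts u = ≡.trans (cong (count u) (colours-enc I es)) (count-↭ u (map⁺ enc ps↭))

        products : product I cs ≉ []
        products = ∏-nonzero _ (go (drop 1 S))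
          where
          go : ∀ us → All (λ f → weigh-up (count (proj₁ f) (map proj₁ cs)) (proj₂ f) ≉ []) (map (λ u → u , options Al u) us)
          go []       = []
          go (u ∷ us) = subst (λ c → weigh-up c (options Al u) ≉ []) (≡.sym (colour-counts u)) (weigh-up-nonzero Al u) ∷ go us

      witness : List Pol
      witness = selectors fs k S powersOf colouring

      length-witness : length witness ≡ n
      length-witness = ≡.trans (length-selectors fs k S powersOf colouring)
        (cong (λ z → length (map enc z) * length S) (≡.sym (proj₁ (proj₂ reordered))))

      nonzero : randomTotal witness ≉ []
      nonzero e = integral _ _ (unit-scalars colouring)
          (integral _ (product I cs) (subst (λ z → vandermonde z ≉ []) (≡.sym (nodes-enc I es)) (vandermonde-nonzero distinct-nodes)) products)
          (≈-trans (≈-sym (value-singles I es length-cs)) (≈-trans (≈-sym at-witness) e))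
        where
        at-witness : randomTotal witness ≈ total fs k (map (_∷ []) cs)
        at-witness = subst (λ z → total fs k (proj₂ (fillRows fs k S powersOf witness (map enc z))) ≈ total fs k (map (_∷ []) cs))
          (≡.sym (proj₁ (proj₂ reordered)))
          (subst (λ z → z ≈ total fs k (map (_∷ []) cs)) (cong (total fs k) (++-identityʳ _))
            (subst (λ z → total fs k (proj₂ (fillRows fs k S powersOf witness (map enc (map proj₂ ps))) ++ []) ≈ total fs k z) (++-identityʳ (map (_∷ []) cs))
              (total-selected fs k S powersOf colouring [])))

    coinCount : ℕ
    coinCount = n * length us

    failures : ℕ
    failures = sumOver coinCount (λ r → indicator (not (succeeds (solve (encode I) r))))

    failures-zeros : failures ≡ zeros us n randomTotal
    failures-zeros = sumOver-cong coinCount λ r _ → cong indicator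
      (≡.trans (cong not (succeeds-solve r)) (≡.trans (not-not _) (cong (λ z → isZero (total fs k z)) (rows-chunks r))))
      where
      not-not : ∀ b → not (not b) ≡ b
      not-not true  = refl
      not-not false = refl

    n<2^n : ∀ n → suc n ≤ 2 ^ n
    n<2^n zero    = ≤-refl
    n<2^n (suc n) = +-mono-≤ (≤-trans (s≤s z≤n) (n<2^n n)) (≤-trans (n<2^n n) (≤-reflexive (≡.sym (+-identityʳ _))))

    -- With n scalars of t bits, failure has probability at most n / 2^t, which the choice of t
    -- makes at most 1/3. A solution provides the point where the total is nonzero.
    failures-bound : Solvable I → 3 * failures ≤ 2 ^ coinCount
    failures-bound (b , sol) = *-cancelˡ-≤ (2 ^ t) {{m^n≢0 2 t}} (begin
      2 ^ t * (3 * failures)                     ≡⟨ cong (λ z → 2 ^ t * (3 * z)) failures-zeros ⟩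
      2 ^ t * (3 * zeros us n randomTotal)       ≡⟨ lem (2 ^ t) (zeros us n randomTotal) ⟩
      3 * (2 ^ t * zeros us n randomTotal)       ≤⟨ *-monoʳ-≤ 3 (zeros-bound us n randomTotal witness randomTotal-multiaffine length-witness nonzero) ⟩
      3 * (n * 2 ^ coinCount)                    ≡⟨ *-assoc 3 n (2 ^ coinCount) ⟨
      3 * n * 2 ^ coinCount                      ≤⟨ *-monoˡ-≤ (2 ^ coinCount) scalars-few ⟩
      2 ^ t * 2 ^ coinCount                      ∎)
      where
      open ≤-Reasoning
      open Complete sol
      t : ℕ
      t = length us
      lem : ∀ a z → a * (3 * z) ≡ 3 * (a * z)
      lem = solve-∀
      lem′ : ∀ a b → 4 * (a * b) ≡ 2 * (2 * (a * b))
      lem′ = solve-∀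
      scalars-few : 3 * n ≤ 2 ^ t
      -- Here n = k s and t = 2 + k + s. The two extra bits of `unary` supply the factor 4 ≥ 3, the
      -- others k ≤ 2^k and s ≤ 2^s.
      scalars-few = begin
        3 * (length Bl * length S)           ≤⟨ *-mono-≤ (n≤1+n 3) (*-mono-≤ (few (length Bl)) (few (length S))) ⟩
        4 * (2 ^ length Bl * 2 ^ length S)   ≡⟨ cong (4 *_) (^-distribˡ-+-* 2 (length Bl) (length S)) ⟨
        4 * 2 ^ (length Bl + length S)       ≡⟨ cong (λ z → 4 * 2 ^ z) (≡.trans (cong (_+ length S) (≡.trans (length-Bl I) (≡.sym (length-Al I)))) (≡.sym (length-++ Al))) ⟩
        4 * 2 ^ length (Al ++ S)             ≡⟨ *-assoc 2 2 (2 ^ length (Al ++ S)) ⟩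
        2 ^ t                                ∎
        where
        few : ∀ a → a ≤ 2 ^ a
        few a = ≤-trans (n≤1+n a) (n<2^n a)

-- Coin tossing, repetition and the final time bounds

open Cost
open Folds
open Polynomials using (Pol)
open Determinant using (size-num; vec)
open DeterminantCost using (size-list≤)
open Algorithm
open AlgorithmCost using (solveᶜ; tossesᶜ; 1≤gridSize)
open SchwartzZippel using (sumOver; indicator; sumOver-cong; sumOver-++; sumOver-*)
open BinaryArithmetic using (length-toBits)
open Correctness using (encodeElement; gridSize-grids; length-Al; length-Bl)
open Probability
open import Data.Bool using (Bool; true; false; if_then_else_; not)
open import Data.Fin using (Fin; zero; suc; toℕ)
open import Data.Integer as ℤ using (+_)
import Data.Integer.Properties as ℤ
open import Data.List using (List; []; _∷_; length; map; _++_; reverse; concat; take; drop; _ʳ++_)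
open import Data.List.Properties using (length-map; length-++; ++-identityʳ; reverse-involutive; length-reverse; take++drop≡id)
open import Data.List.Relation.Unary.All as All using (All; []; _∷_)
open import Data.List.Relation.Unary.Any using (here; there)
open import Data.Nat using (ℕ; zero; suc; s≤s; _≤_; _+_; _*_; _∸_; _^_; NonZero)
open import Data.Nat.Logarithm using (⌊log₂_⌋)
open import Data.Nat.Properties
open import Data.Nat.Tactic.RingSolver using (solve-∀)
open import Data.Product using (Σ-syntax; ∃-syntax; _×_; _,_; proj₁; proj₂)
open import Data.Rational.Unnormalised as ℚᵘ using (ℚᵘ; _/_; _-_; 1ℚᵘ; *≤*)
open import Data.Sum using (inj₁; inj₂)
open import Data.Unit using (tt)
open import Data.Vec as Vec using (Vec; []; _∷_; toList)
import Data.Vec.Properties as Vec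
open import Relation.Binary.PropositionalEquality as ≡ using (_≡_; refl; cong; cong₂; subst; subst₂)

private
  tossBody : Expr (vec ⊗ num ∷ vec ∷ []) ((vec ⊗ num) ⊕ num)
  tossBody = case (uncons (fst (var (here refl)))) (inr (snd (var (there (here refl)))))
               (inl (pair (snd (var (here refl))) (cons toss (snd (var (there (here refl)))))))

-- All coins are tossed here, one for each entry of the given list. Pushing them onto an accumulator
-- leaves them in reverse order.
tossAll : Program vec num
tossAll = loop tossBody (pair (var (here refl)) nil)

-- A round copies the state twice and the split list once, at most three times the state in all; 10
-- covers the remaining constructs.
stateBound tossCost : Poly 1
stateBound = con 1 :+ (X :+ (con 1 :+ (con 2 :* X)))
tossCost = con 1 :+ ((con 1 :+ (X :+ con 1)) :+ (X :* (con 10 :+ (con 3 :* stateBound))))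

module _ (us₀ : List Pol) where
  private
    N B : ℕ
    N = size vec us₀
    B = 10 + 3 * ⟪ stateBound ⟫ N

    state≤ : ∀ us acc → size vec us ≤ N → length acc + length us ≤ N → size (vec ⊗ num) (us , acc) ≤ ⟪ stateBound ⟫ N
    state≤ us acc le le′ = s≤s (+-mono-≤ le (≤-trans (≤-reflexive (size-num acc)) (s≤s (*-monoʳ-≤ 2 (≤-trans (m≤m+n (length acc) (length us)) le′)))))

    stop-cost : ∀ S {C} → S ≤ C → suc (suc (suc (suc S) + suc (suc S))) ≤ 10 + 3 * C
    stop-cost S {C} le = ≤-trans (≤-reflexive (lem S)) (+-mono-≤ (m≤m+n 6 4) (*-mono-≤ (n≤1+n 2) le))
      where
      lem : ∀ S → suc (suc (suc (suc S) + suc (suc S))) ≡ 6 + 2 * S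
      lem = solve-∀

    step-cost : ∀ S x {C} → x ≤ S → S ≤ C → suc (suc (suc (suc S) + suc (suc (suc x + suc (1 + suc S))))) ≤ 10 + 3 * C
    step-cost S x {C} le le′ = ≤-trans (≤-reflexive (lem S x)) (+-monoʳ-≤ 10 (≤-trans (+-monoʳ-≤ (2 * S) le)
                                 (≤-trans (≤-reflexive (lem′ S)) (*-monoʳ-≤ 3 le′))))
      where
      lem : ∀ S x → suc (suc (suc (suc S) + suc (suc (suc x + suc (1 + suc S))))) ≡ 10 + (2 * S + x)
      lem = solve-∀
      lem′ : ∀ S → 2 * S + S ≡ 3 * S
      lem′ = solve-∀

  toss-loop : ∀ us r acc {ω} → length r ≡ length us → size vec us ≤ N → length acc + length us ≤ N →
              ∃[ t ] (us₀ ∷ [] ⊢loop tossBody , (us , acc) ∣ r ++ ω ⇓ r ʳ++ acc ∣ ω ∣ t) × t ≤ suc (length us) * B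
  toss-loop []       []      acc eq le le′ = _ , stop (⇓case₁ (⇓uncons (⇓fst ⇓var)) (⇓inr (⇓snd ⇓var))) ,
    ≤-trans (stop-cost (size (vec ⊗ num) ([] , acc)) (state≤ [] acc le le′)) (≤-reflexive (≡.sym (*-identityˡ B)))
  toss-loop (u ∷ us) (c ∷ r) acc eq le le′ with toss-loop us r (c ∷ acc) (suc-injective eq)
        (≤-trans (≤-trans (m≤n+m _ (size num u)) (n≤1+n _)) le) (≤-trans (≤-reflexive (≡.sym (+-suc (length acc) (length us)))) le′)
  ... | t , d , t≤ = _ , continue (⇓case₂ (⇓uncons (⇓fst ⇓var)) (⇓inl (⇓pair (⇓snd ⇓var) (⇓cons ⇓toss (⇓snd ⇓var))))) d ,
        +-mono-≤ (step-cost (size (vec ⊗ num) (u ∷ us , acc)) (size (num ⊗ vec) (u , us)) (≤-trans (m≤m+n _ (size num acc)) (n≤1+n _))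
          (state≤ (u ∷ us) acc le le′)) t≤

  tossAll-runs : ∀ r ω → length r ≡ length us₀ →
                 ∃[ t ] (us₀ ∷ [] ⊢ tossAll ∣ r ++ ω ⇓ reverse r ∣ ω ∣ t) × t ≤ ⟪ tossCost ⟫ N
  tossAll-runs r ω eq =
    let t , d , t≤ = toss-loop us₀ r [] {ω} eq ≤-refl (≤-trans (n≤1+n _) (length≤size num us₀))
    in _ , ⇓loop (⇓pair ⇓var ⇓nil) d , s≤s (+-monoʳ-≤ (1 + (N + 1)) (≤-trans t≤ (*-monoˡ-≤ B (length≤size num us₀))))

private
  colours : ⟦ InputTy ⟧ → List Pol
  colours x = proj₁ (proj₂ (proj₂ x))

  coinList : ⟦ InputTy ⟧ → List Pol
  coinList x = tosses (proj₂ (proj₂ x))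

  factor : ⟦ InputTy ⟧ → ℕ
  factor x = gridSize (grids (colours x))

abstract
  coinListᶜ : PT {InputTy} {vec} coinList
  coinListᶜ = tossesᶜ ▹ p₂ ▹ p₂

  -- Undoes the reversal by `tossAll`, so that the result is `solve` applied to the coins in the
  -- order of their tossing.
  solveReverseᶜ : Comp {InputTy ⊗ num} {OutputTy} (λ x → factor (proj₁ x)) (λ x → solve (proj₁ x) (reverse (proj₂ x)))
  solveReverseᶜ = after (λ _ → ≤-refl) solveᶜ (weigh (λ x → 1≤gridSize (grids (colours (proj₁ x)))) (pairᶜ p₁ (reverseᶜ ▹ p₂)))

transversal : Program InputTy OutputTy
transversal = call (solveReverseᶜ .prog) (pair (var (here refl)) (call tossAll (coinListᶜ .prog)))

tossedSize runtime outputSize : Poly 1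
tossedSize = con 1 :+ (X :+ (con 1 :+ (con 2 :* coinListᶜ .out)))
runtime = con 1 :+ ((con 1 :+ (X :+ (con 1 :+ (coinListᶜ .cost :+ tossCost ⊙ coinListᶜ .out)))) :+ solveReverseᶜ .cost ⊙ tossedSize)
outputSize = solveReverseᶜ .out ⊙ tossedSize

module _ (x : ⟦ InputTy ⟧) (r : List Bool) (len : length r ≡ length (coinList x)) where

  private
    n : ℕ
    n = size InputTy x

    input-small : size (InputTy ⊗ num) (x , reverse r) ≤ ⟪ tossedSize ⟫ n
    input-small = s≤s (+-monoʳ-≤ n (≤-trans (≤-reflexive (size-num (reverse r))) (s≤s (*-monoʳ-≤ 2
      (≤-trans (≤-reflexive (≡.trans (length-reverse r) len)) (≤-trans (n≤1+n _) (≤-trans (length≤size num (coinList x)) (coinListᶜ .small x))))))))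

  transversal-runs : ∀ ω → ∃[ t ] (x ∷ [] ⊢ transversal ∣ r ++ ω ⇓ solve x r ∣ ω ∣ t) × t ≤ factor x * ⟪ runtime ⟫ n
  transversal-runs ω =
    let t₁ , d₁ , le₁ = coinListᶜ .runs x (r ++ ω)
        t₂ , d₂ , le₂ = tossAll-runs (coinList x) r ω len
        t₃ , d₃ , le₃ = solveReverseᶜ .runs (x , reverse r) ω
        1≤f = 1≤gridSize (grids (colours x))
    in _ , subst (λ z → x ∷ [] ⊢ transversal ∣ r ++ ω ⇓ solve x z ∣ ω ∣ suc (suc (n + suc (t₁ + t₂)) + t₃)) (reverse-involutive r) (⇓call (⇓pair ⇓var (⇓call d₁ d₂)) d₃) ,
       step₂ {factor x} _ _ 1≤f
         (≤-trans (s≤s (+-monoʳ-≤ n (s≤s (+-mono-≤ (≤-trans le₁ (≤-reflexive (*-identityˡ _)))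
           (≤-trans le₂ (≤-⊙ tossCost (coinListᶜ .out) _ (coinListᶜ .small x))))))) (weaken 1≤f))
         (≤-trans le₃ (*-monoʳ-≤ (factor x) (≤-⊙ (solveReverseᶜ .cost) tossedSize _ input-small)))

  solve-small : size OutputTy (solve x r) ≤ ⟪ outputSize ⟫ n
  solve-small = ≤-trans (≤-reflexive (cong (λ z → size OutputTy (solve x z)) (≡.sym (reverse-involutive r))))
    (≤-trans (solveReverseᶜ .small (x , reverse r)) (≤-⊙ (solveReverseᶜ .out) tossedSize _ input-small))

length-tosses : ∀ A B → length (tosses (A , B)) ≡ length B * length (support A) * length (unary A)
length-tosses A B = ≡.trans (length-concat B (concat (map (λ _ → unary A) (support A))))
    (≡.trans (cong (length B *_) (length-concat (support A) (unary A))) (≡.sym (*-assoc (length B) (length (support A)) _)))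
  where
  length-concat : ∀ {X : Set} (xs : List X) (ys : List Pol) → length (concat (map (λ _ → ys) xs)) ≡ length xs * length ys
  length-concat []       ys = refl
  length-concat (x ∷ xs) ys = ≡.trans (length-++ ys) (cong (λ z → length ys + z) (length-concat xs ys))

/-mono : ∀ a b c d .{{_ : NonZero b}} .{{_ : NonZero d}} → a * d ≤ c * b → (+ a / b) ℚᵘ.≤ (+ c / d)
/-mono a (suc b) c (suc d) le = *≤* (subst₂ ℤ._≤_ (ℤ.pos-* a (suc d)) (ℤ.pos-* c (suc b)) (ℤ.+≤+ le))

-- The hypothesis is (t - 1) d ≤ c t with d added on both sides, which avoids truncated subtraction.
1-/-mono : ∀ t c d .{{_ : NonZero t}} .{{_ : NonZero d}} → t * d ≤ c * t + d → (1ℚᵘ - (+ 1 / t)) ℚᵘ.≤ (+ c / d)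
1-/-mono (suc t) c (suc d) le = *≤* (subst₂ ℤ._≤_ (ℤ.pos-* (t + 0) (suc d)) (ℤ.pos-* c (suc (t + 0)))
  (ℤ.+≤+ (subst (λ t → t * suc d ≤ c * suc t) (≡.sym (+-identityʳ t)) (+-cancelʳ-≤ (suc d) _ _ (≤-trans (≤-reflexive (+-comm (t * suc d) (suc d))) le)))))

#-sumOver : ∀ n (Q : List Bool → Bool) → # (λ (v : Vec Bool n) → Q (toList v)) ≡ sumOver n (λ r → indicator (Q r))
#-sumOver zero    Q = refl
#-sumOver (suc n) Q = cong₂ _+_ (#-sumOver n (λ r → Q (false ∷ r))) (#-sumOver n (λ r → Q (true ∷ r)))

sumOver-complement : ∀ n (Q : List Bool → Bool) → sumOver n (λ r → indicator (Q r)) + sumOver n (λ r → indicator (not (Q r))) ≡ 2 ^ n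
sumOver-complement zero    Q with Q []
... | true  = refl
... | false = refl
sumOver-complement (suc n) Q = ≡.trans (lem (s₁ false) _ _ _)
    (cong₂ _+_ (sumOver-complement n (λ r → Q (false ∷ r))) (≡.trans (sumOver-complement n (λ r → Q (true ∷ r))) (≡.sym (+-identityʳ _))))
  where
  s₁ : Bool → ℕ
  s₁ b = sumOver n (λ r → indicator (Q (b ∷ r)))
  lem : ∀ a b c d → a + b + (c + d) ≡ a + c + (b + d)
  lem = solve-∀

-- The function behind `repeat` for a program that uses up exactly `N` coins in each run.
retry : ℕ → (List Bool → ⟦ OutputTy ⟧) → ℕ → List Bool → ⟦ OutputTy ⟧
retry N f zero    r = inj₁ tt
retry N f (suc n) r = if succeeds (f (take N r)) then f (take N r) else retry N f n (drop N r)

take-drop : ∀ (u r : List Bool) N → length u ≡ N → take N (u ++ r) ≡ u × drop N (u ++ r) ≡ r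
take-drop []      r zero    eq = refl , refl
take-drop (x ∷ u) r (suc N) eq = let e , e′ = take-drop u r N (suc-injective eq) in cong (x ∷_) e , e′

-- The runs read disjoint blocks of coins and fail together only if each of them fails, so the
-- numbers of failing strings multiply.
retry-failures : ∀ N f n → sumOver (n * N) (λ r → indicator (not (succeeds (retry N f n r)))) ≡
                           sumOver N (λ r → indicator (not (succeeds (f r)))) ^ n
retry-failures N f zero    = refl
retry-failures N f (suc n) = ≡.trans (sumOver-++ N (n * N) _) (≡.trans (sumOver-cong N λ u eq → ≡.trans
    (sumOver-cong (n * N) λ r _ → let e , e′ = take-drop u r N eq in
       cong₂ (λ a b → indicator (not (succeeds (if succeeds (f a) then f a else retry N f n b)))) e e′)
    (split u)) (≡.trans (sumOver-* F N _) (≡.trans (*-comm F _) (cong (sumOver N (λ r → indicator (not (succeeds (f r)))) *_) (retry-failures N f n)))))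
  where
  F : ℕ
  F = sumOver (n * N) (λ r → indicator (not (succeeds (retry N f n r))))
  none : ∀ n → sumOver n (λ _ → 0) ≡ 0
  none zero    = refl
  none (suc n) = cong₂ _+_ (none n) (none n)
  split : ∀ u → sumOver (n * N) (λ r → indicator (not (succeeds (if succeeds (f u) then f u else retry N f n r)))) ≡
                F * indicator (not (succeeds (f u)))
  split u with succeeds (f u) in eq
  ... | false = ≡.sym (*-identityʳ F)
  ... | true  = ≡.trans (cong (λ b → sumOver (n * N) (λ _ → indicator (not b))) eq) (≡.trans (none (n * N)) (≡.sym (*-zeroʳ F)))

module _ (p : Program InputTy OutputTy) (x : ⟦ InputTy ⟧) (N T U : ℕ) (f : List Bool → ⟦ OutputTy ⟧)
         (p-runs : ∀ r ω → length r ≡ N → ∃[ t ] (x ∷ [] ⊢ p ∣ r ++ ω ⇓ f r ∣ ω ∣ t) × t ≤ T)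
         (f-small : ∀ r → length r ≡ N → size OutputTy (f r) ≤ U) where

  private
    D : ℕ
    -- One attempt is charged its run and, whatever its outcome, both a copy of the input for the
    -- next attempt and a copy of the solution to be returned.
    D = 2 + (T + (size InputTy x + U))

    take-length : ∀ (r : List Bool) N {a} → length r ≡ N + a → length (take N r) ≡ N
    take-length r       zero    eq = refl
    take-length (x ∷ r) (suc N) eq = cong suc (take-length r N (suc-injective eq))

    drop-length : ∀ (r : List Bool) N {a} → length r ≡ N + a → length (drop N r) ≡ a
    drop-length r       zero    eq = eq
    drop-length (x ∷ r) (suc N) eq = drop-length r N (suc-injective eq)

  RepeatRuns : ℕ → List Bool → ⟦ OutputTy ⟧ → Set
  RepeatRuns n r o = ∃[ ω ] ∃[ t ] (x ∷ [] ⊢ repeat n p ∣ r ⇓ o ∣ ω ∣ t) × t ≤ suc n * D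

  first-run : ∀ n u r o {t} → x ∷ [] ⊢ p ∣ u ++ r ⇓ o ∣ r ∣ t → t ≤ T → size OutputTy o ≤ U →
              RepeatRuns n r (retry N f n r) → RepeatRuns (suc n) (u ++ r) (if succeeds o then o else retry N f n r)
  first-run n u r (inj₂ v) d t≤ sm _ = _ , _ , ⇓case₂ d (⇓inr ⇓var) ,
    ≤-trans (s≤s (+-mono-≤ t≤ sm)) (≤-trans (≤-trans (s≤s (+-monoʳ-≤ T (m≤n+m U (size InputTy x)))) (n≤1+n _)) (m≤m+n D _))
  first-run n u r (inj₁ tt) {t} d t≤ sm (ω , t′ , d′ , t′≤) = ω , _ , ⇓case₁ d (⇓call ⇓var d′) ,
    ≤-trans (≤-reflexive (lem t (size InputTy x) t′)) (+-mono-≤ (+-monoʳ-≤ 2 (+-mono-≤ t≤ (m≤m+n _ U))) t′≤)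
    where
    lem : ∀ t s t′ → suc (t + suc (s + t′)) ≡ 2 + (t + s) + t′
    lem = solve-∀

  repeat-runs : ∀ n r → length r ≡ n * N → RepeatRuns n r (retry N f n r)
  repeat-runs zero    r eq = _ , _ , ⇓inl ⇓unit , ≤-trans (m≤m+n 2 _) (≤-reflexive (≡.sym (*-identityˡ D)))
  repeat-runs (suc n) r eq =
    let u≡ = take-length r N eq
        t , d , t≤ = p-runs (take N r) (drop N r) u≡
    in subst (λ z → RepeatRuns (suc n) z (retry N f (suc n) r)) (take++drop≡id N r)
         (first-run n (take N r) (drop N r) (f (take N r)) d t≤ (f-small (take N r) u≡) (repeat-runs n (drop N r) (drop-length r N eq)))

private
  _^ᵖ_ : ∀ {n} → Poly n → ℕ → Poly n
  q ^ᵖ zero  = con 1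
  q ^ᵖ suc n = q :* (q ^ᵖ n)

  eval-^ᵖ : ∀ {n} (q : Poly n) e xs → eval (q ^ᵖ e) xs ≡ eval q xs ^ e
  eval-^ᵖ q zero    xs = refl
  eval-^ᵖ q (suc e) xs = cong (eval q xs *_) (eval-^ᵖ q e xs)

  numSize listSize inputBound : Poly 3
  numSize = con 1 :+ (con 2 :* (con 1 :+ var (suc (suc zero))))
  listSize = con 1 :+ (var zero :* (con 1 :+ numSize))
  inputBound = con 1 :+ (numSize :+ (con 1 :+ (numSize :+ (con 1 :+ (listSize :+ listSize)))))

module _ (I : Instance) where
  open Instance I

  private
    N F : ℕ
    N = coinCount I
    F = failures I
    x : ⟦ InputTy ⟧
    x = encode I
    params : Vec ℕ 3
    params = k ∷ supportSize I ∷ ⌊log₂ m ⌋ ∷ []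

    size-toBits : ∀ a → size num (toBits (width I) a) ≤ eval numSize params
    size-toBits a = ≤-reflexive (≡.trans (size-num (toBits (width I) a)) (cong (λ z → 1 + 2 * z) (length-toBits (width I) a)))

    size-elements : ∀ as → length as ≡ k → size vec (encodeElements I as) ≤ eval listSize params
    size-elements as eq = ≤-trans (size-list≤ num (encodeElements I as) (all as))
        (s≤s (*-monoˡ-≤ _ (≤-reflexive (≡.trans (length-map _ as) eq))))
      where
      all : ∀ as → All (λ a → size num a ≤ eval numSize params) (encodeElements I as)
      all []       = []
      all (a ∷ as) = size-toBits (toℕ a) ∷ all as

  inputSize-bound : inputSize I ≤ eval inputBound params
  inputSize-bound = s≤s (+-mono-≤ (size-toBits m) (s≤s (+-mono-≤ (size-toBits k) (s≤s (+-mono-≤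
    (size-elements (toList A) (Vec.length-toList A))
    (size-elements (elements B) (≡.trans (≡.sym (length-map (encodeElement I) (elements B))) (length-Bl I))))))))

  -- A is written out entry by entry. For fixed s this turns (k + 1)^(s - 1) into a polynomial in
  -- the size of the input.
  k≤inputSize : k ≤ inputSize I
  k≤inputSize = ≤-trans (≤-reflexive (≡.sym (length-Al I))) (≤-trans (n≤1+n _) (≤-trans (length≤size num (encodeElements I (toList A)))
      (third (size num (toBits (width I) m)) (size num (toBits (width I) k)) _ (size vec (encodeElements I (elements B))))))
    where
    third : ∀ a b c d → c ≤ suc (a + suc (b + suc (c + d)))
    third a b c d = ≤-trans (m≤m+n c d) (≤-trans (n≤1+n _) (≤-trans (m≤n+m _ b) (≤-trans (n≤1+n _) (≤-trans (m≤n+m _ a) (n≤1+n _)))))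

  coins≡ : length (coinList x) ≡ N
  coins≡ = length-tosses (encodeElements I (toList A)) (encodeElements I (elements B))

  timeUsed : ℕ
  timeUsed = suc k ^ (supportSize I ∸ 1) * ⟪ runtime ⟫ (inputSize I)

  runs-on-lists : ∀ r ω → length r ≡ N → ∃[ t ] (x ∷ [] ⊢ transversal ∣ r ++ ω ⇓ solve x r ∣ ω ∣ t) × t ≤ timeUsed
  runs-on-lists r ω eq =
    let t , d , t≤ = transversal-runs x r (≡.trans eq (≡.sym coins≡)) ω
    in t , d , ≤-trans t≤ (≤-reflexive (cong (_* ⟪ runtime ⟫ (inputSize I)) (gridSize-grids I)))

  solves : ∀ T → timeUsed ≤ T → Solves transversal I T (+ 2 / 3)
  solves T le = record
    { runs = record
      { coins = N
      ; result = λ v → solve x (toList v)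
      ; halts = λ v → let t , d , t≤ = runs-on-lists (toList v) [] (Vec.length-toList v)
                      in [] , t , subst (λ r → x ∷ [] ⊢ transversal ∣ r ⇓ solve x (toList v) ∣ [] ∣ t) (++-identityʳ (toList v)) d , ≤-trans t≤ le }
    ; correct = λ v → solve-correct I (toList v)
    ; reliable = λ s → /-mono 2 3 (# (λ (v : Vec Bool N) → succeeds (solve x (toList v)))) (2 ^ N) {{_}} {{m^n≢0 2 N}} (likely s) }
    where
    likely : Solvable I → 2 * 2 ^ N ≤ # (λ (v : Vec Bool N) → succeeds (solve x (toList v))) * 3
    likely s = +-cancelʳ-≤ (3 * F) (2 * 2 ^ N) _ (begin
      2 * 2 ^ N + 3 * F       ≤⟨ +-monoʳ-≤ (2 * 2 ^ N) (failures-bound I s) ⟩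
      2 * 2 ^ N + 2 ^ N       ≡⟨ lem (2 ^ N) ⟩
      2 ^ N * 3               ≡⟨ cong (_* 3) (sumOver-complement N (λ r → succeeds (solve x r))) ⟨
      (S + F) * 3             ≡⟨ lem′ S F ⟩
      S * 3 + 3 * F           ≡⟨ cong (λ z → z * 3 + 3 * F) (#-sumOver N (λ r → succeeds (solve x r))) ⟨
      _                       ∎)
      where
      open ≤-Reasoning
      S : ℕ
      S = sumOver N (λ r → indicator (succeeds (solve x r)))
      lem : ∀ a → 2 * a + a ≡ a * 3
      lem = solve-∀
      lem′ : ∀ a b → (a + b) * 3 ≡ a * 3 + 3 * b
      lem′ = solve-∀

  solves-repeatedly : ∀ n T → 2 + (timeUsed + (inputSize I + ⟪ outputSize ⟫ (inputSize I))) ≤ T →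
                      Solves (repeat n transversal) I (suc n * T) (1ℚᵘ - _/_ (+ 1) (3 ^ n) {{m^n≢0 3 n}})
  solves-repeatedly n T le = record
    { runs = record
      { coins = n * N
      ; result = λ v → retry N (solve x) n (toList v)
      ; halts = λ v → let ω , t , d , t≤ = repeat-runs transversal x N timeUsed (⟪ outputSize ⟫ (inputSize I)) (solve x) runs-on-lists
                                             (λ r eq → solve-small x r (≡.trans eq (≡.sym coins≡))) n (toList v) (Vec.length-toList v)
                      in ω , t , d , ≤-trans t≤ (*-monoʳ-≤ (suc n) le) }
    ; correct = λ v → retry-correct n (toList v)
    ; reliable = λ s → 1-/-mono (3 ^ n) _ (2 ^ (n * N)) {{m^n≢0 3 n}} {{m^n≢0 2 (n * N)}} (likely s) }
    where
    retry-correct : ∀ n r → FailureOrSolution I (retry N (solve x) n r)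
    retry-correct zero    r = inj₁ refl
    retry-correct (suc n) r = first-of (solve x (take N r)) _ (solve-correct I (take N r)) (retry-correct n (drop N r))
      where
      first-of : ∀ o o′ → FailureOrSolution I o → FailureOrSolution I o′ → FailureOrSolution I (if succeeds o then o else o′)
      first-of (inj₁ _) o′ c c′ = c′
      first-of (inj₂ _) o′ c c′ = c
    Q : List Bool → Bool
    Q r = succeeds (retry N (solve x) n r)
    likely : Solvable I → 3 ^ n * 2 ^ (n * N) ≤ # (λ (v : Vec Bool (n * N)) → Q (toList v)) * 3 ^ n + 2 ^ (n * N)
    likely s = begin
      3 ^ n * 2 ^ (n * N)          ≡⟨ cong (3 ^ n *_) (sumOver-complement (n * N) Q) ⟨
      3 ^ n * (S + F′)             ≡⟨ lem (3 ^ n) S F′ ⟩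
      S * 3 ^ n + 3 ^ n * F′       ≡⟨ cong (λ z → S * 3 ^ n + 3 ^ n * z) (retry-failures N (solve x) n) ⟩
      S * 3 ^ n + 3 ^ n * F ^ n    ≤⟨ +-monoʳ-≤ (S * 3 ^ n) (powers n) ⟩
      S * 3 ^ n + 2 ^ (n * N)      ≡⟨ cong (λ z → z * 3 ^ n + 2 ^ (n * N)) (#-sumOver (n * N) Q) ⟨
      _                            ∎
      where
      open ≤-Reasoning
      S F′ : ℕ
      S = sumOver (n * N) (λ r → indicator (Q r))
      F′ = sumOver (n * N) (λ r → indicator (not (Q r)))
      lem : ∀ a b c → a * (b + c) ≡ b * a + a * c
      lem = solve-∀
      powers : ∀ n → 3 ^ n * F ^ n ≤ 2 ^ (n * N)
      powers zero    = ≤-refl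
      powers (suc n) = begin
        3 * 3 ^ n * (F * F ^ n)      ≡⟨ lem″ (3 ^ n) F (F ^ n) ⟩
        3 * F * (3 ^ n * F ^ n)      ≤⟨ *-mono-≤ (failures-bound I s) (powers n) ⟩
        2 ^ N * 2 ^ (n * N)          ≡⟨ ^-distribˡ-+-* 2 N (n * N) ⟨
        2 ^ (suc n * N)              ∎
        where
        lem″ : ∀ a b c → 3 * a * (b * c) ≡ 3 * b * (a * c)
        lem″ = solve-∀

theorem3p2 : (Σ[ p ∈ Program InputTy OutputTy ]
    ((Σ[ q ∈ Poly 3 ] ((I : Instance) → Solves p I (timeBound q I) (+ 2 / 3)))
    × (Σ[ q ∈ Poly 3 ] ((n : ℕ) (I : Instance) →
    Solves (repeat n p) I (suc n * timeBound q I) (1ℚᵘ - _/_ (+ 1) (3 ^ n) {{m^n≢0 3 n}})))))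
    × ((s : ℕ) → RandomizedPolyTimeSolvable (λ I → supportSize I ≡ s))
theorem3p2 =
  (transversal , (q , λ I → solves I _ (within I)) , (q′ , λ n I → solves-repeatedly I n _ (within′ I))) ,
  -- With s fixed, the exponent of the superpolynomial factor is a constant and the power becomes a
  -- polynomial.
  λ s → transversal , ((con 1 :+ X) ^ᵖ (s ∸ 1)) :* runtime , λ { I refl → solves I _ (*-monoˡ-≤ _
    (≤-trans (^-monoˡ-≤ (s ∸ 1) (s≤s (k≤inputSize I))) (≤-reflexive (≡.sym (eval-^ᵖ (con 1 :+ X) (s ∸ 1) _))))) }
  where
  q q′ : Poly 3
  q = runtime ⊙ inputBound
  -- The cost of one attempt in a repetition: its run, a copy of the input and a copy of the output.
  -- The last two also fit under the factor (k + 1)^(s - 1), which is at least 1.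
  q′ = con 2 :+ (q :+ (inputBound :+ outputSize ⊙ inputBound))
  within : ∀ I → timeUsed I ≤ timeBound q I
  within I = *-monoʳ-≤ (suc (Instance.k I) ^ (supportSize I ∸ 1)) (≤-⊙ runtime inputBound _ (inputSize-bound I))
  within′ : ∀ I → 2 + (timeUsed I + (inputSize I + ⟪ outputSize ⟫ (inputSize I))) ≤ timeBound q′ I
  within′ I = ≤-trans (+-mono-≤ (weaken 1≤G) (+-mono-≤ (within I) (≤-trans
      (+-mono-≤ (inputSize-bound I) (≤-⊙ outputSize inputBound _ (inputSize-bound I))) (weaken 1≤G))))
    (≤-reflexive (≡.trans (cong (_+_ (G * 2)) (≡.sym (*-distribˡ-+ G _ _))) (≡.sym (*-distribˡ-+ G 2 _))))
    where
    G : ℕ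
    G = suc (Instance.k I) ^ (supportSize I ∸ 1)
    1≤G : 1 ≤ G
    1≤G = m^n>0 (suc (Instance.k I)) (supportSize I ∸ 1)
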